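{- For every fixed positive integer $k$, the following problem can be solved in polynomial time: given a list $Q=(q_1,\ldots,q_k)$ of $k$ sequences of bins with pallet symbols and a positive integer $p$, decide whether there is a processing of $Q$ with at most $p$ stack-up places.
   Context: A bin $b$ carries a pallet symbol $\mathit{plt}(b)$ (a positive integer). In an instance, all bins are pairwise distinct, and for every pallet symbol occurring, the sequences together contain at least two bins destined for it. A subsequence of $q=(b_1,\ldots,b_n)$ is a suffix $q'=(b_j,\ldots,b_n)$ (possibly empty), and $q-q'=(b_1,\ldots,b_{j-1})$. A configuration is $(Q,Q')$ with $Q'=(q'_1,\ldots,q'_k)$, each $q'_j$ a subsequence of $q_j$. A pallet $t$ is open in $(Q,Q')$ if some bin for $t$ lies in some $q'_i$ and some bin for $t$ lies in some $q_j-q'_j$. A transformation step removes the first bin of one nonempty $q'_i$. A processing of $Q$ is a sequence of transformation steps transforming $(Q,Q)$ into the configuration with all sequences empty; it uses at most $p$ stack-up places if every configuration along it has at most $p$ open pallets. -}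

module Defs where

open import Data.Bool using (Bool; true)
open import Data.Digit using (Bit; toDigits)
open import Data.Fin using (Fin)
import Data.Fin.Properties as Fin
open import Data.List using (List; []; _∷_; [_]; _++_; concat; concatMap; deduplicate; filter; length; map; take)
open import Data.List.Relation.Binary.Suffix.Heterogeneous using (Suffix; here)
import Data.List.Relation.Binary.Pointwise as Pointwise
open import Data.List.Relation.Unary.All using (All)
open import Data.List.Relation.Unary.Any using (Any; any?)
open import Data.List.Relation.Unary.Enumerates.Setoid using (IsEnumeration)
open import Data.List.Relation.Unary.Unique.Propositional using (Unique)
open import Data.List.Membership.Propositional using (_∈_)
open import Data.Maybe using (Maybe; just; nothing)
import Data.Maybe as Maybe
open import Data.Nat using (ℕ; suc; NonZero; _+_; _*_; _^_; _∸_; _≤_; _≟_)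
open import Data.Product using (Σ-syntax; ∃-syntax; _×_; _,_; proj₁)
open import Data.Vec using (Vec; lookup; toList; zipWith; replicate; _[_]≔_)
  renaming (_∷_ to _∷ᵛ_; map to mapᵛ)
open import Function.Bundles using (_⇔_)
open import Function.Definitions using (Injective)
open import Relation.Binary.Construct.Closure.ReflexiveTransitive using (Star; ε; _◅_)
open import Relation.Binary.PropositionalEquality using (_≡_; _≢_; refl; setoid)
open import Relation.Nullary using (Dec)
open import Relation.Nullary.Decidable using (_×-dec_)

------------------------------------------------------------------------
-- Deterministic multitape Turing machines

data Direction : Set where
  left stay right : Direction

-- A two-way infinite tape: the cells to the left of the head (nearest first),
-- the scanned cell, and the cells to its right (nearest first). All cells not
-- listed are blank.
record Tape (Γ : Set) : Set where
  constructor tape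
  field
    leftCells  : List Γ
    scanned    : Γ
    rightCells : List Γ

module _ {Γ : Set} (blank : Γ) where

  loadTape : List Γ → Tape Γ
  loadTape []       = tape [] blank []
  loadTape (x ∷ xs) = tape [] x xs

  move : Direction → Tape Γ → Tape Γ
  move stay  t                    = t
  move left  (tape []       x rs) = tape [] blank (x ∷ rs)
  move left  (tape (l ∷ ls) x rs) = tape ls l (x ∷ rs)
  move right (tape ls x [])       = tape (x ∷ ls) blank []
  move right (tape ls x (r ∷ rs)) = tape (x ∷ ls) r rs

  writeAndMove : Γ × Direction → Tape Γ → Tape Γ
  writeAndMove (y , d) (tape ls _ rs) = move d (tape ls y rs)

record TuringMachine (Alphabet : Set) : Set₁ where
  field
    State           : Set
    states          : List State
    states-complete : IsEnumeration (setoid State) states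

    Symbol           : Set
    symbols          : List Symbol
    symbols-complete : IsEnumeration (setoid Symbol) symbols

    blank           : Symbol
    embed           : Alphabet → Symbol
    embed-injective : Injective _≡_ _≡_ embed
    embed-nonblank  : ∀ a → embed a ≢ blank

    workTapes : ℕ

  tapes : ℕ
  tapes = suc workTapes

  field
    start     : State
    accepting : State → Bool
    -- The machine halts when δ returns nothing.
    δ         : State → Vec Symbol tapes → Maybe (State × Vec (Symbol × Direction) tapes)

  MachineConfiguration : Set
  MachineConfiguration = State × Vec (Tape Symbol) tapes

  initialConfiguration : List Alphabet → MachineConfiguration
  initialConfiguration w =
    start , (loadTape blank (map embed w) ∷ᵛ replicate workTapes (loadTape blank []))

  step : MachineConfiguration → Maybe MachineConfiguration
  step (s , ts) = Maybe.map
    (λ { (s′ , actions) → s′ , zipWith (writeAndMove blank) actions ts })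
    (δ s (mapᵛ Tape.scanned ts))

  -- c ⇓[ n ] c′ : the computation from c halts after exactly n steps, in c′.
  data _⇓[_]_ : MachineConfiguration → ℕ → MachineConfiguration → Set where
    halt : ∀ {c} → step c ≡ nothing → c ⇓[ 0 ] c
    next : ∀ {c c′ c″ n} → step c ≡ just c′ → c′ ⇓[ n ] c″ → c ⇓[ suc n ] c″

------------------------------------------------------------------------
-- Polynomial-time decidability

record DecisionProblem : Set₁ where
  field
    Alphabet : Set
    Instance : Set
    encode   : Instance → List Alphabet
    Yes      : Instance → Set

DecidesInTime : (P : DecisionProblem) →
                TuringMachine (DecisionProblem.Alphabet P) → (ℕ → ℕ) → Set
DecidesInTime P M T =
  ∀ (I : Instance) → ∃[ n ] ∃[ c ]
    initialConfiguration (encode I) ⇓[ n ] c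
    × n ≤ T (length (encode I))
    × (accepting (proj₁ c) ≡ true ⇔ Yes I)
  where
  open DecisionProblem P
  open TuringMachine M

SolvableInPolynomialTime : DecisionProblem → Set₁
SolvableInPolynomialTime P =
  Σ[ M ∈ TuringMachine (DecisionProblem.Alphabet P) ]
  ∃[ a ] ∃[ d ] DecidesInTime P M (λ n → a * n ^ d + a)

------------------------------------------------------------------------
-- Bins, configurations and processings

-- The name tells apart different bins destined for the same pallet.
record Bin : Set where
  constructor bin
  field
    name             : ℕ
    plt              : ℕ
    .{{plt-nonZero}} : NonZero plt

open Bin public

Sequences : ℕ → Set
Sequences k = Vec (List Bin) k

bins : ∀ {k} → Sequences k → List Bin
bins Q = concat (toList Q)

-- q ∖ q′ is the paper's q − q′; meaningful when q′ is a suffix of q.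
_∖_ : List Bin → List Bin → List Bin
q ∖ q′ = take (length q ∸ length q′) q

module _ {k : ℕ} (Q : Sequences k) where

  record Configuration : Set where
    field
      remaining : Sequences k
      suffix    : ∀ j → Suffix _≡_ (lookup remaining j) (lookup Q j)

    removed : Fin k → List Bin
    removed j = lookup Q j ∖ lookup remaining j

  open Configuration

  initial : Configuration
  initial = record
    { remaining = Q
    ; suffix    = λ _ → here (Pointwise.refl refl)
    }

  IsFinal : Configuration → Set
  IsFinal C = ∀ j → lookup (remaining C) j ≡ []

  IsOpen : Configuration → ℕ → Set
  IsOpen C t =
    (∃[ i ] Any (λ b → plt b ≡ t) (lookup (remaining C) i)) ×
    (∃[ j ] Any (λ b → plt b ≡ t) (removed C j))

  isOpen? : ∀ C t → Dec (IsOpen C t)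
  isOpen? C t =
    Fin.any? (λ i → any? (λ b → plt b ≟ t) (lookup (remaining C) i)) ×-dec
    Fin.any? (λ j → any? (λ b → plt b ≟ t) (removed C j))

  palletSymbols : List ℕ
  palletSymbols = deduplicate _≟_ (map plt (bins Q))

  openPallets : Configuration → List ℕ
  openPallets C = filter (isOpen? C) palletSymbols

  _⟶_ : Configuration → Configuration → Set
  C ⟶ D = ∃[ i ] ∃[ b ] ∃[ bs ]
    lookup (remaining C) i ≡ b ∷ bs × remaining D ≡ remaining C [ i ]≔ bs

  Processing : Set
  Processing = ∃[ C ] Star _⟶_ initial C × IsFinal C

  along : ∀ {C D} → Star _⟶_ C D → List Configuration
  along {C} ε        = [ C ]
  along {C} (_ ◅ ss) = C ∷ along ss

  UsesAtMost : ℕ → Processing → Set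
  UsesAtMost p (_ , steps , _) = All (λ C → length (openPallets C) ≤ p) (along steps)

------------------------------------------------------------------------
-- The stack-up problem for k sequences

record StackUpInstance (k : ℕ) : Set where
  field
    sequences           : Sequences k
    places              : ℕ
    .{{places-nonZero}} : NonZero places
    bins-distinct       : Unique (bins sequences)
    twoBinsPerPallet    : ∀ t → t ∈ map plt (bins sequences) →
                          2 ≤ length (filter (λ b → plt b ≟ t) (bins sequences))

data InputSymbol : Set where
  bit                   : Bit → InputSymbol
  endNumber endSequence : InputSymbol

-- Numbers are written in binary, least significant bit first.
encodeNumber : ℕ → List InputSymbol
encodeNumber n = map bit (proj₁ (toDigits 2 n)) ++ [ endNumber ]

encodeBin : Bin → List InputSymbol
encodeBin b = encodeNumber (name b) ++ encodeNumber (plt b)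

encodeSequence : List Bin → List InputSymbol
encodeSequence q = concatMap encodeBin q ++ [ endSequence ]

encodeInstance : ∀ {k} → StackUpInstance k → List InputSymbol
encodeInstance I = encodeNumber places ++ concatMap encodeSequence (toList sequences)
  where open StackUpInstance I

StackUp : ℕ → DecisionProblem
StackUp k = record
  { Alphabet = InputSymbol
  ; Instance = StackUpInstance k
  ; encode   = encodeInstance
  ; Yes      = λ I → let open StackUpInstance I in
                     ∃[ π ] UsesAtMost sequences places π
  }

-- The positions of the heads that have been reached in the k sequences describe a configuration, so there are
-- polynomially many of them, and whether a processing can be completed from a configuration is a recursion over
-- these k-tuples of input positions. Every auxiliary notion (equality of binary pallet symbols, being open, the
-- number of open pallets, the comparison of that number with p) is likewise a recursion on tuples of input positions,
-- each given by a first-order formula over the relation itself and earlier ones. A Turing machine whose heads serve as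
-- variables computes such a relation, of arity a over B positions: it sweeps B ^ a times over the table of all B ^ a
-- tuples, replacing each entry by the value of the formula, and since the recursion decreases a rank below B ^ a, the
-- table is then correct. Quantifiers and table look-ups are loops over input positions, so the running time is a
-- polynomial that can be read off the formula.
module Submission where

open import Data.Bool using (Bool; true; false; if_then_else_; not; _∧_; _∨_; T; T?)
import Data.Bool as Bool
open import Data.Bool.Properties using (if-float; T-≡)
open import Data.Digit using (Bit; toDigits; fromDigits)
open import Data.Empty using (⊥-elim)
open import Data.Fin using (Fin; zero; suc)
import Data.Fin as Fin
import Data.Fin.Properties as Fin
open import Data.List using (List; []; _∷_; _++_; [_]; map; length; drop; take; concat; concatMap; allFin; _ʳ++_)
import Data.List as List
import Data.List.Properties as List
import Data.List.Membership.DecPropositional as DecMembership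
open import Data.List.Membership.Propositional using (_∈_; _∉_; find; lose)
open import Data.List.Membership.Propositional.Properties using
  (∈-map⁺; ∈-map⁻; ∈-++⁺ˡ; ∈-++⁺ʳ; ∈-++⁻; ∈-concatMap⁺; ∈-allFin; ∈-lookup; ∈-∃++; ∈-filter⁺; ∈-filter⁻; ∈-deduplicate⁺; ∈-deduplicate⁻)
import Data.List.Relation.Binary.Pointwise as Pointwise
open import Data.List.Relation.Binary.Suffix.Heterogeneous using (Suffix)
import Data.List.Relation.Binary.Suffix.Heterogeneous as Suffix
import Data.List.Relation.Unary.All as ListAll
import Data.List.Relation.Unary.All.Properties as ListAll
import Data.List.Relation.Unary.AllPairs as ListAllPairs
open import Data.List.Relation.Unary.Any using (Any; here; there)
import Data.List.Relation.Unary.Any as Any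
import Data.List.Relation.Unary.Any.Properties as Any
import Data.List.Relation.Unary.Unique.Propositional as ListUnique
import Data.List.Relation.Unary.Unique.Propositional.Properties as ListUnique
open import Data.List.Relation.Unary.Unique.DecPropositional.Properties using (deduplicate-!)
open import Data.Maybe using (Maybe; just; nothing)
open import Data.Nat using
  (ℕ; NonZero; zero; suc; pred; _+_; _*_; _^_; _∸_; _⊓_; _≤_; _<_; z≤n; s≤s; >-nonZero; _≟_; _<?_; _≤?_)
import Data.Nat.Properties as ℕ
open import Data.Product using (Σ; Σ-syntax; ∃-syntax; _×_; _,_; proj₁; proj₂; map₁)
open import Data.Sum using (_⊎_; inj₁; inj₂)
open import Data.Unit using (⊤; tt)
open import Data.Vec using (Vec; []; _∷_; lookup; tabulate; zipWith; toList; _[_]≔_) renaming (map to mapᵛ)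
import Data.Vec as Vec
open import Data.Vec.Properties using (lookup-replicate; lookup-zipWith; lookup-map; lookup∘tabulate)
import Data.Vec.Properties as Vec
open import Data.Vec.Relation.Unary.All using (All; []; _∷_)
import Data.Vec.Relation.Unary.All as All
import Data.Vec.Relation.Unary.All.Properties as All
open import Data.Vec.Relation.Unary.AllPairs using ([]; _∷_)
open import Data.Vec.Relation.Unary.Unique.Propositional using (Unique)
import Data.Vec.Relation.Unary.Unique.Propositional.Properties as Unique
open import Function using (_∘_; case_of_)
open import Function.Bundles using (_⇔_; mk⇔; module Equivalence)
import Relation.Binary.Definitions as Tri
open import Relation.Binary.Construct.Closure.ReflexiveTransitive using (Star; ε; _◅_)
open import Relation.Binary.PropositionalEquality using
  (_≡_; _≢_; _≗_; refl; sym; trans; cong; cong₂; subst; subst₂)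
open import Relation.Nullary using (¬_; Dec; yes; no; does; contradiction)
open import Relation.Nullary.Decidable using (dec-true; dec-false; map′; _×-dec_; _⊎-dec_; ¬?)
open import Defs

open Equivalence using (to; from)

-- Two features of the encoding shape the relations. Names and pallet symbols are written alike, so
-- the role of a number is recovered from the parity of the `endNumber`s that follow it within its
-- sequence; pointers then move by symbols, and most moves leave the configuration as it is. And p
-- is written in binary, so it may exceed every position: it enters only through the relation m ≤ p
-- for positions m, obtained digit by digit. The number of open pallets is treated likewise, as a
-- relation m ≤ count. A table is overwritten in place, in an order unrelated to the rank, so during
-- a sweep the entries of higher rank are arbitrary. Each formula is therefore proved right over
-- every table whose earlier relations and whose own entries of lower rank are right. Each round
-- then settles one more rank. Nothing has to be monotone, so a formula may negate the relation that
-- it defines, as the parity does.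

if-yes : ∀ {P A : Set} (d : Dec P) {a b : A} → P → (if does d then a else b) ≡ a
if-yes d p rewrite dec-true d p = refl

if-no : ∀ {P A : Set} (d : Dec P) {a b : A} → ¬ P → (if does d then a else b) ≡ b
if-no d ¬p rewrite dec-false d ¬p = refl

does-true : ∀ {P : Set} (d : Dec P) → does d ≡ true → P
does-true (yes p) _ = p

-- Finite types

record Finite (A : Set) : Set where
  constructor finite
  field
    elements : List A
    complete : ∀ x → x ∈ elements

open Finite public

instance
  finite-⊤ : Finite ⊤
  finite-⊤ = finite [ tt ] λ _ → here refl

  finite-Bool : Finite Bool
  finite-Bool = finite (true ∷ false ∷ []) λ { true → here refl ; false → there (here refl) }

  finite-⊎ : ∀ {A B} {{_ : Finite A}} {{_ : Finite B}} → Finite (A ⊎ B)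
  finite-⊎ {{a}} {{b}} = finite (map inj₁ (elements a) ++ map inj₂ (elements b)) λ where
    (inj₁ x) → ∈-++⁺ˡ (∈-map⁺ inj₁ (complete a x))
    (inj₂ y) → ∈-++⁺ʳ _ (∈-map⁺ inj₂ (complete b y))

  finite-Maybe : ∀ {A} {{_ : Finite A}} → Finite (Maybe A)
  finite-Maybe {{a}} = finite (nothing ∷ map just (elements a)) λ where
    nothing  → here refl
    (just x) → there (∈-map⁺ just (complete a x))

finite-Σ : ∀ {A} {B : A → Set} → Finite A → (∀ x → Finite (B x)) → Finite (Σ A B)
finite-Σ {A} {B} a b = finite (concatMap row (elements a)) λ (x , y) →
  ∈-concatMap⁺ row (Any.map (λ { refl → ∈-map⁺ (x ,_) (complete (b x) y) }) (complete a x))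
  where
  row : (x : A) → List (Σ A B)
  row x = map (x ,_) (elements (b x))

-- Structured programs on named tapes

module Programs {Symbol Name : Set} (blank : Symbol) where

  -- Programs are indexed by their exits. In act x f g, every tape y acts on the symbols scanned on x and on y;
  -- a loop repeats its body while that exits with nothing.
  data Prog : Set → Set₁ where
    act  : ∀ {E} → Name → (Symbol → E) → (Name → Symbol → Symbol → Symbol × Direction) → Prog E
    bind : ∀ {E F} {{_ : Finite E}} → Prog E → (E → Prog F) → Prog F
    loop : ∀ {E} → Prog (Maybe E) → Prog E

  -- Control points, the future states of the machine. The node of a continuation remembers the exit
  -- value that led to it, which is why `bind` demands a finite type of exits.
  Node : ∀ {E} → Prog E → Set
  Node (act _ _ _)      = ⊤
  Node (bind {E} P k)   = Node P ⊎ Σ[ e ∈ E ] Node (k e)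
  Node (loop P)         = Node P

  entry : ∀ {E} (P : Prog E) → Node P
  entry (act _ _ _) = tt
  entry (bind P k)  = inj₁ (entry P)
  entry (loop P)    = entry P

  nodes : ∀ {E} (P : Prog E) → Finite (Node P)
  nodes (act _ _ _)        = finite-⊤
  nodes (bind {{fin}} P k) = finite-⊎ {{nodes P}} {{finite-Σ fin λ e → nodes (k e)}}
  nodes (loop P)           = nodes P

  nth : List Symbol → ℕ → Symbol
  nth []       _       = blank
  nth (x ∷ _)  zero    = x
  nth (_ ∷ xs) (suc i) = nth xs i

  put : (ℕ → Symbol) → ℕ → Symbol → ℕ → Symbol
  put f i y j = if does (i ≟ j) then y else f j

  shift : Direction → ℕ → ℕ
  shift left  = pred
  shift stay  = λ i → i
  shift right = suc

  -- Cells are numbered from the leftmost listed one, and lists that differ only in trailing blanks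
  -- have the same `f`. Moving left from cell 0 would renumber the cells; `moved-at` excludes it.
  record TapeAt (f : ℕ → Symbol) (i : ℕ) (t : Tape Symbol) : Set where
    constructor _,_
    open Tape t
    field
      position : length leftCells ≡ i
      cells    : ∀ j → nth (leftCells ʳ++ (scanned ∷ rightCells)) j ≡ f j

  open TapeAt public

  nth-ʳ++ : ∀ ls {xs ys} → (∀ j → nth xs j ≡ nth ys j) → ∀ j → nth (ls ʳ++ xs) j ≡ nth (ls ʳ++ ys) j
  nth-ʳ++ []       eq = eq
  nth-ʳ++ (l ∷ ls) eq = nth-ʳ++ ls λ { zero → refl ; (suc j) → eq j }

  nth-head : ∀ ls {xs} i → nth (ls ʳ++ xs) (i + length ls) ≡ nth xs i
  nth-head [] {xs}  i = cong (nth xs) (ℕ.+-identityʳ i)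
  nth-head (l ∷ ls) {xs} i = trans (cong (nth (ls ʳ++ (l ∷ xs))) (ℕ.+-suc i (length ls))) (nth-head ls (suc i))

  nth-except : ∀ ls m {xs ys} → (∀ k → m ≢ k → nth xs k ≡ nth ys k) →
               ∀ j → m + length ls ≢ j → nth (ls ʳ++ xs) j ≡ nth (ls ʳ++ ys) j
  nth-except []       m eq j ne = eq j λ m≡j → ne (trans (ℕ.+-identityʳ m) m≡j)
  nth-except (l ∷ ls) m eq j ne = nth-except ls (suc m)
    (λ { zero _ → refl ; (suc k) ne′ → eq k λ m≡k → ne′ (cong suc m≡k) }) j
    λ eq′ → ne (trans (ℕ.+-suc m (length ls)) eq′)

  nth-write : ∀ ls {x y rs} j → nth (ls ʳ++ (y ∷ rs)) j ≡ put (nth (ls ʳ++ (x ∷ rs))) (length ls) y j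
  nth-write ls j with length ls ≟ j
  ... | yes refl = trans (nth-head ls 0) (sym (if-yes (length ls ≟ j) refl))
  ... | no ne    = trans (nth-except ls 0 (λ { zero ne′ → contradiction refl ne′ ; (suc _) _ → refl }) j ne)
                         (sym (if-no (length ls ≟ j) ne))

  scanned-at : ∀ {f i t} → TapeAt f i t → Tape.scanned t ≡ f i
  scanned-at {t = tape ls x rs} (refl , eq) = trans (sym (nth-head ls 0)) (eq (length ls))

  moved-at : ∀ {f i t} d → (d ≡ left → i ≢ 0) → TapeAt f i t → TapeAt f (shift d i) (move blank d t)
  moved-at {t = tape [] x rs}        left  ok (refl , eq) = contradiction refl (ok refl)
  moved-at {t = tape (l ∷ ls) x rs}  left  ok (refl , eq) = refl , eq
  moved-at {t = tape ls x rs}        stay  ok (refl , eq) = refl , eq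
  -- The cell appended on the right is blank, which is what `nth` reads beyond the end of a list
  -- anyway.
  moved-at {t = tape ls x []}        right ok (refl , eq) = refl , λ j →
    trans (nth-ʳ++ ls {x ∷ blank ∷ []} {x ∷ []} (λ { zero → refl ; (suc zero) → refl ; (suc (suc _)) → refl }) j) (eq j)
  moved-at {t = tape ls x (r ∷ rs)}  right ok (refl , eq) = refl , eq

  written-at : ∀ {f i ls x rs} y → TapeAt f i (tape ls x rs) → TapeAt (put f i y) i (tape ls y rs)
  written-at {f} {ls = ls} y (refl , eq) = refl , λ j → trans (nth-write ls j) (put-cong j)
    where
    put-cong : ∀ j → put (nth (ls ʳ++ _)) (length ls) y j ≡ put f (length ls) y j
    put-cong j = cong (if does (length ls ≟ j) then y else_) (eq j)

  -- Execution of programs and total correctness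

  module Compile {r : ℕ} (names : Fin r → Name) (idx : Name → Fin r) (names-idx : ∀ x → names (idx x) ≡ x) where

    Tapes : Set
    Tapes = Vec (Tape Symbol) r

    -- Passing from `P` to its continuation takes no step of its own: an exit is replaced by the
    -- entry of `k e` within the same transition, so running times simply add up.
    into-bind : ∀ {E F} {{_ : Finite E}} (P : Prog E) (k : E → Prog F) → Node P ⊎ E → Node (bind P k) ⊎ F
    into-bind P k (inj₁ n) = inj₁ (inj₁ n)
    into-bind P k (inj₂ e) = inj₁ (inj₂ (e , entry (k e)))

    into-rest : ∀ {E F} {{_ : Finite E}} (P : Prog E) (k : E → Prog F) e → Node (k e) ⊎ F → Node (bind P k) ⊎ F
    into-rest P k e (inj₁ n) = inj₁ (inj₂ (e , n))
    into-rest P k e (inj₂ f) = inj₂ f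

    into-loop : ∀ {E} (P : Prog (Maybe E)) → Node P ⊎ Maybe E → Node P ⊎ E
    into-loop P (inj₁ n)        = inj₁ n
    into-loop P (inj₂ nothing)  = inj₁ (entry P)
    into-loop P (inj₂ (just e)) = inj₂ e

    transition : ∀ {E} (P : Prog E) → Node P → Vec Symbol r → (Node P ⊎ E) × Vec (Symbol × Direction) r
    transition (act x f g) _ ss = inj₂ (f (lookup ss (idx x))) ,
      tabulate (λ i → g (names i) (lookup ss (idx x)) (lookup ss i))
    transition (bind P k) (inj₁ n)       ss = map₁ (into-bind P k) (transition P n ss)
    transition (bind P k) (inj₂ (e , n)) ss = map₁ (into-rest P k e) (transition (k e) n ss)
    transition (loop P)   n              ss = map₁ (into-loop P) (transition P n ss)

    after : ∀ {E} (P : Prog E) → Node P → Tapes → (Node P ⊎ E) × Tapes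
    after P n ts = let o , as = transition P n (mapᵛ Tape.scanned ts) in o , zipWith (writeAndMove blank) as ts

    -- A run may also begin at an exit, because the outcome of the last step is one; this is the
    -- base case of the inductions that compose runs.
    data Reaches {E} (P : Prog E) : Node P ⊎ E → Tapes → ℕ → E → Tapes → Set where
      done : ∀ {e ts} → Reaches P (inj₂ e) ts 0 e ts
      more : ∀ {n ts t e ts′} → Reaches P (proj₁ (after P n ts)) (proj₂ (after P n ts)) t e ts′ →
             Reaches P (inj₁ n) ts (suc t) e ts′

    Runs : ∀ {E} → Prog E → Tapes → ℕ → E → Tapes → Set
    Runs P = Reaches P (inj₁ (entry P))

    reaches-rest : ∀ {E F} {{_ : Finite E}} (P : Prog E) (k : E → Prog F) {e o ts t f ts′} →
                   Reaches (k e) o ts t f ts′ → Reaches (bind P k) (into-rest P k e o) ts t f ts′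
    reaches-rest P k done     = done
    reaches-rest P k (more s) = more (reaches-rest P k s)

    reaches-bind : ∀ {E F} {{_ : Finite E}} (P : Prog E) (k : E → Prog F) {e o ts t ts′ t′ f ts″} →
                   Reaches P o ts t e ts′ → Runs (k e) ts′ t′ f ts″ →
                   Reaches (bind P k) (into-bind P k o) ts (t + t′) f ts″
    reaches-bind P k done     q = reaches-rest P k q
    reaches-bind P k (more s) q = more (reaches-bind P k s q)

    reaches-loop-exit : ∀ {E} (P : Prog (Maybe E)) {e o ts t ts′} →
                        Reaches P o ts t (just e) ts′ → Reaches (loop P) (into-loop P o) ts t e ts′
    reaches-loop-exit P done     = done
    reaches-loop-exit P (more s) = more (reaches-loop-exit P s)

    reaches-loop-again : ∀ {E} (P : Prog (Maybe E)) {e o ts t ts′ t′ ts″} →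
                         Reaches P o ts t nothing ts′ → Runs (loop P) ts′ t′ e ts″ →
                         Reaches (loop P) (into-loop P o) ts (t + t′) e ts″
    reaches-loop-again P done     q = q
    reaches-loop-again P (more s) q = more (reaches-loop-again P s q)

    record Memory : Set where
      no-eta-equality
      field
        head    : Name → ℕ
        content : Name → ℕ → Symbol

    open Memory public

    at : Memory → Name → Symbol
    at s x = content s x (head s x)

    infix 4 _≈_ _⊨_

    -- Contents are functions, so memories obtained in different ways agree only pointwise; `spec-≈`
    -- makes specifications insensitive to the difference.
    record _≈_ (s s′ : Memory) : Set where
      constructor mk≈
      field
        head≈    : ∀ x → head s x ≡ head s′ x
        content≈ : ∀ x i → content s x i ≡ content s′ x i

    open _≈_ public

    ≈-refl : ∀ {s} → s ≈ s
    ≈-refl = mk≈ (λ _ → refl) (λ _ _ → refl)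

    ≈-sym : ∀ {s s′} → s ≈ s′ → s′ ≈ s
    ≈-sym (mk≈ h c) = mk≈ (λ x → sym (h x)) (λ x i → sym (c x i))

    ≈-trans : ∀ {s s′ s″} → s ≈ s′ → s′ ≈ s″ → s ≈ s″
    ≈-trans (mk≈ h c) (mk≈ h′ c′) = mk≈ (λ x → trans (h x) (h′ x)) (λ x i → trans (c x i) (c′ x i))

    record _⊨_ (ts : Tapes) (s : Memory) : Set where
      constructor mk⊨
      field
        tapeAt : ∀ i → TapeAt (content s (names i)) (head s (names i)) (lookup ts i)

    open _⊨_

    ⊨-resp : ∀ {ts s s′} → s ≈ s′ → ts ⊨ s → ts ⊨ s′
    ⊨-resp e g .tapeAt i = trans (position (tapeAt g i)) (head≈ e _) , λ j → trans (cells (tapeAt g i) j) (content≈ e _ j)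

    perform : (Name → Symbol × Direction) → Memory → Memory
    perform a s .head y    = shift (proj₂ (a y)) (head s y)
    perform a s .content y = put (content s y) (head s y) (proj₁ (a y))

    -- Total correctness with an upper bound on the time: the exact number of steps depends on the
    -- data, whereas a bound lets all branches be weakened to a common one.
    Spec : ∀ {E} → Prog E → Memory → ℕ → E → Memory → Set
    Spec P s t e s′ = ∀ ts → ts ⊨ s → ∃[ t′ ] ∃[ ts′ ] t′ ≤ t × Runs P ts t′ e ts′ × ts′ ⊨ s′

    spec-act : ∀ {E x} {f : Symbol → E} {g} {s} →
               (∀ y → proj₂ (g y (at s x) (at s y)) ≡ left → head s y ≢ 0) →
               Spec (act x f g) s 1 (f (at s x)) (perform (λ y → g y (at s x) (at s y)) s)
    spec-act {x = x} {f} {g} {s} ok ts ts⊨s = 1 , ts′ , ℕ.≤-refl , run , good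
      where
      ss = mapᵛ Tape.scanned ts

      read : ∀ i → lookup ss i ≡ at s (names i)
      read i = trans (lookup-map i Tape.scanned ts) (scanned-at (tapeAt ts⊨s i))

      readₓ : lookup ss (idx x) ≡ at s x
      readₓ = trans (read (idx x)) (cong (at s) (names-idx x))

      actions = tabulate (λ i → g (names i) (lookup ss (idx x)) (lookup ss i))

      ts′ = zipWith (writeAndMove blank) actions ts

      run : Runs (act x f g) ts 1 (f (at s x)) ts′
      run = more (subst (λ e → Reaches (act x f g) (inj₂ (f (lookup ss (idx x)))) ts′ 0 e ts′) (cong f readₓ) done)

      acted : ∀ {h i t} (a : Symbol × Direction) → (proj₂ a ≡ left → i ≢ 0) → TapeAt h i t →
              TapeAt (put h i (proj₁ a)) (shift (proj₂ a) i) (writeAndMove blank a t)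
      acted {t = tape _ _ _} (y , d) ok′ p = moved-at d ok′ (written-at y p)

      good : ts′ ⊨ perform (λ y → g y (at s x) (at s y)) s
      good .tapeAt i rewrite lookup-zipWith (writeAndMove blank) i actions ts
                   | lookup∘tabulate (λ i → g (names i) (lookup ss (idx x)) (lookup ss i)) i
                   | readₓ | read i = acted (g (names i) (at s x) (at s (names i))) (ok (names i)) (tapeAt ts⊨s i)

    spec-≈ : ∀ {E} {P : Prog E} {s s₁ t e s₂ s′} → s ≈ s₁ → Spec P s₁ t e s₂ → s₂ ≈ s′ → Spec P s t e s′
    spec-≈ e₁ p e₂ ts g with p ts (⊨-resp e₁ g)
    ... | t , ts′ , le , run , g′ = t , ts′ , le , run , ⊨-resp e₂ g′

    spec-≤ : ∀ {E} {P : Prog E} {s t t′ e s′} → t ≤ t′ → Spec P s t e s′ → Spec P s t′ e s′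
    spec-≤ le p ts g with p ts g
    ... | t , ts′ , le′ , rest = t , ts′ , ℕ.≤-trans le′ le , rest

    spec-bind : ∀ {E F} {{_ : Finite E}} {P : Prog E} {k : E → Prog F} {s t e s′ t′ f s″} →
                Spec P s t e s′ → Spec (k e) s′ t′ f s″ → Spec (bind P k) s (t + t′) f s″
    spec-bind {P = P} {k} p q ts g with p ts g
    ... | _ , ts′ , le , run , g′ with q ts′ g′
    ...   | _ , ts″ , le′ , run′ , g″ = _ , ts″ , ℕ.+-mono-≤ le le′ , reaches-bind P k run run′ , g″

    spec-exit : ∀ {E} {P : Prog (Maybe E)} {s t e s′} → Spec P s t (just e) s′ → Spec (loop P) s t e s′
    spec-exit {P = P} p ts g with p ts g
    ... | _ , ts′ , le , run , g′ = _ , ts′ , le , reaches-loop-exit P run , g′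

    -- One unrolling of the loop; with `spec-exit` as base case, every loop is specified by
    -- induction on the iterations still to come.
    spec-again : ∀ {E} {P : Prog (Maybe E)} {s t s′ t′ e s″} →
                 Spec P s t nothing s′ → Spec (loop P) s′ t′ e s″ → Spec (loop P) s (t + t′) e s″
    spec-again {P = P} p q ts g with p ts g
    ... | _ , ts′ , le , run , g′ with q ts′ g′
    ...   | _ , ts″ , le′ , run′ , g″ = _ , ts″ , ℕ.+-mono-≤ le le′ , reaches-loop-again P run run′ , g″

-- Polynomials as syntax: the cost of a program is computed by recursion on its formula, and the
-- bound by a single power is extracted once, in `poly-bound`.
data Poly : Set where
  con     : ℕ → Poly
  base    : Poly
  _⊕_ _⊗_ : Poly → Poly → Poly

infixl 6 _⊕_
infixl 7 _⊗_

⟦_⟧ₚ : Poly → ℕ → ℕ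
⟦ con c ⟧ₚ b = c
⟦ base ⟧ₚ  b = b
⟦ p ⊕ q ⟧ₚ b = ⟦ p ⟧ₚ b + ⟦ q ⟧ₚ b
⟦ p ⊗ q ⟧ₚ b = ⟦ p ⟧ₚ b * ⟦ q ⟧ₚ b

upd : ∀ {n} {A : Set} → (Fin n → A) → Fin n → A → Fin n → A
upd f x a y = if does (x Fin.≟ y) then a else f y

-- A `start` stands in cell 0 of every tape except the input and makes the left end detectable. A
-- true entry of a table is a `mark`, a false one stays `blank`.
data Symbol (A : Set) : Set where
  blank start mark : Symbol A
  letter           : A → Symbol A

isBlank isStart isMark : ∀ {A} → Symbol A → Bool
isBlank blank = true
isBlank _     = false
isStart start = true
isStart _     = false
isMark mark   = true
isMark _      = false

-- Formulas over input positions and the programs evaluating them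

module Logic (A : Set) {{finite-A : Finite A}} (V R : ℕ) (arity : Fin R → ℕ) where

  instance
    finite-Symbol : Finite (Symbol A)
    finite-Symbol = finite (blank ∷ start ∷ mark ∷ map letter (elements finite-A)) λ where
      blank      → here refl
      start      → there (here refl)
      mark       → there (there (here refl))
      (letter a) → there (there (there (∈-map⁺ letter (complete finite-A a))))

  -- The value of var x is the position of its head on a copy of the input, which starts in cell 1 behind a start cell.
  -- The entries of a table follow its start cell in lexicographic order. The remaining tapes are scratch counters.
  data Name : Set where
    input tmp    : Name
    var          : Fin V → Name
    table        : Fin R → Name
    stride round : (r : Fin R) → Fin (arity r) → Name

  indexed : ((r : Fin R) → Fin (arity r) → Name) → List Name
  indexed f = concatMap (λ r → map (f r) (allFin (arity r))) (allFin R)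

  ∈-indexed : ∀ f r i → f r i ∈ indexed f
  ∈-indexed f r i = ∈-concatMap⁺ (λ r → map (f r) (allFin (arity r)))
    (Any.map (λ { refl → ∈-map⁺ (f r) (∈-allFin i) }) (∈-allFin r))

  otherNames : List Name
  otherNames = tmp ∷ map var (allFin V) ++ map table (allFin R) ++ indexed stride ++ indexed round

  ∈-names : ∀ x → x ∈ input ∷ otherNames
  ∈-names input        = here refl
  ∈-names tmp          = there (here refl)
  ∈-names (var v)      = there (there (∈-++⁺ˡ (∈-map⁺ var (∈-allFin v))))
  ∈-names (table r)    = there (there (∈-++⁺ʳ (map var (allFin V)) (∈-++⁺ˡ (∈-map⁺ table (∈-allFin r)))))
  ∈-names (stride r i) = there (there (∈-++⁺ʳ (map var (allFin V)) (∈-++⁺ʳ (map table (allFin R))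
    (∈-++⁺ˡ (∈-indexed stride r i)))))
  ∈-names (round r i)  = there (there (∈-++⁺ʳ (map var (allFin V)) (∈-++⁺ʳ (map table (allFin R))
    (∈-++⁺ʳ (indexed stride) (∈-indexed round r i)))))

  names : Fin (suc (length otherNames)) → Name
  names = List.lookup (input ∷ otherNames)

  idx : Name → Fin (suc (length otherNames))
  idx x = Any.index (∈-names x)

  names-idx : ∀ x → names (idx x) ≡ x
  names-idx x = sym (Any.lookup-index (∈-names x))

  infix 4 _≟ⁿ_
  opaque
    _≟ⁿ_ : (x y : Name) → Dec (x ≡ y)
    x ≟ⁿ y = map′ (λ eq → trans (sym (names-idx x)) (trans (cong names eq) (names-idx y))) (cong idx) (idx x Fin.≟ idx y)

  open Programs {Symbol A} {Name} blank public
  open Compile names idx names-idx public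

  moveOn : ∀ {E} → Name → (Symbol A → E × Direction) → Prog E
  moveOn x f = act x (proj₁ ∘ f) λ y a b → b , (if does (x ≟ⁿ y) then proj₂ (f a) else stay)

  writeOn : Name → Symbol A → Prog ⊤
  writeOn x a = act x (λ _ → tt) λ y _ b → (if does (x ≟ⁿ y) then a else b) , stay

  setHead : Name → ℕ → Memory → Memory
  setHead x i s .head y  = if does (x ≟ⁿ y) then i else head s y
  setHead x i s .content = content s

  head-same : ∀ x {i s} → head (setHead x i s) x ≡ i
  head-same x = if-yes (x ≟ⁿ x) refl

  head-other : ∀ {x y i} s → x ≢ y → head (setHead x i s) y ≡ head s y
  head-other {x} {y} s x≢y = if-no (x ≟ⁿ y) x≢y

  setHead-≡ : ∀ {x i i′ s} → i ≡ i′ → setHead x i s ≈ setHead x i′ s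
  setHead-≡ refl = ≈-refl

  setHead-cong : ∀ {x i s s′} → s ≈ s′ → setHead x i s ≈ setHead x i s′
  setHead-cong {x} {i} e = mk≈ (λ y → cong (if does (x ≟ⁿ y) then i else_) (head≈ e y)) (content≈ e)

  setHead-self : ∀ {x i s} → head s x ≡ i → setHead x i s ≈ s
  setHead-self {x} {i} {s} eq = mk≈ go (λ _ _ → refl)
    where
    go : ∀ y → head (setHead x i s) y ≡ head s y
    go y with x ≟ⁿ y
    ... | yes refl = sym eq
    ... | no x≢y   = refl

  setHead-twice : ∀ {x i j} s → setHead x i (setHead x j s) ≈ setHead x i s
  setHead-twice {x} {i} {j} s = mk≈ go (λ _ _ → refl)
    where
    go : ∀ y → head (setHead x i (setHead x j s)) y ≡ head (setHead x i s) y
    go y with x ≟ⁿ y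
    ... | yes refl = refl
    ... | no x≢y   = refl

  setHead-comm : ∀ {x y i j} s → x ≢ y → setHead x i (setHead y j s) ≈ setHead y j (setHead x i s)
  setHead-comm {x} {y} {i} {j} s x≢y = mk≈ go (λ _ _ → refl)
    where
    go : ∀ z → head (setHead x i (setHead y j s)) z ≡ head (setHead y j (setHead x i s)) z
    go z with x ≟ⁿ z | y ≟ⁿ z
    ... | yes refl | yes refl = contradiction refl x≢y
    ... | yes refl | no _     = refl
    ... | no _     | yes refl = refl
    ... | no _     | no _     = refl

  setContent : Name → ℕ → Symbol A → Memory → Memory
  setContent x i a s .head      = head s
  setContent x i a s .content y = if does (x ≟ⁿ y) then put (content s y) i a else content s y

  put-self : ∀ f i j → put f i (f i) j ≡ f j
  put-self f i j with i ≟ j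
  ... | yes refl = if-yes (i ≟ i) refl
  ... | no i≢j   = if-no (i ≟ j) i≢j

  spec-moveOn : ∀ {E x} {f : Symbol A → E × Direction} {s} → (proj₂ (f (at s x)) ≡ left → head s x ≢ 0) →
                Spec (moveOn x f) s 1 (proj₁ (f (at s x))) (setHead x (shift (proj₂ (f (at s x))) (head s x)) s)
  spec-moveOn {x = x} {f} {s} ok = spec-≈ ≈-refl (spec-act ok′) (mk≈ moved λ y → put-self (content s y) (head s y))
    where
    d = proj₂ (f (at s x))

    ok′ : ∀ y → (if does (x ≟ⁿ y) then d else stay) ≡ left → head s y ≢ 0
    ok′ y eq with x ≟ⁿ y
    ... | yes refl = ok eq
    ... | no x≢y   = contradiction eq λ ()

    moved : ∀ y → shift (if does (x ≟ⁿ y) then d else stay) (head s y) ≡ head (setHead x (shift d (head s x)) s) y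
    moved y with x ≟ⁿ y
    ... | yes refl = refl
    ... | no x≢y   = refl

  spec-writeOn : ∀ {x a s} → Spec (writeOn x a) s 1 tt (setContent x (head s x) a s)
  spec-writeOn {x} {a} {s} = spec-≈ ≈-refl (spec-act λ _ ()) (mk≈ (λ _ → refl) written)
    where
    written : ∀ y i → put (content s y) (head s y) (if does (x ≟ⁿ y) then a else at s y) i ≡
                      content (setContent x (head s x) a s) y i
    written y i with x ≟ⁿ y
    ... | yes refl = refl
    ... | no x≢y   = put-self (content s y) (head s y) i

  ret : ∀ {E} → E → Prog E
  ret e = moveOn input λ _ → e , stay

  spec-ret : ∀ {E} {e : E} {s} → Spec (ret e) s 1 e s
  spec-ret = spec-≈ ≈-refl (spec-moveOn λ ()) (setHead-self refl)

  infixr 5 _then_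
  _then_ : ∀ {E} → Prog ⊤ → Prog E → Prog E
  P then Q = bind P λ _ → Q

  advance : Name → Prog ⊤
  advance x = moveOn x λ _ → tt , right

  spec-advance : ∀ {x s} → Spec (advance x) s 1 tt (setHead x (suc (head s x)) s)
  spec-advance = spec-moveOn λ ()

  retreat : Name → Prog ⊤
  retreat x = moveOn x λ _ → tt , left

  down : Name → Prog Bool
  down x = moveOn x λ a → if isStart a then true , stay else false , left

  up : Name → Prog Bool
  up x = moveOn x λ a → if isBlank a then true , stay else false , right

  rewind : Name → Prog ⊤
  rewind x = loop (bind (down x) λ b → ret (if b then just tt else nothing))

  -- Tries the positions from 0 up to and including the first blank, and returns the head to 0,
  -- where the next search expects it.
  search : Name → Prog Bool → Prog Bool
  search y body = bind (loop (bind body λ b → if b then ret (just true) else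
                              bind (up y) λ e → ret (if e then just false else nothing)))
                       λ b → rewind y then ret b

  -- A search that never succeeds visits every position.
  for : Name → Prog ⊤ → Prog ⊤
  for y body = bind (search y (body then ret false)) λ _ → ret tt

  repeat : ∀ m → (Fin m → Name) → Prog ⊤ → Prog ⊤
  repeat zero    f P = P
  repeat (suc m) f P = for (f zero) (repeat m (f ∘ suc) P)

  transfer : Name → Name → Prog ⊤ → Prog ⊤
  transfer x y body = loop (bind (down x) λ b → if b then ret (just tt) else
                            (advance y then body then ret nothing))

  -- The variables are the digits of an address in base B: for each unit of `x` the head of `t`
  -- advances B ^ m cells, counted by nested loops over scratch tapes. The value of `x` is consumed
  -- in the process, hence parked on `tmp` and brought back.
  goTo : ∀ {m} → Name → Vec (Fin V) m → (Fin m → Name) → Prog ⊤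
  goTo t []               f = ret tt
  goTo t (_∷_ {m} x xs)   f = transfer (var x) tmp (repeat m (f ∘ suc) (advance t)) then
                              transfer tmp (var x) (ret tt) then
                              goTo t xs (f ∘ suc)

  infixr 6 _∧ᶠ_
  infixr 5 _∨ᶠ_

  data Form : Set where
    is        : (x : Fin V) (p : Symbol A → Bool) → Form
    next prev : (x : Fin V) (φ : Form) → Form
    ex        : (x : Fin V) (φ : Form) → Form
    call      : (r : Fin R) → Vec (Fin V) (arity r) → Form
    _∧ᶠ_ _∨ᶠ_ : (φ ψ : Form) → Form
    ~ᶠ_       : (φ : Form) → Form

  eval : Form → Prog Bool
  eval (is x p)    = moveOn (var x) λ a → p a , stay
  eval (next x φ)  = bind (up (var x)) λ e → if e then ret false else
                     bind (eval φ) λ b → retreat (var x) then ret b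
  eval (prev x φ)  = bind (down (var x)) λ e → if e then ret false else
                     bind (eval φ) λ b → advance (var x) then ret b
  eval (ex x φ)    = search (var x) (eval φ)
  -- One further advance, because cell 0 of a table holds its `start` and entry i lies in cell i +
  -- 1.
  eval (call r xs) = goTo (table r) xs (stride r) then advance (table r) then
                     bind (moveOn (table r) λ a → isMark a , stay) λ b → rewind (table r) then ret b
  eval (φ ∧ᶠ ψ)    = bind (eval φ) λ b → if b then eval ψ else ret false
  eval (φ ∨ᶠ ψ)    = bind (eval φ) λ b → if b then ret true else eval ψ
  eval (~ᶠ φ)      = bind (eval φ) λ b → ret (not b)

  forAll : ∀ {m} → Vec (Fin V) m → Prog ⊤ → Prog ⊤
  forAll []       P = P
  forAll (x ∷ xs) P = for (var x) (forAll xs P)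

  -- The table is updated in place: an entry may be computed from values written earlier in the same
  -- sweep. Rounds are counted on tapes of their own, as the sweep occupies the variables.
  define : (r : Fin R) → Vec (Fin V) (arity r) → Form → Prog ⊤
  define r xs φ = repeat (arity r) (round r) (forAll xs (bind (eval φ) λ b →
    goTo (table r) xs (stride r) then advance (table r) then
    writeOn (table r) (if b then mark else blank) then rewind (table r)))

  -- At most B iterations, each with the body and two further steps; then a rewind with two steps
  -- per position, and the final return.
  searchCost : Poly → Poly
  searchCost p = base ⊗ (p ⊕ con 2) ⊕ (base ⊗ con 2 ⊕ con 1)

  forCost : Poly → Poly
  forCost p = searchCost (p ⊕ con 1) ⊕ con 1

  repeatCost : ℕ → Poly → Poly
  repeatCost zero    p = p
  repeatCost (suc m) p = forCost (repeatCost m p)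

  transferCost : Poly → Poly
  transferCost p = base ⊗ (p ⊕ con 3)

  goToCost : ℕ → Poly
  goToCost zero    = con 1
  goToCost (suc m) = transferCost (repeatCost m (con 1)) ⊕ (transferCost (con 1) ⊕ goToCost m)

  power : ℕ → Poly
  power zero    = con 1
  power (suc m) = base ⊗ power m

  -- The last entry of the table lies in cell B ^ m, so at most B ^ m + 1 cells are visited, with
  -- two steps each.
  rewindCost : ℕ → Poly
  rewindCost m = (power m ⊕ con 1) ⊗ con 2

  cost : Form → Poly
  cost (is x p)    = con 1
  cost (next x φ)  = con 1 ⊕ (cost φ ⊕ con 2)
  cost (prev x φ)  = con 1 ⊕ (cost φ ⊕ con 2)
  cost (ex x φ)    = searchCost (cost φ)
  cost (call r xs) = goToCost (arity r) ⊕ (con 1 ⊕ (con 1 ⊕ (rewindCost (arity r) ⊕ con 1)))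
  cost (φ ∧ᶠ ψ)    = cost φ ⊕ (cost ψ ⊕ con 1)
  cost (φ ∨ᶠ ψ)    = cost φ ⊕ (cost ψ ⊕ con 1)
  cost (~ᶠ φ)      = cost φ ⊕ con 1

  defineCost : Fin R → Form → Poly
  defineCost r φ = repeatCost (arity r) (repeatCost (arity r)
    (cost φ ⊕ (goToCost (arity r) ⊕ (con 1 ⊕ (con 1 ⊕ rewindCost (arity r))))))

  -- Specifications of the basic movements and loops

  spec-exit-≡ : ∀ {E} {P : Prog E} {s t e e′ s′} → e ≡ e′ → Spec P s t e s′ → Spec P s t e′ s′
  spec-exit-≡ refl p = p

  spec-move : ∀ {E x} {f : Symbol A → E × Direction} {s e d} → f (at s x) ≡ (e , d) →
              (d ≡ left → head s x ≢ 0) → Spec (moveOn x f) s 1 e (setHead x (shift d (head s x)) s)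
  spec-move {x = x} {f} {s} eq ok =
    subst (λ p → Spec (moveOn x f) s 1 (proj₁ p) (setHead x (shift (proj₂ p) (head s x)) s)) eq
      (spec-moveOn λ d≡left → ok (trans (cong proj₂ (sym eq)) d≡left))

  spec-retreat : ∀ {x s} → head s x ≢ 0 → Spec (retreat x) s 1 tt (setHead x (pred (head s x)) s)
  spec-retreat ne = spec-moveOn λ _ → ne

  spec-down-start : ∀ {x s} → isStart (at s x) ≡ true → Spec (down x) s 1 true s
  spec-down-start eq = spec-≈ ≈-refl (spec-move (cong (if_then _ else _) eq) λ ()) (setHead-self refl)

  spec-down-left : ∀ {x s} → isStart (at s x) ≡ false → head s x ≢ 0 →
                   Spec (down x) s 1 false (setHead x (pred (head s x)) s)
  spec-down-left eq ne = spec-move (cong (if_then _ else _) eq) λ _ → ne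

  spec-up-blank : ∀ {x s} → isBlank (at s x) ≡ true → Spec (up x) s 1 true s
  spec-up-blank eq = spec-≈ ≈-refl (spec-move (cong (if_then _ else _) eq) λ ()) (setHead-self refl)

  spec-up-right : ∀ {x s} → isBlank (at s x) ≡ false → Spec (up x) s 1 false (setHead x (suc (head s x)) s)
  spec-up-right eq = spec-move (cong (if_then _ else _) eq) λ ()

  at-setHead : ∀ {x i} s → at (setHead x i s) x ≡ content s x i
  at-setHead {x} s = cong (content s x) (head-same x {s = s})

  Anchored : Memory → Name → Set
  Anchored s x = isStart (content s x 0) ≡ true × (∀ i → isStart (content s x (suc i)) ≡ false)

  spec-down-zero : ∀ {x s} → Anchored s x → Spec (down x) (setHead x 0 s) 1 true (setHead x 0 s)
  spec-down-zero {s = s} (a , _) = spec-down-start (trans (cong isStart (at-setHead s)) a)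

  spec-down-suc : ∀ {x s} i → Anchored s x → Spec (down x) (setHead x (suc i) s) 1 false (setHead x i s)
  spec-down-suc {x} {s} i (_ , a) = spec-≈ ≈-refl
    (spec-down-left (trans (cong isStart (at-setHead s)) (a i)) λ eq → contradiction (trans (sym (head-same x {s = s})) eq) λ ())
    (≈-trans (setHead-twice s) (setHead-≡ (cong pred (head-same x {s = s}))))

  spec-rewind : ∀ {x s} → Anchored s x → ∀ i → Spec (rewind x) (setHead x i s) (suc i * 2) tt (setHead x 0 s)
  spec-rewind a zero    = spec-exit (spec-bind (spec-down-zero a) spec-ret)
  spec-rewind a (suc i) = spec-again (spec-bind (spec-down-suc i a) spec-ret) (spec-rewind a i)

  -- `σ k` is the memory after `k` executions of the body, up to the heads of `x` and `y`. Leaving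
  -- `σ` abstract serves both uses in `goTo`: moving the head of a table, and bringing a value back
  -- with an idle body.
  spec-transfer : ∀ {x y body t} (σ : ℕ → Memory) → x ≢ y → (∀ k → Anchored (σ k) x) →
                  (∀ i j k → Spec body (setHead x i (setHead y j (σ k))) t tt (setHead x i (setHead y j (σ (suc k))))) →
                  ∀ i j k → Spec (transfer x y body) (setHead x i (setHead y j (σ k))) (suc i * (t + 3)) tt
                              (setHead x 0 (setHead y (i + j) (σ (i + k))))
  spec-transfer {t = t} σ x≢y a bodies zero j k =
    spec-≤ (ℕ.≤-trans (s≤s (s≤s z≤n)) (ℕ.≤-trans (ℕ.m≤n+m 3 t) (ℕ.m≤m+n (t + 3) 0)))
      (spec-exit (spec-bind (spec-down-zero (a k)) spec-ret))
  spec-transfer {x} {y} {t = t} σ x≢y a bodies (suc i) j k =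
    spec-≤ (ℕ.≤-reflexive (cong (_+ suc i * (t + 3)) (trans (cong (λ n → suc (suc n)) (ℕ.+-comm t 1)) (ℕ.+-comm 3 t))))
      (spec-≈ ≈-refl
        (spec-again (spec-bind (spec-down-suc i (a k)) (spec-bind moved (spec-bind (bodies i (suc j) k) spec-ret)))
          (spec-transfer σ x≢y a bodies i (suc j) (suc k)))
        (setHead-cong (≈-trans (setHead-≡ (ℕ.+-suc i j)) (setHead-cong (subst (λ n → σ (i + suc k) ≈ σ n) (ℕ.+-suc i k) ≈-refl)))))
    where
    moved : Spec (advance y) (setHead x i (setHead y j (σ k))) 1 tt (setHead x i (setHead y (suc j) (σ k)))
    moved = spec-≈ ≈-refl spec-advance
      (≈-trans (setHead-≡ (cong suc (trans (head-other (setHead y j (σ k)) x≢y) (head-same y {s = σ k}))))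
        (≈-trans (setHead-comm (setHead y j (σ k)) (x≢y ∘ sym)) (setHead-cong (setHead-twice (σ k)))))

  -- The least `i < n` with `b i`, or `n` if there is none: the position where a search halts.
  stop : (ℕ → Bool) → ℕ → ℕ
  stop b zero    = zero
  stop b (suc n) = if b 0 then 0 else suc (stop (b ∘ suc) n)

  stop≤ : ∀ b n → stop b n ≤ n
  stop≤ b zero = z≤n
  stop≤ b (suc n) with b 0
  ... | true  = z≤n
  ... | false = s≤s (stop≤ (b ∘ suc) n)

  before-stop : ∀ b n i → i < stop b n → b i ≡ false
  before-stop b (suc n) i i<s with b 0 in eq
  before-stop b (suc n) zero    i<s       | false = eq
  before-stop b (suc n) (suc i) (s≤s i<s) | false = before-stop (b ∘ suc) n i i<s

  at-stop : ∀ b n → b (stop b n) ≡ true ⊎ stop b n ≡ n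
  at-stop b zero = inj₂ refl
  at-stop b (suc n) with b 0 in eq
  ... | true  = inj₁ eq
  ... | false with at-stop (b ∘ suc) n
  ...   | inj₁ p = inj₁ p
  ...   | inj₂ p = inj₂ (cong suc p)

  -- Semantics of formulas and correctness of their evaluation

  module Semantics (w : List A) where

    last B : ℕ
    last = suc (length w)
    B    = suc last

    word : ℕ → Symbol A
    word zero    = start
    word (suc i) = nth (map letter w) i

    nth-letter : ∀ (v : List A) i → i < length v → isBlank (nth (map letter v) i) ≡ false
    nth-letter (a ∷ v) zero    _         = refl
    nth-letter (a ∷ v) (suc i) (s≤s i<n) = nth-letter v i i<n

    nth-blank : ∀ (v : List A) → isBlank (nth (map letter v) (length v)) ≡ true
    nth-blank []      = refl
    nth-blank (a ∷ v) = nth-blank v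

    nth-start : ∀ (v : List A) i → isStart (nth (map letter v) i) ≡ false
    nth-start []      i       = refl
    nth-start (a ∷ v) zero    = refl
    nth-start (a ∷ v) (suc i) = nth-start v i

    word-anchored : ∀ {s x} → content s x ≗ word → Anchored s x
    word-anchored eq = cong isStart (eq 0) , λ i → trans (cong isStart (eq (suc i))) (nth-start w i)

    word-inside : ∀ i → i < last → isBlank (word i) ≡ false
    word-inside zero    _         = refl
    word-inside (suc i) (s≤s i<n) = nth-letter w i i<n

    spec-search : ∀ {y body t} (σ : ℕ → Memory) (b : ℕ → Bool) →
                  let m = stop b last in
                  (∀ i → content (σ i) y ≗ word) →
                  (∀ i → i ≤ last → Spec body (setHead y i (σ i)) t (b i) (setHead y i (σ (suc i)))) →
                  head (σ 0) y ≡ 0 →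
                  Spec (search y body) (σ 0) (B * (t + 2) + (B * 2 + 1)) (b m) (setHead y 0 (σ (suc m)))
    spec-search {y} {body} {t} σ b words bodies h = spec-≈ (≈-sym (setHead-self h))
      (spec-≤ (ℕ.+-mono-≤ (ℕ.*-monoˡ-≤ (t + 2) m<B) (ℕ.+-monoˡ-≤ 1 (ℕ.*-monoˡ-≤ 2 m<B)))
        (spec-bind (iterations m 0 (ℕ.+-identityʳ m))
          (spec-bind (spec-rewind (word-anchored {σ (suc m)} (words (suc m))) m) spec-ret)))
      ≈-refl
      where
      m = stop b last

      m<B : suc m ≤ B
      m<B = s≤s (stop≤ b last)

      inside : ∀ {i} j → isBlank (at (setHead y i (σ j)) y) ≡ isBlank (word i)
      inside {i} j = cong isBlank (trans (at-setHead (σ j)) (words j i))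

      L : Prog (Maybe Bool)
      L = bind body λ b → if b then ret (just true) else bind (up y) λ e → ret (if e then just false else nothing)

      finish : ∀ c → b m ≡ c → b m ≡ true ⊎ m ≡ last → Spec (loop L) (setHead y m (σ m)) (t + 2) (b m) (setHead y m (σ (suc m)))
      finish true eq _ = spec-exit-≡ (sym eq) (spec-≤ (ℕ.+-monoʳ-≤ t (s≤s z≤n))
        (spec-exit (spec-bind (spec-exit-≡ eq (bodies m (stop≤ b last))) spec-ret)))
      finish false eq (inj₁ eq′) = contradiction (trans (sym eq) eq′) λ ()
      -- A failing test at the stopping position means that this is the last one, and the blank
      -- found there ends the loop.
      finish false eq (inj₂ m≡last) = spec-exit-≡ (sym eq)
        (spec-exit (spec-bind (spec-exit-≡ eq (bodies m (stop≤ b last)))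
          (spec-bind (spec-up-blank (trans (inside (suc m)) (trans (cong (isBlank ∘ word) m≡last) (nth-blank w)))) spec-ret)))

      iterations : ∀ d i → d + i ≡ m → Spec (loop L) (setHead y i (σ i)) (suc d * (t + 2)) (b m) (setHead y m (σ (suc m)))
      iterations zero    i refl = spec-≤ (ℕ.m≤m+n (t + 2) 0) (finish (b m) refl (at-stop b last))
      iterations (suc d) i d+i≡m = spec-again
        (spec-bind (spec-exit-≡ (before-stop b last i i<m) (bodies i (ℕ.<⇒≤ i<last)))
          (spec-bind (spec-≈ ≈-refl (spec-up-right (trans (inside (suc i)) (word-inside i i<last)))
              (≈-trans (setHead-≡ (cong suc (head-same y {s = σ (suc i)}))) (setHead-twice (σ (suc i)))))
            spec-ret))
        (iterations d (suc i) (trans (ℕ.+-suc d i) d+i≡m))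
        where
        i<m : i < m
        i<m = subst (suc i ≤_) d+i≡m (s≤s (ℕ.m≤n+m i d))
        i<last : i < last
        i<last = ℕ.<-≤-trans i<m (stop≤ b last)

    stop-false : ∀ n → stop (λ _ → false) n ≡ n
    stop-false zero    = refl
    stop-false (suc n) = cong suc (stop-false n)

    spec-for : ∀ {y body p} (σ : ℕ → Memory) → (∀ i → content (σ i) y ≗ word) →
               (∀ i → i ≤ last → Spec body (setHead y i (σ i)) (⟦ p ⟧ₚ B) tt (setHead y i (σ (suc i)))) →
               head (σ 0) y ≡ 0 →
               Spec (for y body) (σ 0) (⟦ forCost p ⟧ₚ B) tt (setHead y 0 (σ B))
    spec-for {y} {body} {p} σ words bodies h = spec-bind
      (subst (λ m → Spec (search y (body then ret false)) (σ 0) (⟦ searchCost (p ⊕ con 1) ⟧ₚ B) false (setHead y 0 (σ (suc m)))) (stop-false last)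
        (spec-search {t = ⟦ p ⟧ₚ B + 1} σ (λ _ → false) words (λ i i≤ → spec-bind (bodies i i≤) spec-ret) h))
      spec-ret

    -- Nested loops must count on different tapes, whence the injectivity of `g`. Every counter is
    -- back at 0 afterwards, so only the head of the table has moved.
    spec-repeat-advance : ∀ {r} m (g : Fin m → Fin (arity r)) → (∀ {i j} → g i ≡ g j → i ≡ j) → ∀ {s} →
      (∀ i → head s (stride r (g i)) ≡ 0) → (∀ i → content s (stride r (g i)) ≗ word) →
      Spec (repeat m (stride r ∘ g) (advance (table r))) s (⟦ repeatCost m (con 1) ⟧ₚ B) tt
        (setHead (table r) (B ^ m + head s (table r)) s)
    spec-repeat-advance zero    g inj hs ws = spec-advance
    spec-repeat-advance {r} (suc m) g inj {s} hs ws = spec-≈ (≈-sym (setHead-self refl))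
      (spec-for {y} {p = repeatCost m (con 1)} σ (λ _ → ws zero) bodies (trans (head-other {x} s λ ()) (hs zero)))
      (setHead-self (trans (head-other {x} s λ ()) (hs zero)))
      where
      x = table r
      y = stride r (g zero)

      σ : ℕ → Memory
      σ i = setHead x (i * B ^ m + head s x) s

      fresh : ∀ {i j n} → head (setHead y i (setHead x n s)) (stride r (g (suc j))) ≡ 0
      fresh {j = j} {n} = trans (head-other (setHead x n s) λ eq → 0≢1+ (inj (stride-injective eq))) (trans (head-other {x} s λ ()) (hs (suc j)))
        where
        0≢1+ : zero ≢ suc j
        0≢1+ ()
        stride-injective : ∀ {i j} → stride r i ≡ stride r j → i ≡ j
        stride-injective refl = refl

      bodies : ∀ i → i ≤ last → Spec _ (setHead y i (σ i)) _ tt (setHead y i (σ (suc i)))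
      bodies i _ = spec-≈ ≈-refl
        (spec-repeat-advance m (g ∘ suc) (λ eq → Fin.suc-injective (inj eq)) (λ _ → fresh) (λ j → ws (suc j)))
        (≈-trans (setHead-≡ (trans (cong (B ^ m +_) (trans (head-other {y} (σ i) λ ()) (head-same x {s = s})))
                   (sym (ℕ.+-assoc (B ^ m) (i * B ^ m) (head s x)))))
          (≈-trans (setHead-comm (σ i) λ ()) (setHead-cong (setHead-twice s))))

    Env Tables : Set
    Env    = Fin V → ℕ
    Tables = Fin R → ℕ → Bool

    tableContent : (ℕ → Bool) → ℕ → Symbol A
    tableContent t zero    = start
    tableContent t (suc i) = if t i then mark else blank

    -- The argument ρ only matters on the names round r i.
    mem : (Name → ℕ) → Env → Tables → Memory
    mem ρ env T .head input           = length w
    mem ρ env T .head (var x)         = env x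
    mem ρ env T .head (round r i)     = ρ (round r i)
    mem ρ env T .head tmp             = 0
    mem ρ env T .head (table r)       = 0
    mem ρ env T .head (stride r i)    = 0
    mem ρ env T .content input        = nth (map letter w)
    mem ρ env T .content (table r)    = tableContent (T r)
    mem ρ env T .content (var x)      = word
    mem ρ env T .content (round r i)  = word
    mem ρ env T .content tmp          = word
    mem ρ env T .content (stride r i) = word

    upd-same : ∀ (env : Env) x {i} → upd env x i x ≡ i
    upd-same env x = if-yes (x Fin.≟ x) refl

    mem-content : ∀ {ρ ρ′ env env′ T} x i → content (mem ρ env T) x i ≡ content (mem ρ′ env′ T) x i
    mem-content input        _ = refl
    mem-content tmp          _ = refl
    mem-content (var x)      _ = refl
    mem-content (table r)    _ = refl
    mem-content (stride r i) _ = refl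
    mem-content (round r i)  _ = refl

    mem-env : ∀ {ρ env env′ T} → env ≗ env′ → mem ρ env T ≈ mem ρ env′ T
    mem-env {ρ} {env} {env′} {T} eq = mk≈ heads mem-content
      where
      heads : ∀ x → head (mem ρ env T) x ≡ head (mem ρ env′ T) x
      heads input        = refl
      heads tmp          = refl
      heads (var x)      = eq x
      heads (table r)    = refl
      heads (stride r i) = refl
      heads (round r i)  = refl

    setHead-var : ∀ {ρ env T} x {i} → setHead (var x) i (mem ρ env T) ≈ mem ρ (upd env x i) T
    setHead-var {ρ} {env} {T} x {i} = mk≈ heads mem-content
      where
      M = mem ρ env T
      heads : ∀ y → head (setHead (var x) i M) y ≡ head (mem ρ (upd env x i) T) y
      heads input        = head-other {var x} M λ ()
      heads tmp          = head-other {var x} M λ ()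
      heads (table r)    = head-other {var x} M λ ()
      heads (stride r i) = head-other {var x} M λ ()
      heads (round r i)  = head-other {var x} M λ ()
      heads (var y) with x Fin.≟ y
      ... | yes refl = head-same (var x) {s = M}
      ... | no x≢y   = head-other {var x} M λ { refl → x≢y refl }

    upd-restore : ∀ (env : Env) x {i j} → env x ≡ j → upd (upd env x i) x j ≗ env
    upd-restore env x {i} eq y with x Fin.≟ y
    ... | yes refl = sym eq
    ... | no x≢y   = refl

    -- The number with the given digits in base B, most significant first; positions are at most
    -- `last`, so they are proper digits.
    index : ∀ {m} → Vec ℕ m → ℕ
    index []                = 0
    index (_∷_ {m} i v)     = i * B ^ m + index v

    Bounded : Env → Set
    Bounded env = ∀ x → env x ≤ last

    bounded-upd : ∀ {env x i} → Bounded env → i ≤ last → Bounded (upd env x i)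
    bounded-upd {x = x} b i≤ y with x Fin.≟ y
    ... | yes refl = i≤
    ... | no x≢y   = b y

    index< : ∀ {m} {v : Vec ℕ m} → All (_≤ last) v → index v < B ^ m
    index< []                      = s≤s z≤n
    index< {suc m} {i ∷ v} (p ∷ ps) = ℕ.<-≤-trans (ℕ.+-monoʳ-< (i * B ^ m) (index< ps))
      (ℕ.≤-trans (ℕ.≤-reflexive (ℕ.+-comm (i * B ^ m) (B ^ m))) (ℕ.*-monoˡ-≤ (B ^ m) (s≤s p)))

    index-< : ∀ {i j a b n} → i < j → a < n → i * n + a < j * n + b
    index-< {i} {j} {a} {b} {n} i<j a<n = ℕ.<-≤-trans (ℕ.+-monoʳ-< (i * n) a<n)
      (ℕ.≤-trans (ℕ.≤-reflexive (ℕ.+-comm (i * n) n)) (ℕ.≤-trans (ℕ.*-monoˡ-≤ n i<j) (ℕ.m≤m+n (j * n) b)))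

    index-injective : ∀ {m} {u v : Vec ℕ m} → All (_≤ last) u → All (_≤ last) v → index u ≡ index v → u ≡ v
    index-injective {u = []} {[]} _ _ _ = refl
    index-injective {suc m} {i ∷ u} {j ∷ v} (_ ∷ bu) (_ ∷ bv) eq with ℕ.<-cmp i j
    ... | Tri.tri< i<j _ _  = contradiction eq (ℕ.<⇒≢ (index-< i<j (index< bu)))
    ... | Tri.tri≈ _ refl _ = cong (i ∷_) (index-injective bu bv (ℕ.+-cancelˡ-≡ (i * B ^ m) _ _ eq))
    ... | Tri.tri> _ _ j<i  = contradiction (sym eq) (ℕ.<⇒≢ (index-< j<i (index< bv)))

    ⟦_⟧ : Form → Env → Tables → Set
    ⟦ is x p ⟧    env T = Bool.T (p (word (env x)))
    ⟦ next x φ ⟧  env T = env x < last × ⟦ φ ⟧ (upd env x (suc (env x))) T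
    ⟦ prev x φ ⟧  env T = 0 < env x × ⟦ φ ⟧ (upd env x (pred (env x))) T
    ⟦ ex x φ ⟧    env T = ∃[ i ] i ≤ last × ⟦ φ ⟧ (upd env x i) T
    ⟦ call r xs ⟧ env T = Bool.T (T r (index (Vec.map env xs)))
    ⟦ φ ∧ᶠ ψ ⟧    env T = ⟦ φ ⟧ env T × ⟦ ψ ⟧ env T
    ⟦ φ ∨ᶠ ψ ⟧    env T = ⟦ φ ⟧ env T ⊎ ⟦ ψ ⟧ env T
    ⟦ ~ᶠ φ ⟧      env T = ¬ ⟦ φ ⟧ env T

    -- The decision imitates the program: an existential formula is decided at the position where
    -- the search stops. Hence `does` is literally the exit value that `spec-eval` has to produce.
    dec : ∀ φ env T → Dec (⟦ φ ⟧ env T)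
    dec (is x p)    env T = T? (p (word (env x)))
    dec (next x φ)  env T = (env x <? last) ×-dec dec φ (upd env x (suc (env x))) T
    dec (prev x φ)  env T = (0 <? env x) ×-dec dec φ (upd env x (pred (env x))) T
    dec (ex x φ)    env T = map′ (λ p → m , stop≤ b last , p) least (dec φ (upd env x m) T)
      where
      b : ℕ → Bool
      b i = does (dec φ (upd env x i) T)
      m = stop b last
      least : (∃[ i ] i ≤ last × ⟦ φ ⟧ (upd env x i) T) → ⟦ φ ⟧ (upd env x m) T
      least (i , i≤ , p) with at-stop b last
      ... | inj₁ b≡true = does-true (dec φ (upd env x m) T) b≡true
      ... | inj₂ m≡last with ℕ.m≤n⇒m<n∨m≡n (ℕ.≤-trans i≤ (ℕ.≤-reflexive (sym m≡last)))
      ...   | inj₁ i<m = contradiction (trans (sym (dec-true (dec φ (upd env x i) T) p)) (before-stop b last i i<m)) λ ()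
      ...   | inj₂ i≡m = subst (λ j → ⟦ φ ⟧ (upd env x j) T) i≡m p
    dec (call r xs) env T = T? (T r (index (Vec.map env xs)))
    dec (φ ∧ᶠ ψ)    env T = dec φ env T ×-dec dec ψ env T
    dec (φ ∨ᶠ ψ)    env T = dec φ env T ⊎-dec dec ψ env T
    dec (~ᶠ φ)      env T = ¬? (dec φ env T)

    -- Quantified variables are scanned from position 0, hence must be there beforehand.
    Clean : Form → Env → Set
    Clean (is x p)    env = ⊤
    Clean (next x φ)  env = Clean φ (upd env x (suc (env x)))
    Clean (prev x φ)  env = Clean φ (upd env x (pred (env x)))
    Clean (ex x φ)    env = env x ≡ 0 × (∀ i → Clean φ (upd env x i))
    Clean (call r xs) env = ⊤
    Clean (φ ∧ᶠ ψ)    env = Clean φ env × Clean ψ env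
    Clean (φ ∨ᶠ ψ)    env = Clean φ env × Clean ψ env
    Clean (~ᶠ φ)      env = Clean φ env

    power≡ : ∀ m → ⟦ power m ⟧ₚ B ≡ B ^ m
    power≡ zero    = refl
    power≡ (suc m) = cong (B *_) (power≡ m)

    -- `h` is what the digits already processed have contributed to the address; the induction is
    -- over the digits left.
    spec-goTo : ∀ {r ρ env T} → Bounded env → ∀ m (xs : Vec (Fin V) m) (g : Fin m → Fin (arity r)) →
                (∀ {i j} → g i ≡ g j → i ≡ j) → ∀ h →
                Spec (goTo (table r) xs (stride r ∘ g)) (setHead (table r) h (mem ρ env T)) (⟦ goToCost m ⟧ₚ B) tt
                  (setHead (table r) (index (Vec.map env xs) + h) (mem ρ env T))
    spec-goTo bd zero    []       g inj h = spec-ret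
    spec-goTo {r} {ρ} {env} {T} bd (suc m) (x ∷ xs) g inj h = spec-bind there′ (spec-bind back
        (spec-≈ ≈-refl (spec-goTo bd m xs (g ∘ suc) (λ eq → Fin.suc-injective (inj eq)) (env x * B ^ m + h))
          (setHead-≡ (trans (sym (ℕ.+-assoc (index (Vec.map env xs)) (env x * B ^ m) h))
            (cong (_+ h) (ℕ.+-comm (index (Vec.map env xs)) (env x * B ^ m)))))))
      where
      M = mem ρ env T
      t = table r
      v = var x

      σ : ℕ → Memory
      σ k = setHead t (k * B ^ m + h) M

      bodies : ∀ i j k → Spec (repeat m (stride r ∘ g ∘ suc) (advance t)) (setHead v i (setHead tmp j (σ k)))
                 (⟦ repeatCost m (con 1) ⟧ₚ B) tt (setHead v i (setHead tmp j (σ (suc k))))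
      bodies i j k = spec-≈ ≈-refl
        (spec-repeat-advance m (g ∘ suc) (λ eq → Fin.suc-injective (inj eq))
          (λ l → trans (head-other {v} (setHead tmp j (σ k)) λ ()) (trans (head-other {tmp} (σ k) λ ()) (head-other {t} M λ ())))
          (λ _ _ → refl))
        (≈-trans (setHead-≡ (trans (cong (B ^ m +_) (trans (head-other {v} (setHead tmp j (σ k)) λ ())
                    (trans (head-other {tmp} (σ k) λ ()) (head-same t {s = M})))) (sym (ℕ.+-assoc (B ^ m) (k * B ^ m) h))))
          (≈-trans (setHead-comm (setHead tmp j (σ k)) λ ())
            (setHead-cong (≈-trans (setHead-comm (σ k) λ ()) (setHead-cong (setHead-twice M))))))

      N = env x + 0

      there′ : Spec (transfer v tmp (repeat m (stride r ∘ g ∘ suc) (advance t))) (setHead t h M)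
                 (⟦ transferCost (repeatCost m (con 1)) ⟧ₚ B) tt (setHead tmp N (setHead v 0 (σ N)))
      there′ = spec-≤ (ℕ.*-monoˡ-≤ (⟦ repeatCost m (con 1) ⟧ₚ B + 3) (s≤s (bd x)))
        (spec-≈ (≈-sym (≈-trans (setHead-cong (setHead-self (head-other {t} M λ ()))) (setHead-self (head-other {t} M λ ()))))
          (spec-transfer σ (λ ()) (λ k → word-anchored {σ k} {v} λ _ → refl) bodies (env x) 0 0)
          (setHead-comm (σ N) λ ()))

      back : Spec (transfer tmp v (ret tt)) (setHead tmp N (setHead v 0 (σ N))) (⟦ transferCost (con 1) ⟧ₚ B) tt (σ (env x))
      back = spec-≤ (ℕ.*-monoˡ-≤ 4 (s≤s (ℕ.≤-trans (ℕ.≤-reflexive (ℕ.+-identityʳ (env x))) (bd x))))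
        (spec-≈ ≈-refl
          (spec-transfer (λ _ → σ N) (λ ()) (λ k → word-anchored {σ N} {tmp} λ _ → refl) (λ _ _ _ → spec-ret) N 0 0)
          (≈-trans (setHead-cong (setHead-self (trans (head-other {t} M λ ()) (sym (trans (ℕ.+-identityʳ N) (ℕ.+-identityʳ (env x)))))))
            (≈-trans (setHead-self (head-other {t} M λ ()))
              (setHead-≡ (cong (λ n → n * B ^ m + h) (ℕ.+-identityʳ (env x)))))))

    spec-access : ∀ {r ρ env T} → Bounded env → (xs : Vec (Fin V) (arity r)) →
                  Spec (goTo (table r) xs (stride r)) (mem ρ env T) (⟦ goToCost (arity r) ⟧ₚ B) tt
                    (setHead (table r) (index (Vec.map env xs)) (mem ρ env T))
    spec-access {r} bd xs = spec-≈ (≈-sym (setHead-self refl)) (spec-goTo bd (arity r) xs (λ i → i) (λ eq → eq) 0)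
      (setHead-≡ (ℕ.+-identityʳ _))

    bounded-map : ∀ {env m} → Bounded env → (xs : Vec (Fin V) m) → All (_≤ last) (Vec.map env xs)
    bounded-map bd []       = []
    bounded-map bd (x ∷ xs) = bd x ∷ bounded-map bd xs

    table-anchored : ∀ {s r t} → (∀ i → content s (table r) i ≡ tableContent t i) → Anchored s (table r)
    table-anchored {t = t} eq = cong isStart (eq 0) , λ i → trans (cong isStart (eq (suc i))) (unmarked (t i))
      where
      unmarked : ∀ b → isStart {A} (if b then mark else blank) ≡ false
      unmarked true  = refl
      unmarked false = refl

    spec-rewind-table : ∀ {s r t i} → (∀ j → content s (table r) j ≡ tableContent t j) → i < B ^ arity r →
                        Spec (rewind (table r)) (setHead (table r) (suc i) s) (⟦ rewindCost (arity r) ⟧ₚ B) tt (setHead (table r) 0 s)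
    spec-rewind-table {s} {r} {t} {i} eq i< = spec-≤
      (ℕ.*-monoˡ-≤ 2 (subst (λ n → suc (suc i) ≤ n + 1) (sym (power≡ (arity r))) (subst (suc (suc i) ≤_) (ℕ.+-comm 1 _) (s≤s i<))))
      (spec-rewind (table-anchored {s} {r} {t} eq) (suc i))

    spec-eval : ∀ φ {ρ env T} → Bounded env → Clean φ env →
                Spec (eval φ) (mem ρ env T) (⟦ cost φ ⟧ₚ B) (does (dec φ env T)) (mem ρ env T)
    spec-eval (is x p) bd cl = spec-≈ ≈-refl (spec-moveOn λ ()) (setHead-self refl)
    spec-eval (next x φ) {ρ} {env} {T} bd cl = by (env x <? last)
      where
      i = env x
      env′ = upd env x (suc i)

      by : Dec (i < last) → Spec (eval (next x φ)) (mem ρ env T) (⟦ cost (next x φ) ⟧ₚ B) (does (dec (next x φ) env T)) (mem ρ env T)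
      by (yes i<) = spec-exit-≡ (cong (_∧ does (dec φ env′ T)) (sym (dec-true (i <? last) i<)))
        (spec-bind (spec-≈ ≈-refl (spec-up-right (word-inside i i<)) (setHead-var x))
          (spec-bind (spec-eval φ (bounded-upd {x = x} bd i<) cl)
            (spec-bind (spec-≈ ≈-refl (spec-retreat {var x} λ eq → contradiction (trans (sym (upd-same env x)) eq) λ ())
                (≈-trans (setHead-var x) (mem-env (upd-restore env x (sym (cong pred (upd-same env x)))))))
              spec-ret)))
      by (no i≮) = spec-exit-≡ (cong (_∧ does (dec φ env′ T)) (sym (dec-false (i <? last) i≮)))
        (spec-≤ (s≤s (ℕ.≤-trans (s≤s z≤n) (ℕ.m≤n+m 2 (⟦ cost φ ⟧ₚ B))))
          (spec-bind (spec-up-blank (trans (cong (isBlank ∘ word) (ℕ.≤-antisym (bd x) (ℕ.≮⇒≥ i≮))) (nth-blank w))) spec-ret))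
    spec-eval (prev x φ) {ρ} {env} {T} bd cl = by (env x) refl
      where
      env′ = upd env x (pred (env x))

      by : ∀ i → env x ≡ i → Spec (eval (prev x φ)) (mem ρ env T) (⟦ cost (prev x φ) ⟧ₚ B) (does (dec (prev x φ) env T)) (mem ρ env T)
      by zero eq = spec-exit-≡ (cong (_∧ does (dec φ env′ T)) (sym (dec-false (0 <? env x) (ℕ.≤⇒≯ (ℕ.≤-reflexive eq)))))
        (spec-≤ (s≤s (ℕ.≤-trans (s≤s z≤n) (ℕ.m≤n+m 2 (⟦ cost φ ⟧ₚ B))))
          (spec-bind (spec-down-start (cong (isStart ∘ word) eq)) spec-ret))
      by (suc i) eq = spec-exit-≡ (cong (_∧ does (dec φ env′ T)) (sym (dec-true (0 <? env x) (ℕ.≤-trans (s≤s z≤n) (ℕ.≤-reflexive (sym eq))))))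
        (spec-bind (spec-≈ ≈-refl (spec-down-left {var x} (trans (cong (isStart ∘ word) eq) (nth-start w i)) λ eq′ → contradiction (trans (sym eq) eq′) λ ()) (setHead-var x))
          (spec-bind (spec-eval φ (bounded-upd {x = x} bd (ℕ.≤-trans ℕ.pred[n]≤n (bd x))) cl)
            (spec-bind (spec-≈ ≈-refl spec-advance
                (≈-trans (setHead-var x) (mem-env (upd-restore env x
                  (trans eq (cong suc (trans (cong pred (sym eq)) (sym (upd-same env x)))))))))
              spec-ret)))
    spec-eval (ex x φ) {ρ} {env} {T} bd (x≡0 , cl) = spec-≈ ≈-refl
      (spec-search (λ _ → mem ρ env T) (λ i → does (dec φ (upd env x i) T)) (λ _ _ → refl)
        (λ i i≤ → spec-≈ (setHead-var x) (spec-eval φ (bounded-upd {x = x} bd i≤) (cl i)) (≈-sym (setHead-var x))) x≡0)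
      (setHead-self x≡0)
    spec-eval (call r xs) {ρ} {env} {T} bd cl =
      spec-bind (spec-access bd xs)
        (spec-bind (spec-≈ ≈-refl spec-advance (≈-trans (setHead-≡ (cong suc (head-same t {s = M}))) (setHead-twice M)))
          (spec-bind (spec-exit-≡ marked (spec-≈ ≈-refl (spec-moveOn λ ()) (setHead-self refl)))
            (spec-bind (spec-≈ ≈-refl (spec-rewind-table {M} {r} {T r} (λ _ → refl) (index< (bounded-map bd xs))) (setHead-self refl)) spec-ret)))
      where
      M = mem ρ env T
      t = table r
      i = index (Vec.map env xs)

      mark? : ∀ b → isMark {A} (if b then mark else blank) ≡ b
      mark? true  = refl
      mark? false = refl

      marked : isMark (at (setHead t (suc i) M) t) ≡ T r i
      marked = trans (cong isMark (at-setHead {t} M)) (mark? (T r i))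
    spec-eval (φ ∧ᶠ ψ) {ρ} {env} {T} bd (cl , cl′) = spec-bind (spec-eval φ bd cl) (by (does (dec φ env T)))
      where
      by : ∀ b → Spec (if b then eval ψ else ret false) (mem ρ env T) (⟦ cost ψ ⟧ₚ B + 1) (b ∧ does (dec ψ env T)) (mem ρ env T)
      by true  = spec-≤ (ℕ.m≤m+n _ 1) (spec-eval ψ bd cl′)
      by false = spec-≤ (ℕ.m≤n+m 1 _) spec-ret
    spec-eval (φ ∨ᶠ ψ) {ρ} {env} {T} bd (cl , cl′) = spec-bind (spec-eval φ bd cl) (by (does (dec φ env T)))
      where
      by : ∀ b → Spec (if b then ret true else eval ψ) (mem ρ env T) (⟦ cost ψ ⟧ₚ B + 1) (b ∨ does (dec ψ env T)) (mem ρ env T)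
      by true  = spec-≤ (ℕ.m≤n+m 1 _) spec-ret
      by false = spec-≤ (ℕ.m≤m+n _ 1) (spec-eval ψ bd cl′)
    spec-eval (~ᶠ φ) bd cl = spec-bind (spec-eval φ bd cl) spec-ret

    -- Tables computed by repeated sweeps

    iterate : ∀ {X : Set} → (ℕ → X → X) → ℕ → X → X
    iterate f zero    x = x
    iterate f (suc n) x = f n (iterate f n x)

    sweep : ∀ m → (Vec ℕ m → Tables → Tables) → Tables → Tables
    sweep zero    g = g []
    sweep (suc m) g = iterate (λ i → sweep m (λ v → g (i ∷ v))) B

    rounds : ℕ → (Tables → Tables) → Tables → Tables
    rounds zero    g = g
    rounds (suc m) g = iterate (λ _ → rounds m g) B

    assign : ∀ {m} → Env → Vec (Fin V) m → Vec ℕ m → Env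
    assign env []       []      = env
    assign env (x ∷ xs) (i ∷ v) = assign (upd env x i) xs v

    setTable : Fin R → ℕ → Bool → Tables → Tables
    setTable r j b T r′ i = if does (r Fin.≟ r′) then (if does (j ≟ i) then b else T r′ i) else T r′ i

    BoundedVec : ∀ {m} → Vec ℕ m → Set
    BoundedVec = All (_≤ last)

    spec-forAll : ∀ {ρ m P p} (xs : Vec (Fin V) m) (g : Vec ℕ m → Tables → Tables) {env T} →
      Unique xs → All (λ x → env x ≡ 0) xs →
      (∀ v T → BoundedVec v → Spec P (mem ρ (assign env xs v) T) (⟦ p ⟧ₚ B) tt (mem ρ (assign env xs v) (g v T))) →
      Spec (forAll xs P) (mem ρ env T) (⟦ repeatCost m p ⟧ₚ B) tt (mem ρ env (sweep m g T))
    spec-forAll []       g _ _ bodies = bodies [] _ []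
    spec-forAll {ρ} {suc m} {P} {p} (x ∷ xs) g {env} {T} (x∉xs ∷ u) (x≡0 ∷ zs) bodies = spec-≈ ≈-refl
      (spec-for {p = repeatCost m p} (λ i → mem ρ env (iterate (λ i → sweep m (λ v → g (i ∷ v))) i T)) (λ _ _ → refl)
        (λ i i≤ → spec-≈ (setHead-var x)
          (spec-forAll {p = p} xs (λ v → g (i ∷ v)) u (zeros i xs x∉xs zs) (λ v T bv → bodies (i ∷ v) T (i≤ ∷ bv)))
          (≈-sym (setHead-var x)))
        x≡0)
      (setHead-self x≡0)
      where
      zeros : ∀ i {n} (ys : Vec (Fin V) n) → All (x ≢_) ys → All (λ y → env y ≡ 0) ys → All (λ y → upd env x i y ≡ 0) ys
      zeros i []       []         []        = []
      zeros i (y ∷ ys) (x≢y ∷ ns) (eq ∷ es) = trans (if-no (x Fin.≟ y) x≢y) eq ∷ zeros i ys ns es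

    -- While a sweep runs, the round counters stand at arbitrary positions; this is why the body is
    -- specified for every `ρ`, although all counters are 0 at the outset.
    spec-rounds : ∀ {r env P p} m (k : Fin m → Fin (arity r)) → (∀ {i j} → k i ≡ k j → i ≡ j) →
      (g : Tables → Tables) →
      (∀ ρ T → Spec P (mem ρ env T) (⟦ p ⟧ₚ B) tt (mem ρ env (g T))) →
      ∀ {ρ T} → (∀ i → ρ (round r (k i)) ≡ 0) →
      Spec (repeat m (round r ∘ k) P) (mem ρ env T) (⟦ repeatCost m p ⟧ₚ B) tt (mem ρ env (rounds m g T))
    spec-rounds zero    k inj g body z = body _ _
    spec-rounds {r} {env} {P} {p} (suc m) k inj g body {ρ} {T} z = spec-≈ ≈-refl
      (spec-for {p = repeatCost m p} (λ i → mem ρ env (iterate (λ _ → rounds m g) i T)) (λ _ _ → refl)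
        (λ i i≤ → spec-≈ moved
          (spec-rounds {p = p} m (k ∘ suc) (λ eq → Fin.suc-injective (inj eq)) g body (still i)) (≈-sym moved))
        (z zero))
      (setHead-self (z zero))
      where
      y = round r (k zero)

      ρ′ : ℕ → Name → ℕ
      ρ′ i x = if does (y ≟ⁿ x) then i else ρ x

      round-injective : ∀ {i j} → round r i ≡ round r j → i ≡ j
      round-injective refl = refl

      still : ∀ i j → ρ′ i (round r (k (suc j))) ≡ 0
      still i j = trans (if-no (y ≟ⁿ round r (k (suc j))) λ eq → 0≢suc (inj (round-injective eq))) (z (suc j))
        where
        0≢suc : zero ≢ suc j
        0≢suc ()

      moved : ∀ {i T} → setHead y i (mem ρ env T) ≈ mem (ρ′ i) env T
      moved {i} {T} = mk≈ heads mem-content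
        where
        M = mem ρ env T
        heads : ∀ x → head (setHead y i M) x ≡ head (mem (ρ′ i) env T) x
        heads input        = head-other {y} M λ ()
        heads tmp          = head-other {y} M λ ()
        heads (var x)      = head-other {y} M λ ()
        heads (table r)    = head-other {y} M λ ()
        heads (stride r i) = head-other {y} M λ ()
        heads (round r j) = refl

    zeroEnv : Env
    zeroEnv _ = 0

    update : (r : Fin R) → Vec (Fin V) (arity r) → Form → Vec ℕ (arity r) → Tables → Tables
    update r xs φ v T = setTable r (index v) (does (dec φ (assign zeroEnv xs v) T)) T

    defined : (r : Fin R) → Vec (Fin V) (arity r) → Form → Tables → Tables
    defined r xs φ = rounds (arity r) (sweep (arity r) (update r xs φ))

    bounded-assign : ∀ {m env} (xs : Vec (Fin V) m) {v} → Bounded env → BoundedVec v → Bounded (assign env xs v)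
    bounded-assign []       {[]}    bd []        = bd
    bounded-assign (x ∷ xs) {i ∷ v} bd (i≤ ∷ bv) = bounded-assign xs (bounded-upd {x = x} bd i≤) bv

    assign-other : ∀ {m env x} (xs : Vec (Fin V) m) v → All (_≢ x) xs → assign env xs v x ≡ env x
    assign-other []       []      []        = refl
    assign-other {x = x} (y ∷ xs) (i ∷ v) (y≢x ∷ ns) = trans (assign-other xs v ns) (if-no (y Fin.≟ x) y≢x)

    map-assign : ∀ {m env} (xs : Vec (Fin V) m) v → Unique xs → Vec.map (assign env xs v) xs ≡ v
    map-assign []       []      []        = refl
    map-assign {env = env} (x ∷ xs) (i ∷ v) (n ∷ u) = cong₂ _∷_
      (trans (assign-other xs v (All.map (λ x≢y y≡x → x≢y (sym y≡x)) n)) (upd-same env x)) (map-assign xs v u)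

    spec-define : ∀ {r xs φ ρ T} → Unique xs → (∀ v → BoundedVec v → Clean φ (assign zeroEnv xs v)) → (∀ x → ρ x ≡ 0) →
                  Spec (define r xs φ) (mem ρ zeroEnv T) (⟦ defineCost r φ ⟧ₚ B) tt (mem ρ zeroEnv (defined r xs φ T))
    spec-define {r} {xs} {φ} u cl z =
      spec-rounds {p = repeatCost (arity r) p} (arity r) (λ i → i) (λ eq → eq) (sweep (arity r) (update r xs φ))
        (λ ρ T → spec-forAll {p = p} xs (update r xs φ) u (zeros xs) (λ v T bv → body ρ v T bv)) (λ i → z _)
      where
      t = table r
      p = cost φ ⊕ (goToCost (arity r) ⊕ (con 1 ⊕ (con 1 ⊕ rewindCost (arity r))))

      zeros : ∀ {m} (ys : Vec (Fin V) m) → All (λ y → zeroEnv y ≡ 0) ys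
      zeros []       = []
      zeros (y ∷ ys) = refl ∷ zeros ys

      body : ∀ ρ v T → BoundedVec v → Spec _ (mem ρ (assign zeroEnv xs v) T) (⟦ p ⟧ₚ B) tt
               (mem ρ (assign zeroEnv xs v) (update r xs φ v T))
      body ρ v T bv = spec-bind (spec-eval φ bd (cl v bv))
          (spec-bind (subst (λ j → Spec (goTo t xs (stride r)) M _ tt (setHead t j M)) (cong index (map-assign xs v u)) (spec-access bd xs))
            (spec-bind (spec-≈ ≈-refl spec-advance (≈-trans (setHead-≡ (cong suc (head-same t {s = M}))) (setHead-twice M)))
              (spec-bind (spec-≈ ≈-refl spec-writeOn written)
                (spec-≈ ≈-refl (spec-rewind-table {M′} {r} {setTable r j b T r} (λ _ → refl) (index< bv)) (setHead-self refl)))))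
        where
        env = assign zeroEnv xs v
        bd  = bounded-assign xs (λ _ → z≤n) bv
        b   = does (dec φ env T)
        M   = mem ρ env T
        M′  = mem ρ env (update r xs φ v T)
        j   = index v

        written : setContent t (head (setHead t (suc j) M) t) (if b then mark else blank) (setHead t (suc j) M) ≈ setHead t (suc j) M′
        written rewrite head-same t {suc j} {M} = mk≈ heads contents
          where
          heads : ∀ x → head (setHead t (suc j) M) x ≡ head (setHead t (suc j) M′) x
          heads x = cong (if does (t ≟ⁿ x) then suc j else_) (unmoved x)
            where
            unmoved : ∀ x → head M x ≡ head M′ x
            unmoved input        = refl
            unmoved tmp          = refl
            unmoved (var _)      = refl
            unmoved (table _)    = refl
            unmoved (stride _ _) = refl
            unmoved (round _ _)  = refl

          unwritten : ∀ {x f a} i → t ≢ x → (if does (t ≟ⁿ x) then put f (suc j) a else f) i ≡ f i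
          unwritten {x} i ne = cong (λ (h : ℕ → Symbol A) → h i) (if-no (t ≟ⁿ x) ne)

          contents : ∀ x i → content (setContent t (suc j) (if b then mark else blank) (setHead t (suc j) M)) x i ≡ content (setHead t (suc j) M′) x i
          contents input        i = unwritten i λ ()
          contents tmp          i = unwritten i λ ()
          contents (var _)      i = unwritten i λ ()
          contents (stride _ _) i = unwritten i λ ()
          contents (round _ _)  i = unwritten i λ ()
          contents (table r′) i with r Fin.≟ r′
          ... | no ne = trans (unwritten i λ { refl → ne refl }) (same i)
            where
            same : ∀ i → tableContent (T r′) i ≡ tableContent (λ i → T r′ i) i
            same zero    = refl
            same (suc i) = refl
          ... | yes refl = trans (cong (λ (h : ℕ → Symbol A) → h i) (if-yes (t ≟ⁿ t) refl)) (same i)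
            where
            same : ∀ i → put (tableContent (T r)) (suc j) (if b then mark else blank) i ≡ tableContent (λ i → if does (j ≟ i) then b else T r i) i
            same zero = refl
            same (suc i) = sym (if-float (if_then mark else blank) (does (j ≟ i)))

    sweep-preserves : ∀ {m} {K : Tables → Set} (g : Vec ℕ m → Tables → Tables) →
                      (∀ v T → BoundedVec v → K T → K (g v T)) → ∀ {T} → K T → K (sweep m g T)
    sweep-preserves {zero}      g step k = step [] _ [] k
    sweep-preserves {suc m} {K} g step {T} k = go B ℕ.≤-refl
      where
      go : ∀ n → n ≤ B → K (iterate (λ i → sweep m (λ v → g (i ∷ v))) n T)
      go zero    _        = k
      go (suc n) (s≤s n≤) = sweep-preserves (λ v → g (n ∷ v)) (λ v T bv → step (n ∷ v) T (n≤ ∷ bv)) (go n (ℕ.m≤n⇒m≤1+n n≤))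

    -- The sweep meets the tuple `u` at some moment, which establishes `Q`; all later updates keep
    -- it. The invariant `K` holds throughout.
    sweep-hits : ∀ {m} {K Q : Tables → Set} (g : Vec ℕ m → Tables → Tables) →
                 (∀ v T → BoundedVec v → K T → K (g v T)) → (∀ v T → BoundedVec v → K T → Q T → Q (g v T)) →
                 ∀ {u} → BoundedVec u → (∀ T → K T → Q (g u T)) → ∀ {T} → K T → Q (sweep m g T)
    sweep-hits {zero}              g stepK stepQ {[]}    []         hit k = hit _ k
    sweep-hits {suc m} {K} {Q} g stepK stepQ {i ∷ u} (i≤ ∷ bu) hit {T} k = proj₂ (go B ℕ.≤-refl) (s≤s i≤)
      where
      go : ∀ n → n ≤ B → let T′ = iterate (λ i → sweep m (λ v → g (i ∷ v))) n T in K T′ × (i < n → Q T′)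
      go zero    _        = k , λ ()
      go (suc n) (s≤s n≤) with go n (ℕ.m≤n⇒m≤1+n n≤)
      ... | k′ , q′ = sweep-preserves (λ v → g (n ∷ v)) (λ v T bv → stepK (n ∷ v) T (n≤ ∷ bv)) k′ , λ { (s≤s i≤n) → hit′ (ℕ.m≤n⇒m<n∨m≡n i≤n) }
        where
        hit′ : i < n ⊎ i ≡ n → Q (sweep m (λ v → g (n ∷ v)) (iterate (λ i → sweep m (λ v → g (i ∷ v))) n T))
        hit′ (inj₁ i<n)  = proj₂ (sweep-preserves {K = λ T → K T × Q T} (λ v → g (n ∷ v))
          (λ v T bv kq → stepK (n ∷ v) T (n≤ ∷ bv) (proj₁ kq) , stepQ (n ∷ v) T (n≤ ∷ bv) (proj₁ kq) (proj₂ kq)) (k′ , q′ i<n))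
        hit′ (inj₂ refl) = sweep-hits (λ v → g (n ∷ v)) (λ v T bv → stepK (n ∷ v) T (n≤ ∷ bv))
          (λ v T bv → stepQ (n ∷ v) T (n≤ ∷ bv)) bu hit k′

    rounds-advance : ∀ {K : ℕ → Tables → Set} m {g} → (∀ j T → K j T → K (suc j) (g T)) →
                     ∀ j T → K j T → K (B ^ m + j) (rounds m g T)
    rounds-advance         zero    step j T k = step j T k
    rounds-advance {K} (suc m) {g} step j T k = go B
      where
      go : ∀ n → K (n * B ^ m + j) (iterate (λ _ → rounds m g) n T)
      go zero    = k
      go (suc n) = subst (λ i → K i (iterate (λ _ → rounds m g) (suc n) T)) (sym (ℕ.+-assoc (B ^ m) (n * B ^ m) j))
                     (rounds-advance m step (n * B ^ m + j) _ (go n))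

    record Agree (r : Fin R) (T T′ : Tables) : Set where
      constructor agree
      field
        agrees : ∀ {r′} → r ≢ r′ → T r′ ≗ T′ r′

    -- After j rounds, the entries of rank below j are correct and stay correct.
    defined-correct : ∀ {r xs φ T₀} (rank : Vec ℕ (arity r) → ℕ) (Ok : Vec ℕ (arity r) → Bool → Set) →
      (∀ v → BoundedVec v → rank v < B ^ arity r) →
      (∀ T v → BoundedVec v → Agree r T₀ T →
        (∀ u → BoundedVec u → rank u < rank v → Ok u (T r (index u))) → Ok v (does (dec φ (assign zeroEnv xs v) T))) →
      Agree r T₀ (defined r xs φ T₀) × (∀ v → BoundedVec v → Ok v (defined r xs φ T₀ r (index v)))
    defined-correct {r} {xs} {φ} {T₀} rank Ok rank< step = proj₁ final , λ v bv → proj₂ final v bv (ℕ.<-≤-trans (rank< v bv) (ℕ.m≤m+n _ 0))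
      where
      g = update r xs φ

      Good : ℕ → Tables → Set
      Good j T = Agree r T₀ T × (∀ u → BoundedVec u → rank u < j → Ok u (T r (index u)))

      agree-update : ∀ v T → Agree r T₀ T → Agree r T₀ (g v T)
      agree-update v T (agree a) = agree λ {r′} r≢r′ i → trans (a r≢r′ i)
        (sym (if-no (r Fin.≟ r′) r≢r′))

      written : ∀ v T i → g v T r i ≡ (if does (index v ≟ i) then does (dec φ (assign zeroEnv xs v) T) else T r i)
      written v T i = if-yes (r Fin.≟ r) refl

      -- The value written depends on correctness of strictly smaller ranks only, and these are
      -- settled after `j` rounds, whatever the other entries contain.
      hit : ∀ j u → BoundedVec u → rank u ≤ j → ∀ T → Good j T → Ok u (g u T r (index u))
      hit j u bu ≤j T (a , ok) = subst (Ok u) (sym (trans (written u T (index u)) (if-yes (index u ≟ index u) refl)))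
        (step T u bu a λ u′ bu′ lt → ok u′ bu′ (ℕ.<-≤-trans lt ≤j))

      -- An update at another index leaves the entry alone; an update at the same index is, by
      -- `index-injective`, an update of `u` itself and correct once more.
      keep : ∀ j u → BoundedVec u → rank u ≤ j → ∀ v T → BoundedVec v → Good j T → Ok u (T r (index u)) → Ok u (g v T r (index u))
      keep j u bu ≤j v T bv good ok with index v ≟ index u
      ... | yes eq with index-injective bv bu eq
      ...   | refl = hit j u bu ≤j T good
      keep j u bu ≤j v T bv good ok | no ne = subst (Ok u) (sym (trans (written v T (index u)) (if-no (index v ≟ index u) ne))) ok

      good-update : ∀ j v T → BoundedVec v → Good j T → Good j (g v T)
      good-update j v T bv good = agree-update v T (proj₁ good) , λ u bu lt →
        keep j u bu (ℕ.<⇒≤ lt) v T bv good (proj₂ good u bu lt)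

      final : Good (B ^ arity r + 0) (defined r xs φ T₀)
      -- A single round raises the settled rank by one: it preserves what is settled, and it meets
      -- every tuple of rank `j`.
      final = rounds-advance {Good} (arity r)
        (λ j T good → proj₁ (sweep-preserves {K = Good j} g (good-update j) good) , λ u bu lt →
          sweep-hits {K = Good j} {λ T → Ok u (T r (index u))} g (good-update j) (keep j u bu (ℕ.≤-pred lt)) bu (hit j u bu (ℕ.≤-pred lt)) good)
        0 T₀ (agree (λ _ _ → refl) , λ _ _ ())

  -- Setting up the tapes and running the definitions in order

  data Kind : Set where
    inputK tableK wordK : Kind

  kind : Name → Kind
  kind input     = inputK
  kind (table _) = tableK
  kind _         = wordK

  -- All tapes of one kind act alike, so a single step serves them all. On a word tape the head also
  -- moves off the start cell, since the copy of the input begins in cell 1.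
  markAction : Kind → Symbol A → Symbol A × Direction
  markAction inputK b = b , stay
  markAction tableK b = start , stay
  markAction wordK  b = start , right

  copyAction : Kind → Symbol A → Symbol A → Symbol A × Direction
  copyAction inputK a b = b , right
  copyAction tableK a b = b , stay
  copyAction wordK  a b = a , right

  rewindAction : Kind → Direction
  rewindAction wordK = left
  rewindAction _     = stay

  markStart copy rewindAll : Prog ⊤
  markStart = act input (λ _ → tt) λ y _ b → markAction (kind y) b
  copy      = loop (act input (λ a → if isBlank a then just tt else nothing)
                      λ y a b → if isBlank a then b , stay else copyAction (kind y) a b)
  rewindAll = loop (act tmp (λ a → if isStart a then just tt else nothing)
                      λ y a b → b , (if isStart a then stay else rewindAction (kind y)))

  record Definition : Set where
    constructor definition
    field
      relation   : Fin R
      parameters : Vec (Fin V) (arity relation)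
      body       : Form

  open Definition public

  family : (∀ r → Vec (Fin V) (arity r)) → (Fin R → Form) → List Definition
  family params bodies = List.tabulate λ r → definition r (params r) (bodies r)

  stages : List Definition → Form → Prog Bool
  stages []       φ = eval φ
  stages (d ∷ ds) φ = define (relation d) (parameters d) (body d) then stages ds φ

  decide : List Definition → Form → Prog Bool
  decide ds φ = markStart then copy then rewindAll then stages ds φ

  stagesCost : List Definition → Form → Poly
  stagesCost []       φ = cost φ
  stagesCost (d ∷ ds) φ = defineCost (relation d) (body d) ⊕ stagesCost ds φ

  -- One step writes the start cells; copying the word and moving the heads back take at most B
  -- steps each.
  decideCost : List Definition → Form → Poly
  decideCost ds φ = con 1 ⊕ (base ⊕ (base ⊕ stagesCost ds φ))

  module Correctness (w : List A) where

    open Semantics w public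

    tablesAfter : List Definition → Tables → Tables
    tablesAfter []       T = T
    tablesAfter (d ∷ ds) T = tablesAfter ds (defined (relation d) (parameters d) (body d) T)

    record WellFormed (d : Definition) : Set where
      constructor wellFormed
      field
        unique : Unique (parameters d)
        clean  : ∀ v → BoundedVec v → Clean (body d) (assign zeroEnv (parameters d) v)

    noMarks : Tables
    noMarks _ _ = false

    spec-stages : ∀ ds {φ T} → ListAll.All WellFormed ds → Clean φ zeroEnv →
                  Spec (stages ds φ) (mem (λ _ → 0) zeroEnv T) (⟦ stagesCost ds φ ⟧ₚ B)
                    (does (dec φ zeroEnv (tablesAfter ds T))) (mem (λ _ → 0) zeroEnv (tablesAfter ds T))
    spec-stages []       {φ} ListAll.[]                      cl = spec-eval φ (λ _ → z≤n) cl
    spec-stages (d ∷ ds)     (wellFormed u c ListAll.∷ wfs) cl =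
      spec-bind (spec-define {relation d} {parameters d} {body d} u c λ _ → refl) (spec-stages ds wfs cl)

    empty : Memory
    empty .head _        = 0
    empty .content input = nth (map letter w)
    empty .content _     = λ _ → blank

    layoutHead : ℕ → ℕ → Kind → ℕ
    layoutHead i j inputK = i
    layoutHead i j tableK = 0
    layoutHead i j wordK  = j

    layoutContent : (ℕ → Symbol A) → Kind → ℕ → Symbol A
    layoutContent f inputK = nth (map letter w)
    layoutContent f tableK = tableContent (λ _ → false)
    layoutContent f wordK  = f

    layout : ℕ → ℕ → (ℕ → Symbol A) → Memory
    layout i j f .head y    = layoutHead i j (kind y)
    layout i j f .content y = layoutContent f (kind y)

    prefix : ℕ → ℕ → Symbol A
    prefix i zero    = start
    prefix i (suc j) = if does (j <? i) then nth (map letter w) j else blank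

    spec-markStart : Spec markStart empty 1 tt (layout 0 1 (prefix 0))
    spec-markStart = spec-≈ ≈-refl (spec-act λ y → unmoved (kind y)) (mk≈ heads contents)
      where
      unmoved : ∀ K {b} → proj₂ (markAction K b) ≡ left → 0 ≢ 0
      unmoved inputK ()
      unmoved tableK ()
      unmoved wordK  ()

      heads : ∀ y → shift (proj₂ (markAction (kind y) (content empty y 0))) 0 ≡ layoutHead 0 1 (kind y)
      heads y with kind y
      ... | inputK = refl
      ... | tableK = refl
      ... | wordK  = refl

      start-only : ∀ i → put (λ _ → blank) 0 start i ≡ prefix 0 i
      start-only zero    = refl
      start-only (suc i) = refl

      contents : ∀ y i → put (content empty y) 0 (proj₁ (markAction (kind y) (content empty y 0))) i ≡ layoutContent (prefix 0) (kind y) i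
      contents input        i       = put-self (nth (map letter w)) 0 i
      contents (table _)    zero    = refl
      contents (table _)    (suc _) = refl
      contents tmp          i       = start-only i
      contents (var _)      i       = start-only i
      contents (stride _ _) i       = start-only i
      contents (round _ _)  i       = start-only i

    spec-copy : ∀ d i → d + i ≡ length w →
                Spec copy (layout i (suc i) (prefix i)) (suc d) tt (layout (length w) (suc (length w)) (prefix (length w)))
    spec-copy zero i refl = spec-exit (spec-≈ ≈-refl
      (spec-exit-≡ (cong (if_then just tt else nothing) (nth-blank w)) (spec-act λ y eq → contradiction (trans (sym (cong proj₂ (idle y))) eq) λ ()))
      (mk≈ heads contents))
      where
      s = layout i (suc i) (prefix i)

      action : Name → Symbol A × Direction
      action y = if isBlank (at s input) then at s y , stay else copyAction (kind y) (at s input) (at s y)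

      idle : ∀ y → action y ≡ (at s y , stay)
      idle y = cong (if_then at s y , stay else copyAction (kind y) (at s input) (at s y)) (nth-blank w)

      heads : ∀ y → shift (proj₂ (action y)) (head s y) ≡ head s y
      heads y rewrite idle y = refl

      contents : ∀ y j → put (content s y) (head s y) (proj₁ (action y)) j ≡ content s y j
      contents y j rewrite idle y = put-self (content s y) (head s y) j
    spec-copy (suc d) i d+i≡n = spec-again
      (spec-≈ ≈-refl (spec-exit-≡ (cong (if_then just tt else nothing) inside) (spec-act ok)) (mk≈ heads contents))
      (spec-copy d (suc i) (trans (ℕ.+-suc d i) d+i≡n))
      where
      s = layout i (suc i) (prefix i)
      s′ = layout (suc i) (suc (suc i)) (prefix (suc i))
      a = nth (map letter w) i

      i<n : i < length w
      i<n = subst (suc i ≤_) d+i≡n (s≤s (ℕ.m≤n+m i d))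

      inside : isBlank a ≡ false
      inside = nth-letter w i i<n

      action : Name → Symbol A × Direction
      action y = if isBlank a then at s y , stay else copyAction (kind y) a (at s y)

      busy : ∀ y → action y ≡ copyAction (kind y) a (at s y)
      busy y = cong (if_then at s y , stay else copyAction (kind y) a (at s y)) inside

      ok : ∀ y → proj₂ (action y) ≡ left → head s y ≢ 0
      ok y eq with kind y | trans (sym (cong proj₂ (busy y))) eq
      ... | inputK | ()
      ... | tableK | ()
      ... | wordK  | ()

      heads : ∀ y → shift (proj₂ (action y)) (head s y) ≡ head s′ y
      heads y rewrite busy y with kind y
      ... | inputK = refl
      ... | tableK = refl
      ... | wordK  = refl

      longer : ∀ j → put (prefix i) (suc i) a j ≡ prefix (suc i) j
      longer zero = refl
      longer (suc j) with ℕ.<-cmp i j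
      ... | Tri.tri< i<j _ _ = trans (if-no (suc i ≟ suc j) λ eq → ℕ.<⇒≢ i<j (ℕ.suc-injective eq))
        (trans (if-no (j <? i) (ℕ.<-asym i<j)) (sym (if-no (j <? suc i) (ℕ.<⇒≱ (s≤s i<j)))))
      ... | Tri.tri≈ _ refl _ = trans (if-yes (suc i ≟ suc i) refl) (sym (if-yes (i <? suc i) ℕ.≤-refl))
      ... | Tri.tri> _ _ j<i = trans (if-no (suc i ≟ suc j) λ eq → ℕ.<⇒≢ j<i (sym (ℕ.suc-injective eq)))
        (trans (if-yes (j <? i) j<i) (sym (if-yes (j <? suc i) (ℕ.m<n⇒m<1+n j<i))))

      contents : ∀ y j → put (content s y) (head s y) (proj₁ (action y)) j ≡ content s′ y j
      contents y j rewrite busy y with kind y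
      ... | inputK = put-self (nth (map letter w)) i j
      ... | tableK = put-self (tableContent λ _ → false) 0 j
      ... | wordK  = longer j

    prefix-word : ∀ i → prefix (length w) i ≡ word i
    prefix-word zero = refl
    prefix-word (suc i) with i <? length w
    ... | yes i<n = if-yes (i <? length w) i<n
    ... | no i≮n  = trans (if-no (i <? length w) i≮n) (sym (beyond w i (ℕ.≮⇒≥ i≮n)))
      where
      beyond : ∀ (v : List A) i → length v ≤ i → nth (map letter v) i ≡ blank
      beyond []      i       _       = refl
      beyond (a ∷ v) (suc i) (s≤s l) = beyond v i l

    spec-rewindAll : ∀ i → Spec rewindAll (layout (length w) i (prefix (length w))) (suc i) tt (layout (length w) 0 (prefix (length w)))
    spec-rewindAll zero = spec-exit (spec-≈ ≈-refl (spec-act λ _ ())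
      (mk≈ (λ _ → refl) λ y j → put-self (content s y) (head s y) j))
      where
      s = layout (length w) 0 (prefix (length w))
    spec-rewindAll (suc i) = spec-again
      (spec-≈ ≈-refl (spec-exit-≡ (cong (if_then just tt else nothing) inside) (spec-act ok))
        (mk≈ heads λ y j → put-self (content s y) (head s y) j))
      (spec-rewindAll i)
      where
      s  = layout (length w) (suc i) (prefix (length w))
      s′ = layout (length w) i (prefix (length w))

      inside : isStart (at s tmp) ≡ false
      inside = trans (cong isStart (prefix-word (suc i))) (nth-start w i)

      direction : Name → Direction
      direction y = if isStart (at s tmp) then stay else rewindAction (kind y)

      busy : ∀ y → direction y ≡ rewindAction (kind y)
      busy y = cong (if_then stay else rewindAction (kind y)) inside

      ok : ∀ y → direction y ≡ left → head s y ≢ 0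
      ok y eq with kind y | trans (sym (busy y)) eq
      ... | inputK | ()
      ... | tableK | ()
      ... | wordK  | _ = λ ()

      heads : ∀ y → shift (direction y) (head s y) ≡ head s′ y
      heads y rewrite busy y with kind y
      ... | inputK = refl
      ... | tableK = refl
      ... | wordK  = refl

    loaded : layout (length w) 0 (prefix (length w)) ≈ mem (λ _ → 0) zeroEnv noMarks
    loaded = mk≈ heads contents
      where
      heads : ∀ y → head (layout (length w) 0 (prefix (length w))) y ≡ head (mem (λ _ → 0) zeroEnv noMarks) y
      heads input        = refl
      heads tmp          = refl
      heads (var _)      = refl
      heads (table _)    = refl
      heads (stride _ _) = refl
      heads (round _ _)  = refl
      contents : ∀ y i → content (layout (length w) 0 (prefix (length w))) y i ≡ content (mem (λ _ → 0) zeroEnv noMarks) y i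
      contents input        i       = refl
      contents (table _)    zero    = refl
      contents (table _)    (suc i) = refl
      contents tmp          i       = prefix-word i
      contents (var _)      i       = prefix-word i
      contents (stride _ _) i       = prefix-word i
      contents (round _ _)  i       = prefix-word i

    spec-decide : ∀ {ds φ} → ListAll.All WellFormed ds → Clean φ zeroEnv →
                  Spec (decide ds φ) empty (⟦ decideCost ds φ ⟧ₚ B)
                    (does (dec φ zeroEnv (tablesAfter ds noMarks))) (mem (λ _ → 0) zeroEnv (tablesAfter ds noMarks))
    spec-decide {ds} wfs cl = spec-bind spec-markStart
      (spec-bind (spec-≤ (ℕ.n≤1+n _) (spec-copy (length w) 0 (ℕ.+-identityʳ _)))
        (spec-bind (spec-≈ ≈-refl (spec-rewindAll (suc (length w))) loaded) (spec-stages ds wfs cl)))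

    input-tapes : loadTape blank (map letter w) ∷ Vec.replicate (length otherNames) (loadTape blank []) ⊨ empty
    input-tapes = mk⊨ λ where
        zero    → first w
        (suc i) → subst (λ t → TapeAt (content empty (List.lookup otherNames i)) 0 t) (sym (lookup-replicate i (loadTape blank [])))
                    (other (List.lookup otherNames i) (ListAll.lookup notInput (∈-lookup i)))
      where
      first : ∀ v → TapeAt (nth (map letter v)) 0 (loadTape blank (map letter v))
      first []      = refl , λ { zero → refl ; (suc _) → refl }
      first (a ∷ v) = refl , λ { zero → refl ; (suc _) → refl }

      notInput : ListAll.All (_≢ input) otherNames
      notInput = (λ ()) ListAll.∷ ListAll.++⁺ (ListAll.map⁺ (ListAll.universal (λ _ ()) (allFin V)))
        (ListAll.++⁺ (ListAll.map⁺ (ListAll.universal (λ _ ()) (allFin R)))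
          (ListAll.++⁺ (all-indexed λ _ _ ()) (all-indexed λ _ _ ())))
        where
        all-indexed : ∀ {f : (r : Fin R) → Fin (arity r) → Name} → (∀ r i → f r i ≢ input) → ListAll.All (_≢ input) (indexed f)
        all-indexed ne = ListAll.concat⁺ (ListAll.map⁺ (ListAll.universal
          (λ r → ListAll.map⁺ (ListAll.universal (ne r) (allFin (arity r)))) (allFin R)))

      other : ∀ x → x ≢ input → TapeAt (content empty x) 0 (tape [] blank [])
      other input        ne = contradiction refl ne
      other tmp          ne = refl , λ { zero → refl ; (suc _) → refl }
      other (var _)      ne = refl , λ { zero → refl ; (suc _) → refl }
      other (table _)    ne = refl , λ { zero → refl ; (suc _) → refl }
      other (stride _ _) ne = refl , λ { zero → refl ; (suc _) → refl }
      other (round _ _)  ne = refl , λ { zero → refl ; (suc _) → refl }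

    -- Families of relations defined by recursion on a rank

    module Family (params : ∀ r → Vec (Fin V) (arity r)) (bodies : Fin R → Form)
                  (P : ∀ r → Vec ℕ (arity r) → Set) (rank : ∀ r → Vec ℕ (arity r) → ℕ)
                  (rank< : ∀ r v → BoundedVec v → rank r v < B ^ arity r) where

      Correct : Fin R → Tables → Set
      Correct r T = ∀ v → BoundedVec v → Bool.T (T r (index v)) ⇔ P r v

      -- Quantifies over all tables that are right on earlier relations and on smaller ranks of `r`:
      -- in the middle of a sweep nothing is known about the remaining entries. The formula may use
      -- negation, since the recursion rests on the rank alone.
      Sound : Fin R → Set
      Sound r = ∀ T v → BoundedVec v → (∀ r′ → r′ Fin.< r → Correct r′ T) →
        (∀ u → BoundedVec u → rank r u < rank r v → Bool.T (T r (index u)) ⇔ P r u) →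
        ⟦ bodies r ⟧ (assign zeroEnv (params r) v) T ⇔ P r v

      stage-correct : ∀ {T} r → Sound r → (∀ r′ → r′ Fin.< r → Correct r′ T) →
                      ∀ r′ → r′ Fin.≤ r → Correct r′ (defined r (params r) (bodies r) T)
      stage-correct {T} r sound earlier r′ r′≤r = by (r′ Fin.≟ r)
        where
        T-dec : ∀ {Q Q′ : Set} {d : Dec Q} → Q ⇔ Q′ → Bool.T (does d) ⇔ Q′
        T-dec {d = d} q = mk⇔ (λ t → Equivalence.to q (does-true d (Equivalence.to T-≡ t)))
                              (λ p → Equivalence.from T-≡ (dec-true d (Equivalence.from q p)))

        step : ∀ T′ v → BoundedVec v → Agree r T T′ →
               (∀ u → BoundedVec u → rank r u < rank r v → Bool.T (T′ r (index u)) ⇔ P r u) →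
               Bool.T (does (dec (bodies r) (assign zeroEnv (params r) v) T′)) ⇔ P r v
        step T′ v bv (agree a) lower = T-dec {d = dec (bodies r) (assign zeroEnv (params r) v) T′} (sound T′ v bv
          (λ r″ lt u bu → subst (λ b → Bool.T b ⇔ P r″ u) (a (λ { refl → ℕ.<-irrefl refl lt }) (index u)) (earlier r″ lt u bu)) lower)

        result = defined-correct {r} {params r} {bodies r} {T} (rank r) (λ v b → Bool.T b ⇔ P r v) (rank< r) step

        by : Dec (r′ ≡ r) → Correct r′ (defined r (params r) (bodies r) T)
        by (yes refl) = proj₂ result
        by (no r′≢r)  = λ u bu → subst (λ b → Bool.T b ⇔ P r′ u) (Agree.agrees (proj₁ result) (r′≢r ∘ sym) (index u))
                          (earlier r′ (ℕ.≤∧≢⇒< r′≤r (r′≢r ∘ Fin.toℕ-injective)) u bu)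

      all-correct : (∀ r → Sound r) → ∀ r → Correct r (tablesAfter (family params bodies) noMarks)
      all-correct sound r = go R (λ r → r) 0 (λ _ → refl) (λ _ ()) r (Fin.toℕ<n r)
        where
        -- Induction over the definitions still to be carried out: `f` enumerates them as a shift by
        -- `b`, and the relations before `b` are already correct.
        go : ∀ n (f : Fin n → Fin R) b → (∀ i → Fin.toℕ (f i) ≡ b + Fin.toℕ i) → ∀ {T} →
             (∀ r → Fin.toℕ r < b → Correct r T) → ∀ r → Fin.toℕ r < b + n →
             Correct r (tablesAfter (List.tabulate λ i → definition (f i) (params (f i)) (bodies (f i))) T)
        go zero    f b shifted earlier r lt = earlier r (subst (Fin.toℕ r <_) (ℕ.+-identityʳ b) lt)
        go (suc n) f b shifted earlier r lt = go n (f ∘ suc) (suc b) (λ i → trans (shifted (suc i)) (ℕ.+-suc b (Fin.toℕ i)))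
          (λ r r<1+b → stage-correct (f zero) (sound (f zero)) (λ r′ r′< → earlier r′ (subst (Fin.toℕ r′ <_) f0 r′<)) r
            (subst (Fin.toℕ r ≤_) (sym f0) (ℕ.≤-pred r<1+b)))
          r (subst (Fin.toℕ r <_) (ℕ.+-suc b n) lt)
          where
          f0 : Fin.toℕ (f zero) ≡ b
          f0 = trans (shifted zero) (ℕ.+-identityʳ b)

      family-decides : (∀ r → Sound r) → (∀ r → Unique (params r)) →
                       (∀ r v → BoundedVec v → Clean (bodies r) (assign zeroEnv (params r) v)) → ∀ φ → Clean φ zeroEnv →
                       ∃[ T ] (∀ r → Correct r T) × ∃[ s ] Spec (decide (family params bodies) φ) empty
                         (⟦ decideCost (family params bodies) φ ⟧ₚ B) (does (dec φ zeroEnv T)) s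
      family-decides sound unique clean φ cl =
        tablesAfter (family params bodies) noMarks , all-correct sound , _ ,
        spec-decide (ListAll.tabulate⁺ λ r → wellFormed (unique r) (clean r)) cl

  -- From programs to Turing machines, from cost to polynomial time

  machine : Prog Bool → TuringMachine A
  machine P = record
    { State            = Node P ⊎ Bool
    ; states           = elements fin
    ; states-complete  = complete fin
    ; Symbol           = Symbol A
    ; symbols          = elements finite-Symbol
    ; symbols-complete = complete finite-Symbol
    ; blank            = blank
    ; embed            = letter
    ; embed-injective  = λ { refl → refl }
    ; embed-nonblank   = λ _ ()
    ; workTapes        = length otherNames
    ; start            = inj₁ (entry P)
    ; accepting        = λ { (inj₁ _) → false ; (inj₂ b) → b }
    ; δ                = λ { (inj₁ n) ss → just (transition P n ss) ; (inj₂ _) _ → nothing }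
    }
    where
    fin = finite-⊎ {{nodes P}}

  machine-runs : ∀ (P : Prog Bool) {o ts t b ts′} → Reaches P o ts t b ts′ →
                 let open TuringMachine (machine P) in (o , ts) ⇓[ t ] (inj₂ b , ts′)
  machine-runs P done     = TuringMachine.halt refl
  machine-runs P (more s) = TuringMachine.next refl (machine-runs P s)

-- The argument has the form 2 + n because B exceeds the length of the input by two, for the start
-- cell and the first blank. Being positive, it admits raising both exponents of a sum to a common
-- one.
poly-bound : ∀ p → ∃[ a ] ∃[ d ] ∀ n → ⟦ p ⟧ₚ (2 + n) ≤ a * (2 + n) ^ d
poly-bound (con c) = c , 0 , λ n → ℕ.≤-reflexive (sym (ℕ.*-identityʳ c))
poly-bound base    = 1 , 1 , λ n → ℕ.≤-reflexive (sym (trans (ℕ.*-identityˡ _) (ℕ.*-identityʳ (2 + n))))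
poly-bound (p ⊕ q) with poly-bound p | poly-bound q
... | a , d , le | a′ , d′ , le′ = a + a′ , d + d′ , λ n →
  ℕ.≤-trans (ℕ.+-mono-≤ (ℕ.≤-trans (le n) (ℕ.*-monoʳ-≤ a (ℕ.^-monoʳ-≤ (2 + n) (ℕ.m≤m+n d d′))))
                        (ℕ.≤-trans (le′ n) (ℕ.*-monoʳ-≤ a′ (ℕ.^-monoʳ-≤ (2 + n) (ℕ.m≤n+m d′ d)))))
    (ℕ.≤-reflexive (sym (ℕ.*-distribʳ-+ ((2 + n) ^ (d + d′)) a a′)))
poly-bound (p ⊗ q) with poly-bound p | poly-bound q
... | a , d , le | a′ , d′ , le′ = a * a′ , d + d′ , λ n →
  ℕ.≤-trans (ℕ.*-mono-≤ (le n) (le′ n)) (ℕ.≤-reflexive (trans (ℕ.[m*n]*[o*p]≡[m*o]*[n*p] a ((2 + n) ^ d) a′ ((2 + n) ^ d′))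
    (cong (a * a′ *_) (sym (ℕ.^-distribˡ-+-* (2 + n) d d′)))))

^-distrib-* : ∀ d m n → (m * n) ^ d ≡ m ^ d * n ^ d
^-distrib-* zero    m n = refl
^-distrib-* (suc d) m n = trans (cong (m * n *_) (^-distrib-* d m n)) (ℕ.[m*n]*[o*p]≡[m*o]*[n*p] m n (m ^ d) (n ^ d))

-- For n ≥ 1 the base 2 + n is at most 3 * n, whence the factor 3 ^ d; the additive constant takes
-- care of n = 0.
poly-time : ∀ p → ∃[ a ] ∃[ d ] ∀ n → ⟦ p ⟧ₚ (2 + n) ≤ a * n ^ d + a
poly-time p with poly-bound p
... | a , d , le = a * 3 ^ d , d , λ n → ℕ.≤-trans (le n) (bound n)
  where
  bound : ∀ n → a * (2 + n) ^ d ≤ a * 3 ^ d * n ^ d + a * 3 ^ d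
  bound zero    = ℕ.≤-trans (ℕ.*-monoʳ-≤ a (ℕ.^-monoˡ-≤ d (ℕ.n≤1+n 2))) (ℕ.m≤n+m _ _)
  bound n@(suc m) = ℕ.≤-trans
    (ℕ.≤-trans (ℕ.*-monoʳ-≤ a (ℕ.^-monoˡ-≤ d (ℕ.≤-trans (ℕ.+-monoˡ-≤ n (ℕ.*-monoʳ-≤ 2 (s≤s (z≤n {m})))) (ℕ.≤-reflexive (ℕ.+-comm (2 * n) n)))))
      (ℕ.≤-reflexive (trans (cong (a *_) (^-distrib-* d 3 n)) (sym (ℕ.*-assoc a (3 ^ d) (n ^ d))))))
    (ℕ.m≤m+n _ _)

-- Reading bins and pallet symbols off the encoded instance

instance
  finite-InputSymbol : Finite InputSymbol
  finite-InputSymbol = finite (bit zero ∷ bit (suc zero) ∷ endNumber ∷ endSequence ∷ []) λ where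
    (bit zero)       → here refl
    (bit (suc zero)) → there (here refl)
    endNumber        → there (there (here refl))
    endSequence      → there (there (there (here refl)))

Sym : Set
Sym = Symbol InputSymbol

isHash isDollar isBit : Sym → Bool
isHash (letter endNumber) = true
isHash _                  = false
isDollar (letter endSequence) = true
isDollar _                    = false
isBit (letter (bit _)) = true
isBit _                = false

isDigit : Bit → Sym → Bool
isDigit zero       (letter (bit zero))       = true
isDigit (suc zero) (letter (bit (suc zero))) = true
isDigit _          _                         = false

oddStep : Sym → Bool → Bool
oddStep (letter endNumber)   b = not b
oddStep (letter endSequence) b = false
oddStep _                    b = b

-- The parity of the number of `endNumber`s before the next `endSequence`. The number of places is
-- followed by complete bins only, hence by an even number, and is not mistaken for a name.
odd : List Sym → Bool
odd []      = false
odd (a ∷ v) = oddStep a (odd v)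

digits : List Sym → List Bit
digits (letter (bit b) ∷ v) = b ∷ digits v
digits _                    = []

-- Within a sequence, an endNumber ends the name of a bin (rather than a pallet symbol) iff an odd number of them follows.
-- A pallet symbol is identified with its digits.
pallets palletsHere : List Sym → List (List Bit)
pallets []                     = []
pallets (letter endNumber ∷ v) = if odd v then digits v ∷ pallets v else pallets v
pallets (_ ∷ v)                = pallets v
palletsHere []                       = []
palletsHere (letter endNumber ∷ v)   = if odd v then digits v ∷ palletsHere v else palletsHere v
palletsHere (letter endSequence ∷ v) = []
palletsHere (_ ∷ v)                  = palletsHere v

-- One step of a scan from left to right, the mirror image of `palletsHere`: it collects the bins of
-- the current sequence whose names have been passed, and starts afresh after each end of a
-- sequence.
beforeStep : Sym → List Sym → List (List Bit) → List (List Bit)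
beforeStep (letter endSequence) v ts = []
beforeStep (letter endNumber)   v ts = if odd v then ts ++ [ digits v ] else ts
beforeStep _                    v ts = ts

-- The eight relations and their defining formulas

module StackUpFormulas (k : ℕ) where

  arity : Fin 8 → ℕ
  arity zero                                                 = 2
  arity (suc zero)                                           = 1
  arity (suc (suc zero))                                     = 2
  arity (suc (suc (suc zero)))                               = 2
  arity (suc (suc (suc (suc zero))))                         = 2
  arity (suc (suc (suc (suc (suc zero)))))                   = 2
  arity (suc (suc (suc (suc (suc (suc zero))))))             = 2 + k
  arity (suc (suc (suc (suc (suc (suc (suc zero)))))))       = k

  pattern leᴿ   = zero
  pattern oddᴿ  = suc zero
  pattern sameᴿ = suc (suc zero)
  pattern segᴿ  = suc (suc (suc zero))
  pattern dblᴿ  = suc (suc (suc (suc zero)))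
  pattern valᴿ  = suc (suc (suc (suc (suc zero))))
  pattern cntᴿ  = suc (suc (suc (suc (suc (suc zero)))))
  pattern goodᴿ = suc (suc (suc (suc (suc (suc (suc zero))))))

  -- The pointer C i runs through the i-th sequence symbol by symbol; a bin is removed once C i has passed the end of its name.
  pattern X = zero
  pattern Y = suc zero
  pattern M = suc (suc zero)
  pattern H = suc (suc (suc zero))
  pattern C i = suc (suc (suc (suc i)))

  open Logic InputSymbol (4 + k) 8 arity public

  Var : Set
  Var = Fin (4 + k)

  cs : Vec Var k
  cs = tabulate λ i → C i

  orAll andAll : ∀ n → (Fin n → Form) → Form
  orAll zero     φ = is X λ _ → false
  orAll (suc n)  φ = φ zero ∨ᶠ orAll n (φ ∘ suc)
  andAll zero    φ = is X λ _ → true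
  andAll (suc n) φ = φ zero ∧ᶠ andAll n (φ ∘ suc)

  leF : Form
  leF = is X isStart ∨ᶠ prev X (prev Y (call leᴿ (X ∷ Y ∷ [])))

  oddF : Form
  oddF = is X isHash ∧ᶠ next X (~ᶠ call oddᴿ (X ∷ [])) ∨ᶠ
         (~ᶠ is X isHash) ∧ᶠ (~ᶠ is X isDollar) ∧ᶠ next X (call oddᴿ (X ∷ []))

  sameF : Form
  sameF = (~ᶠ is X isBit) ∧ᶠ (~ᶠ is Y isBit) ∨ᶠ
          (is X (isDigit zero) ∧ᶠ is Y (isDigit zero) ∨ᶠ is X (isDigit (suc zero)) ∧ᶠ is Y (isDigit (suc zero))) ∧ᶠ
          next X (next Y (call sameᴿ (X ∷ Y ∷ [])))

  segF : Form
  segF = call leᴿ (X ∷ Y ∷ []) ∧ᶠ call leᴿ (Y ∷ X ∷ []) ∨ᶠ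
         (~ᶠ is X isDollar) ∧ᶠ next X (call segᴿ (X ∷ Y ∷ []))

  -- Expresses m ≤ 2h: two is taken from `M` for each one taken from `H`. The inner test for the
  -- start covers odd m.
  dblF : Form
  dblF = is M isStart ∨ᶠ prev H (prev M (is M isStart ∨ᶠ prev M (call dblᴿ (M ∷ H ∷ []))))

  -- A binary number may exceed every position, so only its comparison with a position m is defined.
  -- With least significant digit d and value v of the other digits, m ≤ d + 2v holds iff m is 0 or
  -- m - d ≤ 2h for some position h ≤ v.
  valF : Form
  valF = is M isStart ∨ᶠ
         is X (isDigit zero) ∧ᶠ ex H (call dblᴿ (M ∷ H ∷ []) ∧ᶠ next X (call valᴿ (H ∷ X ∷ []))) ∨ᶠ
         is X (isDigit (suc zero)) ∧ᶠ prev M (ex H (call dblᴿ (M ∷ H ∷ []) ∧ᶠ next X (call valᴿ (H ∷ X ∷ []))))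

  markerF : Var → Form
  markerF v = is v isHash ∧ᶠ next v (call oddᴿ (v ∷ []))

  matchF : Form
  matchF = markerF Y ∧ᶠ next X (next Y (call sameᴿ (X ∷ Y ∷ [])))

  hereF beforeF advanceF : Fin k → Form
  hereF i    = ex Y (call segᴿ (C i ∷ Y ∷ []) ∧ᶠ matchF)
  beforeF i  = ex Y (matchF ∧ᶠ next Y (call segᴿ (Y ∷ C i ∷ [])))
  advanceF i = (~ᶠ is (C i) isDollar) ∧ᶠ next (C i) (call goodᴿ cs)

  -- An open pallet is counted at the last bin destined for it.
  countedF : Form
  countedF = markerF X ∧ᶠ
             (~ᶠ ex Y (next X (call leᴿ (X ∷ Y ∷ [])) ∧ᶠ matchF)) ∧ᶠ
             orAll k hereF ∧ᶠ
             orAll k beforeF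

  -- Only the lower bound m ≤ count is asserted, so the last disjunct, which ignores the symbol at
  -- `X`, is sound at counted and uncounted positions alike.
  cntF : Form
  cntF = is M isStart ∨ᶠ
         countedF ∧ᶠ prev M (next X (call cntᴿ (X ∷ M ∷ cs))) ∨ᶠ
         next X (call cntᴿ (X ∷ M ∷ cs))

  -- The first conjunct says count ≤ p: no position lies below the count without lying below p. The
  -- variable `X` stands at 0 here, so the count is over the whole text, and position 1 is where the
  -- digits of p begin.
  goodF : Form
  goodF = (~ᶠ ex M (call cntᴿ (X ∷ M ∷ cs) ∧ᶠ (~ᶠ next X (call valᴿ (M ∷ X ∷ []))))) ∧ᶠ
          (andAll k (λ i → is (C i) isDollar) ∨ᶠ
           orAll k advanceF)

  -- The successor of `v` is guessed as `u` and checked to follow immediately after the first end of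
  -- a sequence at or after `v`.
  chainF : ∀ {n} → Var → Vec Var n → Form → Form
  chainF v []       φ = φ
  chainF v (u ∷ us) φ = ex u (prev u (call segᴿ (v ∷ u ∷ []) ∧ᶠ is u isDollar) ∧ᶠ chainF u us φ)

  -- The first pointer starts at 0 and thus also travels over the number of places, where no name of
  -- a bin ends.
  startF : ∀ {n} → Vec Var n → Form → Form
  startF []       φ = φ
  startF (v ∷ vs) φ = chainF v vs φ

  params : ∀ r → Vec Var (arity r)
  params leᴿ   = X ∷ Y ∷ []
  params oddᴿ  = X ∷ []
  params sameᴿ = X ∷ Y ∷ []
  params segᴿ  = X ∷ Y ∷ []
  params dblᴿ  = M ∷ H ∷ []
  params valᴿ  = M ∷ X ∷ []
  params cntᴿ  = X ∷ M ∷ cs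
  params goodᴿ = cs

  formula : Fin 8 → Form
  formula leᴿ   = leF
  formula oddᴿ  = oddF
  formula sameᴿ = sameF
  formula segᴿ  = segF
  formula dblᴿ  = dblF
  formula valᴿ  = valF
  formula cntᴿ  = cntF
  formula goodᴿ = goodF

  -- Intended meaning of the relations

  module Meaning (w : List InputSymbol) where

    open Correctness w public

    text : List Sym
    text = start ∷ map letter w

    suff : ℕ → List Sym
    suff i = drop i text

    beyond : ∀ i → last ≤ i → word i ≡ blank
    beyond (suc i) (s≤s n≤i) = go w i n≤i
      where
      go : ∀ (v : List InputSymbol) i → length v ≤ i → nth (map letter v) i ≡ blank
      go []      i       _       = refl
      go (a ∷ v) (suc i) (s≤s l) = go v i l

    suff-end : ∀ i → last ≤ i → suff i ≡ []
    suff-end (suc i) (s≤s n≤i) = go w i n≤i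
      where
      go : ∀ (v : List InputSymbol) i → length v ≤ i → drop i (map letter v) ≡ []
      go []      zero    _       = refl
      go []      (suc i) _       = refl
      go (a ∷ v) (suc i) (s≤s l) = go v i l

    suff-∷ : ∀ i → i < last → suff i ≡ word i ∷ suff (suc i)
    suff-∷ zero    _         = refl
    suff-∷ (suc i) (s≤s i<n) = go w i i<n
      where
      go : ∀ (v : List InputSymbol) i → i < length v → drop i (map letter v) ≡ nth (map letter v) i ∷ drop (suc i) (map letter v)
      go (a ∷ v) zero    _       = refl
      go (a ∷ v) (suc i) (s≤s l) = go v i l

    nonblank⇒< : ∀ {i} → word i ≢ blank → i < last
    nonblank⇒< {i} ne with i <? last
    ... | yes i< = i<
    ... | no i≮  = contradiction (beyond i (ℕ.≮⇒≥ i≮)) ne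

    symbol⇒< : ∀ {i} (p : Sym → Bool) → p blank ≡ false → T (p (word i)) → i < last
    symbol⇒< p pb t = nonblank⇒< λ eq → subst T (trans (cong p eq) pb) t

    start⇒0 : ∀ {i} → T (isStart (word i)) → i ≡ 0
    start⇒0 {zero}  _ = refl
    start⇒0 {suc i} t = ⊥-elim (subst T (nth-start w i) t)

    Marker : ℕ → Set
    Marker y = T (isHash (word y)) × T (odd (suff (suc y)))

    -- No sequence ends in the positions from x up to (but not including) y.
    data Seg : ℕ → ℕ → Set where
      here  : ∀ {x} → Seg x x
      there : ∀ {x y} → ¬ T (isDollar (word x)) → Seg (suc x) y → Seg x y

    palletsBefore : ℕ → List (List Bit)
    palletsBefore zero    = []
    palletsBefore (suc i) = beforeStep (word i) (suff (suc i)) (palletsBefore i)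

    Open : Vec ℕ k → List Bit → Set
    Open c t = (∃[ i ] t ∈ palletsHere (suff (lookup c i))) × (∃[ i ] t ∈ palletsBefore (lookup c i))

    open DecMembership (List.≡-dec (Fin._≟_ {2})) using (_∈?_) public

    open? : ∀ c t → Dec (Open c t)
    open? c t = Fin.any? (λ i → t ∈? palletsHere (suff (lookup c i))) ×-dec Fin.any? (λ i → t ∈? palletsBefore (lookup c i))

    -- Drops an open pallet that occurs again further on, so each open pallet is listed exactly
    -- once. Whether a pallet recurs is visible from the rest of the text, as the recursion from
    -- right to left requires.
    lastOpen : Vec ℕ k → List (List Bit) → List (List Bit)
    lastOpen c []       = []
    lastOpen c (t ∷ ts) = if does (open? c t ×-dec ¬? (t ∈? ts)) then t ∷ lastOpen c ts else lastOpen c ts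

    Fits : Vec ℕ k → Set
    Fits c = length (lastOpen c (pallets text)) ≤ fromDigits (digits (suff 1))

    data Good (c : Vec ℕ k) : Set where
      finished : Fits c → (∀ i → T (isDollar (word (lookup c i)))) → Good c
      advanced : Fits c → ∀ i → ¬ T (isDollar (word (lookup c i))) → lookup c i < last →
                 Good (c [ i ]≔ suc (lookup c i)) → Good c

    P : ∀ r → Vec ℕ (arity r) → Set
    P leᴿ   (x ∷ y ∷ []) = x ≤ y
    P oddᴿ  (x ∷ [])     = T (odd (suff x))
    P sameᴿ (x ∷ y ∷ []) = digits (suff x) ≡ digits (suff y)
    P segᴿ  (x ∷ y ∷ []) = Seg x y
    P dblᴿ  (m ∷ h ∷ []) = m ≤ h * 2
    P valᴿ  (m ∷ x ∷ []) = m ≤ fromDigits (digits (suff x))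
    P cntᴿ  (x ∷ m ∷ c)  = m ≤ length (lastOpen c (pallets (suff x)))
    P goodᴿ c            = Good c

    remaining : ∀ {n} → Vec ℕ n → ℕ
    remaining []      = 0
    remaining (i ∷ c) = (last ∸ i) + remaining c

    -- `leᴿ` and `dblᴿ` recurse towards position 0, the others towards the end of the input; for
    -- `goodᴿ` each move of a pointer shortens the total distance by one.
    rank : ∀ r → Vec ℕ (arity r) → ℕ
    rank leᴿ   (x ∷ y ∷ []) = x
    rank oddᴿ  (x ∷ [])     = last ∸ x
    rank sameᴿ (x ∷ y ∷ []) = last ∸ x
    rank segᴿ  (x ∷ y ∷ []) = last ∸ x
    rank dblᴿ  (m ∷ h ∷ []) = m
    rank valᴿ  (m ∷ x ∷ []) = last ∸ x
    rank cntᴿ  (x ∷ m ∷ c)  = last ∸ x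
    rank goodᴿ c            = remaining c

    remaining< : ∀ {n} (c : Vec ℕ n) → remaining c < B ^ n
    remaining< []              = s≤s z≤n
    remaining< {suc n} (i ∷ c) = ℕ.<-≤-trans (s≤s (ℕ.+-monoˡ-≤ (remaining c) (ℕ.m∸n≤m last i)))
      (ℕ.≤-trans (ℕ.≤-reflexive (sym (ℕ.+-suc last (remaining c))))
        (ℕ.≤-trans (ℕ.+-mono-≤ (ℕ.m≤m*n last (B ^ n) {{ℕ.m^n≢0 B n}}) (remaining< c))
          (ℕ.≤-reflexive (ℕ.+-comm (last * B ^ n) (B ^ n)))))

    small : ∀ {i} n → i ≤ last → i < B ^ suc n
    small n i≤ = ℕ.<-≤-trans (s≤s i≤) (ℕ.m≤m*n B (B ^ n) {{ℕ.m^n≢0 B n}})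

    rank< : ∀ r v → BoundedVec v → rank r v < B ^ arity r
    rank< leᴿ   (x ∷ y ∷ []) (x≤ ∷ _) = small 1 x≤
    rank< oddᴿ  (x ∷ [])     _        = small 0 (ℕ.m∸n≤m last x)
    rank< sameᴿ (x ∷ y ∷ []) _        = small 1 (ℕ.m∸n≤m last x)
    rank< segᴿ  (x ∷ y ∷ []) _        = small 1 (ℕ.m∸n≤m last x)
    rank< dblᴿ  (m ∷ h ∷ []) (m≤ ∷ _) = small 1 m≤
    rank< valᴿ  (m ∷ x ∷ []) _        = small 1 (ℕ.m∸n≤m last x)
    rank< cntᴿ  (x ∷ m ∷ c)  _        = small (suc k) (ℕ.m∸n≤m last x)
    rank< goodᴿ c            _        = remaining< c

    open Family params formula P rank rank< public

    -- The four ways in which a position can act on all three lists of pallets at once. Case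
    -- distinction on it replaces reasoning about individual symbols later on.
    data View (i : ℕ) : Set where
      end    : last ≤ i → suff i ≡ [] → View i
      marker : i < last → Marker i → ¬ T (isDollar (word i)) →
               pallets (suff i) ≡ digits (suff (suc i)) ∷ pallets (suff (suc i)) →
               palletsHere (suff i) ≡ digits (suff (suc i)) ∷ palletsHere (suff (suc i)) →
               palletsBefore (suc i) ≡ palletsBefore i ++ [ digits (suff (suc i)) ] → View i
      dollar : i < last → ¬ Marker i → T (isDollar (word i)) →
               pallets (suff i) ≡ pallets (suff (suc i)) → palletsHere (suff i) ≡ [] → palletsBefore (suc i) ≡ [] → View i
      other  : i < last → ¬ Marker i → ¬ T (isDollar (word i)) →
               pallets (suff i) ≡ pallets (suff (suc i)) → palletsHere (suff i) ≡ palletsHere (suff (suc i)) →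
               palletsBefore (suc i) ≡ palletsBefore i → View i

    view : ∀ i → View i
    view i with i <? last
    ... | no i≮  = end (ℕ.≮⇒≥ i≮) (suff-end i (ℕ.≮⇒≥ i≮))
    ... | yes i< = at-symbol (word i) refl (suff-∷ i i<)
      where
      before : ∀ {a} → word i ≡ a → palletsBefore (suc i) ≡ beforeStep a (suff (suc i)) (palletsBefore i)
      before eq = cong (λ a → beforeStep a (suff (suc i)) (palletsBefore i)) eq

      plain : ∀ {a} → word i ≡ a → ¬ T (isHash a) → ¬ T (isDollar a) → pallets (suff i) ≡ pallets (suff (suc i)) →
              palletsHere (suff i) ≡ palletsHere (suff (suc i)) → palletsBefore (suc i) ≡ palletsBefore i → View i
      plain eq ¬h ¬d = other i< (λ m → ¬h (subst (T ∘ isHash) eq (proj₁ m))) (λ d → ¬d (subst (T ∘ isDollar) eq d))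

      at-symbol : ∀ a → word i ≡ a → suff i ≡ a ∷ suff (suc i) → View i
      at-symbol blank            eq s = plain eq (λ ()) (λ ()) (cong pallets s) (cong palletsHere s) (before eq)
      at-symbol start            eq s = plain eq (λ ()) (λ ()) (cong pallets s) (cong palletsHere s) (before eq)
      at-symbol mark             eq s = plain eq (λ ()) (λ ()) (cong pallets s) (cong palletsHere s) (before eq)
      at-symbol (letter (bit b)) eq s = plain eq (λ ()) (λ ()) (cong pallets s) (cong palletsHere s) (before eq)
      at-symbol (letter endSequence) eq s = dollar i< (λ m → subst (T ∘ isHash) eq (proj₁ m))
        (subst (T ∘ isDollar) (sym eq) tt) (cong pallets s) (cong palletsHere s) (before eq)
      at-symbol (letter endNumber) eq s with odd (suff (suc i)) in o
      ... | true  = marker i< (subst (T ∘ isHash) (sym eq) tt , subst T (sym o) tt) (subst (T ∘ isDollar) eq)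
        (trans (cong pallets s) (cong (if_then digits (suff (suc i)) ∷ pallets (suff (suc i)) else pallets (suff (suc i))) o))
        (trans (cong palletsHere s) (cong (if_then digits (suff (suc i)) ∷ palletsHere (suff (suc i)) else palletsHere (suff (suc i))) o))
        (trans (before eq) (cong (if_then palletsBefore i ++ [ digits (suff (suc i)) ] else palletsBefore i) o))
      ... | false = other i< (λ m → subst T o (proj₂ m)) (subst (T ∘ isDollar) eq)
        (trans (cong pallets s) (cong (if_then digits (suff (suc i)) ∷ pallets (suff (suc i)) else pallets (suff (suc i))) o))
        (trans (cong palletsHere s) (cong (if_then digits (suff (suc i)) ∷ palletsHere (suff (suc i)) else palletsHere (suff (suc i))) o))
        (trans (before eq) (cong (if_then palletsBefore i ++ [ digits (suff (suc i)) ] else palletsBefore i) o))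

    data DigitView (i : ℕ) : Set where
      none : (∀ b → ¬ T (isDigit b (word i))) → ¬ T (isBit (word i)) → digits (suff i) ≡ [] → DigitView i
      some : ∀ b → word i ≡ letter (bit b) → i < last → digits (suff i) ≡ b ∷ digits (suff (suc i)) → DigitView i

    digitView : ∀ i → DigitView i
    digitView i with i <? last
    ... | no i≮  = none (λ b t → digit-blank b (subst (T ∘ isDigit b) (beyond i (ℕ.≮⇒≥ i≮)) t))
                     (subst (T ∘ isBit) (beyond i (ℕ.≮⇒≥ i≮))) (cong digits (suff-end i (ℕ.≮⇒≥ i≮)))
      where
      digit-blank : ∀ b → ¬ T (isDigit b blank)
      digit-blank zero       ()
      digit-blank (suc zero) ()
    ... | yes i< = at-symbol (word i) refl (suff-∷ i i<)
      where
      plain : ∀ {a} → word i ≡ a → (∀ b → ¬ T (isDigit b a)) → ¬ T (isBit a) → digits (suff i) ≡ [] → DigitView i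
      plain eq ¬d ¬b = none (λ b t → ¬d b (subst (T ∘ isDigit b) eq t)) (¬b ∘ subst (T ∘ isBit) eq)

      at-symbol : ∀ a → word i ≡ a → suff i ≡ a ∷ suff (suc i) → DigitView i
      at-symbol (letter (bit b))     eq s = some b eq i< (cong digits s)
      at-symbol (letter endNumber)   eq s = plain eq (λ { zero () ; (suc zero) () }) (λ ()) (cong digits s)
      at-symbol (letter endSequence) eq s = plain eq (λ { zero () ; (suc zero) () }) (λ ()) (cong digits s)
      at-symbol blank eq s = plain eq (λ { zero () ; (suc zero) () }) (λ ()) (cong digits s)
      at-symbol start eq s = plain eq (λ { zero () ; (suc zero) () }) (λ ()) (cong digits s)
      at-symbol mark  eq s = plain eq (λ { zero () ; (suc zero) () }) (λ ()) (cong digits s)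

    Seg⇒≤ : ∀ {x y} → Seg x y → x ≤ y
    Seg⇒≤ here        = ℕ.≤-refl
    Seg⇒≤ (there _ s) = ℕ.<⇒≤ (Seg⇒≤ s)

    Seg-snoc : ∀ {x y} → Seg x y → ¬ T (isDollar (word y)) → Seg x (suc y)
    Seg-snoc here        nd = there nd here
    Seg-snoc (there p s) nd = there p (Seg-snoc s nd)

    Seg-unsnoc : ∀ {x y} → Seg x (suc y) → x ≡ suc y ⊎ (Seg x y × ¬ T (isDollar (word y)))
    Seg-unsnoc here = inj₁ refl
    Seg-unsnoc (there nd s) with Seg-unsnoc s
    ... | inj₁ refl     = inj₂ (here , nd)
    ... | inj₂ (s′ , p) = inj₂ (there nd s′ , p)

    marker⇒< : ∀ {y} → Marker y → y < last
    marker⇒< m = symbol⇒< isHash refl (proj₁ m)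

    ∈-pallets-skip : ∀ t a → ¬ Marker a → pallets (suff a) ≡ pallets (suff (suc a)) →
      t ∈ pallets (suff (suc a)) ⇔ (∃[ y ] suc a ≤ y × Marker y × digits (suff (suc y)) ≡ t) →
      t ∈ pallets (suff a) ⇔ (∃[ y ] a ≤ y × Marker y × digits (suff (suc y)) ≡ t)
    ∈-pallets-skip t a ¬m p ih = mk⇔
      (λ t∈ → let y , a<y , rest = to ih (subst (t ∈_) p t∈) in y , ℕ.<⇒≤ a<y , rest)
      (λ (y , a≤y , m , d) → subst (t ∈_) (sym p) (case ℕ.m≤n⇒m<n∨m≡n a≤y of λ where
        (inj₁ a<y)  → from ih (y , a<y , m , d)
        (inj₂ refl) → contradiction m ¬m))

    -- Turns membership in a list of pallets, in which the meaning is stated, into a quantification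
    -- over positions, which a formula can express. The induction is on the distance `n` to the end
    -- of the text.
    ∈-pallets : ∀ t n a → a + n ≡ last → t ∈ pallets (suff a) ⇔ (∃[ y ] a ≤ y × Marker y × digits (suff (suc y)) ≡ t)
    ∈-pallets t zero a eq = mk⇔
      (λ t∈ → case subst (λ v → t ∈ pallets v) (suff-end a last≤a) t∈ of λ ())
      (λ (y , a≤y , m , _) → contradiction (marker⇒< m) (ℕ.≤⇒≯ (ℕ.≤-trans last≤a a≤y)))
      where
      last≤a : last ≤ a
      last≤a = ℕ.≤-reflexive (trans (sym eq) (ℕ.+-identityʳ a))
    ∈-pallets t (suc n) a eq with view a | ∈-pallets t n (suc a) (trans (sym (ℕ.+-suc a n)) eq)
    ... | end last≤a _ | _ = contradiction (ℕ.≤-trans (ℕ.m≤m+n (suc a) n) (ℕ.≤-reflexive (trans (sym (ℕ.+-suc a n)) eq))) (ℕ.≤⇒≯ last≤a)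
    ... | marker _ m _ p _ _ | ih = mk⇔
      (λ t∈ → case subst (t ∈_) p t∈ of λ where
        (here refl) → a , ℕ.≤-refl , m , refl
        (there t∈′) → let y , a<y , rest = to ih t∈′ in y , ℕ.<⇒≤ a<y , rest)
      (λ (y , a≤y , m′ , d) → subst (t ∈_) (sym p) (case ℕ.m≤n⇒m<n∨m≡n a≤y of λ where
        (inj₁ a<y)  → there (from ih (y , a<y , m′ , d))
        (inj₂ refl) → here (sym d)))
    ... | dollar _ ¬m _ p _ _ | ih = ∈-pallets-skip t a ¬m p ih
    ... | other _ ¬m _ p _ _  | ih = ∈-pallets-skip t a ¬m p ih

    ∈-palletsHere⁻ : ∀ t n a → a + n ≡ last → t ∈ palletsHere (suff a) → ∃[ y ] Seg a y × Marker y × digits (suff (suc y)) ≡ t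
    ∈-palletsHere⁻ t zero a eq t∈ = case subst (λ v → t ∈ palletsHere v) (suff-end a (ℕ.≤-reflexive (trans (sym eq) (ℕ.+-identityʳ a)))) t∈ of λ ()
    ∈-palletsHere⁻ t (suc n) a eq t∈ with view a
    ... | end _ s = case subst (λ v → t ∈ palletsHere v) s t∈ of λ ()
    ... | dollar _ _ _ _ p _ = case subst (t ∈_) p t∈ of λ ()
    ... | other _ _ nd _ p _ = let y , s , rest = ∈-palletsHere⁻ t n (suc a) (trans (sym (ℕ.+-suc a n)) eq) (subst (t ∈_) p t∈) in y , there nd s , rest
    ... | marker _ m nd _ p _ with subst (t ∈_) p t∈
    ...   | here refl = a , here , m , refl
    ...   | there t∈′ = let y , s , rest = ∈-palletsHere⁻ t n (suc a) (trans (sym (ℕ.+-suc a n)) eq) t∈′ in y , there nd s , rest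

    ∈-palletsHere⁺ : ∀ {t a y} → Seg a y → Marker y → digits (suff (suc y)) ≡ t → t ∈ palletsHere (suff a)
    ∈-palletsHere⁺ {t} {a} here m d with view a
    ... | end last≤a _         = contradiction (marker⇒< m) (ℕ.≤⇒≯ last≤a)
    ... | marker _ _ _ _ p _   = subst (t ∈_) (sym p) (here (sym d))
    ... | dollar _ ¬m _ _ _ _  = contradiction m ¬m
    ... | other _ ¬m _ _ _ _   = contradiction m ¬m
    ∈-palletsHere⁺ {t} {a} (there nd s) m d with view a | ∈-palletsHere⁺ s m d
    ... | end last≤a _         | _  = contradiction (ℕ.<-trans (Seg⇒≤ s) (marker⇒< m)) (ℕ.≤⇒≯ last≤a)
    ... | marker _ _ _ _ p _   | t∈ = subst (t ∈_) (sym p) (there t∈)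
    ... | dollar _ _ dl _ _ _  | _  = contradiction dl nd
    ... | other _ _ _ _ p _    | t∈ = subst (t ∈_) (sym p) t∈

    ∈-palletsBefore⁻ : ∀ {t} c → t ∈ palletsBefore c → ∃[ y ] Seg (suc y) c × Marker y × digits (suff (suc y)) ≡ t
    ∈-palletsBefore⁻ {t} (suc c) t∈ with view c
    ... | end last≤c _ = earlier (subst (t ∈_) unchanged t∈)
      where
      unchanged : palletsBefore (suc c) ≡ palletsBefore c
      unchanged rewrite beyond c last≤c = refl
      earlier : t ∈ palletsBefore c → _
      earlier t∈′ = let y , s , rest = ∈-palletsBefore⁻ c t∈′ in y , Seg-snoc s (subst (T ∘ isDollar) (beyond c last≤c)) , rest
    ... | dollar _ _ _ _ _ p = case subst (t ∈_) p t∈ of λ ()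
    ... | other _ _ nd _ _ p = let y , s , rest = ∈-palletsBefore⁻ c (subst (t ∈_) p t∈) in y , Seg-snoc s nd , rest
    ... | marker _ m nd _ _ p with ∈-++⁻ (palletsBefore c) (subst (t ∈_) p t∈)
    ...   | inj₁ t∈′         = let y , s , rest = ∈-palletsBefore⁻ c t∈′ in y , Seg-snoc s nd , rest
    ...   | inj₂ (here refl) = c , here , m , refl

    ∈-palletsBefore⁺ : ∀ {t y} c → Seg (suc y) c → Marker y → digits (suff (suc y)) ≡ t → t ∈ palletsBefore c
    ∈-palletsBefore⁺ zero s m d = case Seg⇒≤ s of λ ()
    ∈-palletsBefore⁺ {t} (suc c) s m d with view c | Seg-unsnoc s
    ... | marker _ _ _ _ _ p  | inj₁ refl     = subst (t ∈_) (sym p) (∈-++⁺ʳ (palletsBefore c) (here (sym d)))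
    ... | marker _ _ _ _ _ p  | inj₂ (s′ , _) = subst (t ∈_) (sym p) (∈-++⁺ˡ (∈-palletsBefore⁺ c s′ m d))
    ... | end last≤c _        | inj₁ refl     = contradiction (marker⇒< m) (ℕ.≤⇒≯ last≤c)
    ... | end last≤c _        | inj₂ (s′ , _) = subst (t ∈_) (sym unchanged) (∈-palletsBefore⁺ c s′ m d)
      where
      unchanged : palletsBefore (suc c) ≡ palletsBefore c
      unchanged rewrite beyond c last≤c = refl
    ... | dollar _ ¬m _ _ _ _ | inj₁ refl     = contradiction m ¬m
    ... | dollar _ _ dl _ _ _ | inj₂ (_ , nd) = contradiction dl nd
    ... | other _ ¬m _ _ _ _  | inj₁ refl     = contradiction m ¬m
    ... | other _ _ _ _ _ p   | inj₂ (s′ , _) = subst (t ∈_) (sym p) (∈-palletsBefore⁺ c s′ m d)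

    closer : ∀ {x} → x < last → last ∸ suc x < last ∸ x
    closer {x} x< = ℕ.∸-monoʳ-< ℕ.≤-refl x<

    -- Soundness of the arithmetical and textual relations

    Below : Fin 8 → Tables → Set
    Below r τ = ∀ r′ → r′ Fin.< r → Correct r′ τ

    sound-le : Sound leᴿ
    sound-le τ (zero ∷ y ∷ []) _ _ lower = mk⇔ (λ _ → z≤n) (λ _ → inj₁ tt)
    sound-le τ (suc x ∷ y ∷ []) (x≤ ∷ y≤ ∷ []) _ lower = mk⇔ there′ back
      where
      IH : ∀ y → y ≤ last → T (τ leᴿ (index (x ∷ y ∷ []))) ⇔ x ≤ y
      IH y y≤ = lower (x ∷ y ∷ []) (ℕ.<⇒≤ x≤ ∷ y≤ ∷ []) ℕ.≤-refl
      there′ : ⟦ leF ⟧ (assign zeroEnv (X ∷ Y ∷ []) (suc x ∷ y ∷ [])) τ → suc x ≤ y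
      there′ (inj₁ t) = contradiction (start⇒0 {suc x} t) λ ()
      there′ (inj₂ (_ , 0<y , t)) = ℕ.≤-trans (s≤s (to (IH (pred y) (ℕ.≤-trans ℕ.pred[n]≤n y≤)) t)) (ℕ.≤-reflexive (ℕ.suc-pred y {{>-nonZero 0<y}}))
      back : suc x ≤ y → ⟦ leF ⟧ (assign zeroEnv (X ∷ Y ∷ []) (suc x ∷ y ∷ [])) τ
      back (s≤s x≤y) = inj₂ (s≤s z≤n , s≤s z≤n , from (IH _ (ℕ.<⇒≤ y≤)) x≤y)

    sound-odd : Sound oddᴿ
    sound-odd τ (x ∷ []) (x≤ ∷ []) _ lower = by (x <? last)
      where
      by : Dec (x < last) → ⟦ oddF ⟧ (assign zeroEnv (X ∷ []) (x ∷ [])) τ ⇔ T (odd (suff x))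
      by (no x≮) = mk⇔ (λ { (inj₁ (_ , x< , _)) → contradiction x< x≮ ; (inj₂ (_ , _ , x< , _)) → contradiction x< x≮ })
                       (λ t → ⊥-elim (subst (T ∘ odd) (suff-end x (ℕ.≮⇒≥ x≮)) t))
      by (yes x<) = mk⇔
          (λ { (inj₁ (h , _ , ¬t)) → subst (T ∘ odd) (sym (suff-∷ x x<)) (to step (inj₁ (h , λ o → ¬t (from IH o))))
             ; (inj₂ (¬h , ¬d , _ , t)) → subst (T ∘ odd) (sym (suff-∷ x x<)) (to step (inj₂ (¬h , ¬d , to IH t))) })
          (λ o → case from step (subst (T ∘ odd) (suff-∷ x x<) o) of λ
             { (inj₁ (h , ¬o)) → inj₁ (h , x< , λ t → ¬o (to IH t)) ; (inj₂ (¬h , ¬d , o′)) → inj₂ (¬h , ¬d , x< , from IH o′) })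
        where
        IH : T (τ oddᴿ (index (suc x ∷ []))) ⇔ T (odd (suff (suc x)))
        IH = lower (suc x ∷ []) (x< ∷ []) (closer x<)
        oddStep⇔ : ∀ a b → ((T (isHash a) × ¬ T b) ⊎ (¬ T (isHash a) × ¬ T (isDollar a) × T b)) ⇔ T (oddStep a b)
        oddStep⇔ (letter endNumber) true  = mk⇔ (λ { (inj₁ (_ , ¬t)) → ¬t tt ; (inj₂ (¬h , _)) → ¬h tt }) (λ ())
        oddStep⇔ (letter endNumber) false = mk⇔ (λ _ → tt) (λ _ → inj₁ (tt , λ ()))
        oddStep⇔ (letter endSequence) b   = mk⇔ (λ { (inj₁ (() , _)) ; (inj₂ (_ , ¬d , _)) → ¬d tt }) (λ ())
        oddStep⇔ (letter (bit _)) b       = mk⇔ (λ { (inj₁ (() , _)) ; (inj₂ (_ , _ , t)) → t }) (λ t → inj₂ ((λ ()) , (λ ()) , t))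
        oddStep⇔ blank b                  = mk⇔ (λ { (inj₁ (() , _)) ; (inj₂ (_ , _ , t)) → t }) (λ t → inj₂ ((λ ()) , (λ ()) , t))
        oddStep⇔ start b                  = mk⇔ (λ { (inj₁ (() , _)) ; (inj₂ (_ , _ , t)) → t }) (λ t → inj₂ ((λ ()) , (λ ()) , t))
        oddStep⇔ mark b                   = mk⇔ (λ { (inj₁ (() , _)) ; (inj₂ (_ , _ , t)) → t }) (λ t → inj₂ ((λ ()) , (λ ()) , t))
        step = oddStep⇔ (word x) (odd (suff (suc x)))

    isDigit⇒≡ : ∀ b b′ → T (isDigit b (letter (bit b′))) → b ≡ b′
    isDigit⇒≡ zero       zero       _ = refl
    isDigit⇒≡ (suc zero) (suc zero) _ = refl

    sound-same : Sound sameᴿ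
    sound-same τ (x ∷ y ∷ []) (x≤ ∷ y≤ ∷ []) _ lower = by (digitView x) (digitView y)
      where
      env = assign zeroEnv (X ∷ Y ∷ []) (x ∷ y ∷ [])

      by : DigitView x → DigitView y → ⟦ sameF ⟧ env τ ⇔ (digits (suff x) ≡ digits (suff y))
      by (none _ ¬b d) (none _ ¬b′ d′)     = mk⇔ (λ _ → trans d (sym d′)) (λ _ → inj₁ (¬b , ¬b′))
      by (none nd ¬b d) (some _ eq _ d′)   = mk⇔
        (λ { (inj₁ (_ , ¬b′)) → contradiction (subst (T ∘ isBit) (sym eq) tt) ¬b′
           ; (inj₂ (inj₁ (t , _) , _)) → contradiction t (nd zero) ; (inj₂ (inj₂ (t , _) , _)) → contradiction t (nd (suc zero)) })
        (λ e → case trans (sym d) (trans e d′) of λ ())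
      by (some _ eq _ d) (none nd ¬b d′)   = mk⇔
        (λ { (inj₁ (¬b′ , _)) → contradiction (subst (T ∘ isBit) (sym eq) tt) ¬b′
           ; (inj₂ (inj₁ (_ , t) , _)) → contradiction t (nd zero) ; (inj₂ (inj₂ (_ , t) , _)) → contradiction t (nd (suc zero)) })
        (λ e → case trans (sym d) (trans e d′) of λ ())
      by (some b eq x< d) (some b′ eq′ y< d′) = mk⇔
          (λ { (inj₁ (¬b , _)) → contradiction (subst (T ∘ isBit) (sym eq) tt) ¬b
             ; (inj₂ (inj₁ (t , t′) , _ , _ , r)) → equal zero t t′ r ; (inj₂ (inj₂ (t , t′) , _ , _ , r)) → equal (suc zero) t t′ r })
          (λ e → let b≡b′ , ds = List.∷-injective (trans (sym d) (trans e d′)) in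
                 inj₂ (both b eq (trans eq′ (cong (letter ∘ bit) (sym b≡b′))) , x< , y< , from IH ds))
        where
        IH : T (τ sameᴿ (index (suc x ∷ suc y ∷ []))) ⇔ (digits (suff (suc x)) ≡ digits (suff (suc y)))
        IH = lower (suc x ∷ suc y ∷ []) (x< ∷ y< ∷ []) (closer x<)
        equal : ∀ c → T (isDigit c (word x)) → T (isDigit c (word y)) → T (τ sameᴿ (index (suc x ∷ suc y ∷ []))) → digits (suff x) ≡ digits (suff y)
        equal c t t′ r = trans d (trans (cong₂ _∷_
          (trans (sym (isDigit⇒≡ c b (subst (T ∘ isDigit c) eq t))) (isDigit⇒≡ c b′ (subst (T ∘ isDigit c) eq′ t′))) (to IH r)) (sym d′))
        both : ∀ b → word x ≡ letter (bit b) → word y ≡ letter (bit b) →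
               (T (isDigit zero (word x)) × T (isDigit zero (word y))) ⊎ (T (isDigit (suc zero) (word x)) × T (isDigit (suc zero) (word y)))
        both zero       e e′ = inj₁ (subst (T ∘ isDigit zero) (sym e) tt , subst (T ∘ isDigit zero) (sym e′) tt)
        both (suc zero) e e′ = inj₂ (subst (T ∘ isDigit (suc zero)) (sym e) tt , subst (T ∘ isDigit (suc zero)) (sym e′) tt)

    sound-seg : Sound segᴿ
    sound-seg τ (x ∷ y ∷ []) (x≤ ∷ y≤ ∷ []) below lower = mk⇔ there′ back
      where
      le : ∀ {i j} → i ≤ last → j ≤ last → T (τ leᴿ (index (i ∷ j ∷ []))) ⇔ i ≤ j
      le i≤ j≤ = below leᴿ (s≤s z≤n) _ (i≤ ∷ j≤ ∷ [])
      env = assign zeroEnv (X ∷ Y ∷ []) (x ∷ y ∷ [])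
      IH : x < last → T (τ segᴿ (index (suc x ∷ y ∷ []))) ⇔ Seg (suc x) y
      IH x< = lower (suc x ∷ y ∷ []) (x< ∷ y≤ ∷ []) (closer x<)
      there′ : ⟦ segF ⟧ env τ → Seg x y
      there′ (inj₁ (t , t′))      = subst (Seg x) (ℕ.≤-antisym (to (le x≤ y≤) t) (to (le y≤ x≤) t′)) here
      there′ (inj₂ (nd , x< , t)) = there nd (to (IH x<) t)
      back : Seg x y → ⟦ segF ⟧ env τ
      back here         = inj₁ (from (le x≤ x≤) ℕ.≤-refl , from (le x≤ x≤) ℕ.≤-refl)
      back (there nd s) = inj₂ (nd , x< , from (IH x<) s)
        where
        x< : x < last
        x< = ℕ.≤-trans (Seg⇒≤ s) y≤

    sound-dbl : Sound dblᴿ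
    sound-dbl τ (zero ∷ h ∷ []) _ _ lower = mk⇔ (λ _ → z≤n) (λ _ → inj₁ tt)
    sound-dbl τ (suc m ∷ zero ∷ []) _ _ lower = mk⇔
      (λ { (inj₁ t) → contradiction (start⇒0 {suc m} t) λ () ; (inj₂ (() , _)) }) (λ ())
    sound-dbl τ (suc zero ∷ suc h ∷ []) _ _ lower = mk⇔ (λ _ → s≤s z≤n) (λ _ → inj₂ (s≤s z≤n , s≤s z≤n , inj₁ tt))
    sound-dbl τ (suc (suc m) ∷ suc h ∷ []) (m≤ ∷ h≤ ∷ []) _ lower = mk⇔
      (λ { (inj₁ t) → contradiction (start⇒0 {suc (suc m)} t) λ ()
         ; (inj₂ (_ , _ , inj₁ t)) → contradiction (start⇒0 {suc m} t) λ ()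
         ; (inj₂ (_ , _ , inj₂ (_ , t))) → s≤s (s≤s (to IH t)) })
      (λ { (s≤s (s≤s m≤2h)) → inj₂ (s≤s z≤n , s≤s z≤n , inj₂ (s≤s z≤n , from IH m≤2h)) })
      where
      IH : T (τ dblᴿ (index (m ∷ h ∷ []))) ⇔ m ≤ h * 2
      IH = lower (m ∷ h ∷ []) (ℕ.≤-trans (ℕ.n≤1+n _) (ℕ.<⇒≤ m≤) ∷ ℕ.<⇒≤ h≤ ∷ []) (ℕ.n≤1+n _)

    sound-val : Sound valᴿ
    sound-val τ (m ∷ x ∷ []) (m≤ ∷ x≤ ∷ []) below lower = by (digitView x)
      where
      env = assign zeroEnv (M ∷ X ∷ []) (m ∷ x ∷ [])

      start⇔ : T (isStart (word m)) ⇔ m ≡ 0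
      start⇔ = mk⇔ start⇒0 (λ { refl → tt })

      Half : ℕ → Set
      Half m = ∃[ h ] h ≤ last × T (τ dblᴿ (index (m ∷ h ∷ []))) × x < last × T (τ valᴿ (index (h ∷ suc x ∷ [])))

      half⇔ : ∀ {m} → m ≤ last → x < last → Half m ⇔ m ≤ fromDigits (digits (suff (suc x))) * 2
      half⇔ {m} m≤ x< = mk⇔
          (λ { (h , h≤ , t , _ , t′) → ℕ.≤-trans (to (dbl h≤) t) (ℕ.*-monoˡ-≤ 2 (to (val h≤) t′)) })
          -- The value v need not be a position, but m is one; cutting v off at `last` therefore
          -- keeps m ≤ 2h.
          (λ m≤2v → v ⊓ last , ℕ.m⊓n≤n v last ,
             from (dbl (ℕ.m⊓n≤n v last)) (subst (m ≤_) (sym (ℕ.*-distribʳ-⊓ 2 v last)) (ℕ.⊓-glb m≤2v (ℕ.≤-trans m≤ (ℕ.m≤m*n last 2)))) ,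
             x< , from (val (ℕ.m⊓n≤n v last)) (ℕ.m⊓n≤m v last))
        where
        v = fromDigits (digits (suff (suc x)))
        dbl : ∀ {h} → h ≤ last → T (τ dblᴿ (index (m ∷ h ∷ []))) ⇔ m ≤ h * 2
        dbl h≤ = below dblᴿ ℕ.≤-refl _ (m≤ ∷ h≤ ∷ [])
        val : ∀ {h} → h ≤ last → T (τ valᴿ (index (h ∷ suc x ∷ []))) ⇔ h ≤ v
        val h≤ = lower _ (h≤ ∷ x< ∷ []) (closer x<)

      by : DigitView x → ⟦ valF ⟧ env τ ⇔ m ≤ fromDigits (digits (suff x))
      by (none nd _ d) rewrite d = mk⇔
        (λ { (inj₁ t) → ℕ.≤-reflexive (start⇒0 t) ; (inj₂ (inj₁ (t , _))) → contradiction t (nd zero) ; (inj₂ (inj₂ (t , _))) → contradiction t (nd (suc zero)) })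
        (λ m≤0 → inj₁ (from start⇔ (ℕ.n≤0⇒n≡0 m≤0)))
      by (some zero eq x< d) rewrite d = mk⇔
        (λ { (inj₁ t) → ℕ.≤-trans (ℕ.≤-reflexive (start⇒0 t)) z≤n ; (inj₂ (inj₁ (_ , half))) → to (half⇔ m≤ x<) half
           ; (inj₂ (inj₂ (t , _))) → ⊥-elim (subst (T ∘ isDigit (suc zero)) eq t) })
        (λ m≤2v → inj₂ (inj₁ (subst (T ∘ isDigit zero) (sym eq) tt , from (half⇔ m≤ x<) m≤2v)))
      by (some (suc zero) eq x< d) rewrite d = mk⇔
          (λ { (inj₁ t) → ℕ.≤-trans (ℕ.≤-reflexive (start⇒0 t)) z≤n
             ; (inj₂ (inj₁ (t , _))) → ⊥-elim (subst (T ∘ isDigit zero) eq t)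
             ; (inj₂ (inj₂ (_ , 0<m , half))) → ℕ.≤-trans (ℕ.≤-reflexive (sym (ℕ.suc-pred m {{>-nonZero 0<m}}))) (s≤s (to (half⇔ pred≤ x<) half)) })
          (λ m≤1+2v → back (0 <? m) m≤1+2v)
        where
        pred≤ : pred m ≤ last
        pred≤ = ℕ.≤-trans ℕ.pred[n]≤n m≤
        back : Dec (0 < m) → m ≤ 1 + fromDigits (digits (suff (suc x))) * 2 → ⟦ valF ⟧ env τ
        back (no m≯0)  _      = inj₁ (from start⇔ (ℕ.n≤0⇒n≡0 (ℕ.≮⇒≥ m≯0)))
        back (yes 0<m) m≤1+2v = inj₂ (inj₂ (subst (T ∘ isDigit (suc zero)) (sym eq) tt , 0<m , from (half⇔ pred≤ x<) (ℕ.pred-mono-≤ m≤1+2v)))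

-- Soundness of the count of open pallets and of completability

module Stages (k : ℕ) (w : List InputSymbol) where

  open StackUpFormulas k
  open Meaning w

  orAll⇔ : ∀ n (φ : Fin n → Form) env τ → ⟦ orAll n φ ⟧ env τ ⇔ (∃[ i ] ⟦ φ i ⟧ env τ)
  orAll⇔ zero    φ env τ = mk⇔ (λ ()) (λ ())
  orAll⇔ (suc n) φ env τ = mk⇔
    (λ { (inj₁ p) → zero , p ; (inj₂ q) → let i , p = to (orAll⇔ n (φ ∘ suc) env τ) q in suc i , p })
    (λ { (zero , p) → inj₁ p ; (suc i , p) → inj₂ (from (orAll⇔ n (φ ∘ suc) env τ) (i , p)) })

  andAll⇔ : ∀ n (φ : Fin n → Form) env τ → ⟦ andAll n φ ⟧ env τ ⇔ (∀ i → ⟦ φ i ⟧ env τ)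
  andAll⇔ zero    φ env τ = mk⇔ (λ _ ()) (λ _ → tt)
  andAll⇔ (suc n) φ env τ = mk⇔
    (λ { (p , q) zero → p ; (p , q) (suc i) → to (andAll⇔ n (φ ∘ suc) env τ) q i })
    (λ p → p zero , from (andAll⇔ n (φ ∘ suc) env τ) (p ∘ suc))

  map-cs : ∀ (env : Env) (c : Vec ℕ k) → (∀ i → env (C i) ≡ lookup c i) → Vec.map env cs ≡ c
  map-cs env c eq = trans (sym (Vec.tabulate-∘ env (λ i → C i))) (trans (Vec.tabulate-cong eq) (Vec.tabulate∘lookup c))

  C-injective : ∀ {i j : Fin k} → _≡_ {A = Var} (C i) (C j) → i ≡ j
  C-injective refl = refl

  unique-cs : Unique cs
  unique-cs = Unique.tabulate⁺ C-injective

  assign-cs : ∀ env c i → assign env cs c (C i) ≡ lookup c i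
  assign-cs env c i = trans (cong (assign env cs c) (sym (Vec.lookup∘tabulate (λ i → C i) i)))
    (trans (sym (Vec.lookup-map i (assign env cs c) cs)) (cong (λ v → lookup v i) (map-assign cs c unique-cs)))

  assign-low : ∀ env c {v} → (∀ i → C i ≢ v) → assign env cs c v ≡ env v
  assign-low env c ne = assign-other cs c (All.tabulate⁺ ne)

  bounded-update : ∀ {n a} (c : Vec ℕ n) i → a ≤ last → BoundedVec c → BoundedVec (c [ i ]≔ a)
  bounded-update (_ ∷ c) zero    a≤ (_ ∷ bc)  = a≤ ∷ bc
  bounded-update (_ ∷ c) (suc i) a≤ (b≤ ∷ bc) = b≤ ∷ bounded-update c i a≤ bc

  remaining-update : ∀ {n} (c : Vec ℕ n) i → lookup c i < last → remaining (c [ i ]≔ suc (lookup c i)) < remaining c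
  remaining-update (a ∷ c) zero    a< = ℕ.+-monoˡ-< (remaining c) (closer a<)
  remaining-update (a ∷ c) (suc i) c< = ℕ.+-monoʳ-< (last ∸ a) (remaining-update c i c<)

  Match : ℕ → ℕ → Set
  Match x y = Marker y × x < last × digits (suff (suc x)) ≡ digits (suff (suc y))

  -- With `k` unknown, an environment assigned along `cs` does not compute, so the arguments run
  -- over an abstract `env` that is known only through its values.
  module Counting (τ : Tables) (env : Env) (c : Vec ℕ k) (bd : Bounded env) (bc : BoundedVec c)
                  (env-C : ∀ i → env (C i) ≡ lookup c i) (below : Below cntᴿ τ) where

    x : ℕ
    x = env X

    number : List Bit
    number = digits (suff (suc x))

    markerX⇔ : ⟦ markerF X ⟧ env τ ⇔ Marker x
    markerX⇔ = mk⇔ (λ { (h , x< , t) → h , to (below oddᴿ (s≤s (s≤s z≤n)) _ (x< ∷ [])) t })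
                   (λ { m@(h , o) → h , marker⇒< {x} m , from (below oddᴿ (s≤s (s≤s z≤n)) _ (marker⇒< {x} m ∷ [])) o })

    match⇔ : ∀ {y} → y ≤ last → ⟦ matchF ⟧ (upd env Y y) τ ⇔ Match x y
    match⇔ {y} y≤ = mk⇔
      (λ { ((h , y< , t) , x< , _ , t′) → (h , to (below oddᴿ (s≤s (s≤s z≤n)) _ (y< ∷ [])) t) , x< ,
             to (below sameᴿ (s≤s (s≤s (s≤s z≤n))) _ (x< ∷ y< ∷ [])) t′ })
      (λ { (m@(h , o) , x< , e) → let y< = marker⇒< m in (h , y< , from (below oddᴿ (s≤s (s≤s z≤n)) _ (y< ∷ [])) o) , x< , y< ,
             from (below sameᴿ (s≤s (s≤s (s≤s z≤n))) _ (x< ∷ y< ∷ [])) e })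

    seg⇔ : ∀ {a b} → a ≤ last → b ≤ last → T (τ segᴿ (index (a ∷ b ∷ []))) ⇔ Seg a b
    seg⇔ a≤ b≤ = below segᴿ (s≤s (s≤s (s≤s (s≤s z≤n)))) _ (a≤ ∷ b≤ ∷ [])

    later⇔ : x < last → ⟦ ex Y (next X (call leᴿ (X ∷ Y ∷ [])) ∧ᶠ matchF) ⟧ env τ ⇔ number ∈ pallets (suff (suc x))
    later⇔ x< = mk⇔
        (λ { (y , y≤ , (_ , t) , match) → let m , _ , e = to (match⇔ y≤) match in
               from members (y , to (le y≤) t , m , sym e) })
        (λ number∈ → let y , x<y , m , e = to members number∈
                         y≤ = ℕ.<⇒≤ (marker⇒< m) in
                     y , y≤ , (x< , from (le y≤) x<y) , from (match⇔ y≤) (m , x< , sym e))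
      where
      members = ∈-pallets number (last ∸ suc x) (suc x) (ℕ.m+[n∸m]≡n x<)
      le : ∀ {y} → y ≤ last → T (τ leᴿ (index (suc x ∷ y ∷ []))) ⇔ suc x ≤ y
      le y≤ = below leᴿ (s≤s z≤n) _ (x< ∷ y≤ ∷ [])

    c≤ : ∀ i → lookup c i ≤ last
    c≤ i = All.lookup⁺ bc i

    here⇔ : x < last → ⟦ orAll k hereF ⟧ env τ ⇔ (∃[ i ] number ∈ palletsHere (suff (lookup c i)))
    here⇔ x< = mk⇔
      (λ p → let i , y , y≤ , t , match = to (orAll⇔ k hereF env τ) p
                 m , _ , e = to (match⇔ y≤) match in
             i , ∈-palletsHere⁺ (to (seg⇔ (c≤ i) y≤) (subst (λ a → T (τ segᴿ (index (a ∷ y ∷ [])))) (env-C i) t)) m (sym e))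
      (λ { (i , number∈) → let y , s , m , e = ∈-palletsHere⁻ number (last ∸ lookup c i) (lookup c i) (ℕ.m+[n∸m]≡n (c≤ i)) number∈
                               y≤ = ℕ.<⇒≤ (marker⇒< m) in
             from (orAll⇔ k hereF env τ) (i , y , y≤ , subst (λ a → T (τ segᴿ (index (a ∷ y ∷ [])))) (sym (env-C i)) (from (seg⇔ (c≤ i) y≤) s) ,
               from (match⇔ y≤) (m , x< , sym e)) })

    before⇔ : x < last → ⟦ orAll k beforeF ⟧ env τ ⇔ (∃[ i ] number ∈ palletsBefore (lookup c i))
    before⇔ x< = mk⇔
      (λ p → let i , y , y≤ , match , y< , t = to (orAll⇔ k beforeF env τ) p
                 m , _ , e = to (match⇔ y≤) match in
             i , ∈-palletsBefore⁺ (lookup c i) (to (seg⇔ y< (c≤ i)) (subst (λ a → T (τ segᴿ (index (suc y ∷ a ∷ [])))) (env-C i) t)) m (sym e))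
      (λ { (i , number∈) → let y , s , m , e = ∈-palletsBefore⁻ (lookup c i) number∈
                               y< = marker⇒< m in
             from (orAll⇔ k beforeF env τ) (i , y , ℕ.<⇒≤ y< , from (match⇔ (ℕ.<⇒≤ y<)) (m , x< , sym e) , y< ,
               subst (λ a → T (τ segᴿ (index (suc y ∷ a ∷ [])))) (sym (env-C i)) (from (seg⇔ y< (c≤ i)) s)) })

    counted⇔ : ⟦ countedF ⟧ env τ ⇔ (Marker x × Open c number × number ∉ pallets (suff (suc x)))
    counted⇔ = mk⇔
      (λ { (m , ¬later , h , b) → let m′ = to markerX⇔ m ; x< = marker⇒< m′ in
             m′ , (to (here⇔ x<) h , to (before⇔ x<) b) , λ l → ¬later (from (later⇔ x<) l) })
      (λ { (m , (h , b) , ¬later) → let x< = marker⇒< m in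
             from markerX⇔ m , (λ l → ¬later (to (later⇔ x<) l)) , from (here⇔ x<) h , from (before⇔ x<) b })

    count : ℕ → ℕ
    count i = length (lastOpen c (pallets (suff i)))

    cnt⇔ : (∀ m → m ≤ last → x < last → T (τ cntᴿ (index (suc x ∷ m ∷ c))) ⇔ m ≤ count (suc x)) →
           ⟦ cntF ⟧ env τ ⇔ env M ≤ count x
    cnt⇔ IH = by (view x)
      where
      m = env M
      next-c : Vec.map (upd env X (suc x)) cs ≡ c
      next-c = map-cs (upd env X (suc x)) c env-C
      prev-next-c : Vec.map (upd (upd env M (pred m)) X (suc x)) cs ≡ c
      prev-next-c = map-cs (upd (upd env M (pred m)) X (suc x)) c env-C

      keep : x < last → T (τ cntᴿ (index (suc x ∷ m ∷ Vec.map (upd env X (suc x)) cs))) ⇔ m ≤ count (suc x)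
      keep x< = subst (λ v → T (τ cntᴿ (index (suc x ∷ m ∷ v))) ⇔ m ≤ count (suc x)) (sym next-c) (IH m (bd M) x<)

      drop-one : x < last → T (τ cntᴿ (index (suc x ∷ pred m ∷ Vec.map (upd (upd env M (pred m)) X (suc x)) cs))) ⇔ pred m ≤ count (suc x)
      drop-one x< = subst (λ v → T (τ cntᴿ (index (suc x ∷ pred m ∷ v))) ⇔ pred m ≤ count (suc x)) (sym prev-next-c)
        (IH (pred m) (ℕ.≤-trans ℕ.pred[n]≤n (bd M)) x<)

      uncounted : x < last → count x ≡ count (suc x) → ¬ ⟦ countedF ⟧ env τ → ⟦ cntF ⟧ env τ ⇔ m ≤ count x
      uncounted x< same ¬counted = mk⇔
        (λ { (inj₁ s) → ℕ.≤-trans (ℕ.≤-reflexive (start⇒0 s)) z≤n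
           ; (inj₂ (inj₁ (p , _))) → contradiction p ¬counted
           ; (inj₂ (inj₂ (_ , t))) → subst (m ≤_) (sym same) (to (keep x<) t) })
        (λ m≤ → inj₂ (inj₂ (x< , from (keep x<) (subst (m ≤_) same m≤))))

      by : View x → ⟦ cntF ⟧ env τ ⇔ m ≤ count x
      by (end last≤x s) = mk⇔
        (λ { (inj₁ s) → ℕ.≤-trans (ℕ.≤-reflexive (start⇒0 s)) z≤n
           ; (inj₂ (inj₁ (_ , _ , x< , _))) → contradiction x< (ℕ.≤⇒≯ last≤x)
           ; (inj₂ (inj₂ (x< , _))) → contradiction x< (ℕ.≤⇒≯ last≤x) })
        (λ m≤ → inj₁ (subst (T ∘ isStart ∘ word) (sym (ℕ.n≤0⇒n≡0 (subst (λ v → m ≤ length (lastOpen c (pallets v))) s m≤))) tt))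
      by (dollar x< ¬m _ p _ _) = uncounted x< (cong (length ∘ lastOpen c) p) (¬m ∘ proj₁ ∘ to counted⇔)
      by (other x< ¬m _ p _ _)  = uncounted x< (cong (length ∘ lastOpen c) p) (¬m ∘ proj₁ ∘ to counted⇔)
      by (marker x< mk _ p _ _) = decide-on (open? c number ×-dec ¬? (number ∈? pallets (suff (suc x)))) refl
        where
        ts = pallets (suff (suc x))
        D  = open? c number ×-dec ¬? (number ∈? ts)

        decide-on : (d : Dec (Open c number × number ∉ ts)) → D ≡ d → ⟦ cntF ⟧ env τ ⇔ m ≤ count x
        decide-on (no ¬d) _ = uncounted x< (cong length (trans (cong (lastOpen c) p) (if-no D ¬d))) (¬d ∘ proj₂ ∘ to counted⇔)
        decide-on (yes d) _ = subst (λ n → ⟦ cntF ⟧ env τ ⇔ m ≤ n) (sym (cong length (trans (cong (lastOpen c) p) (if-yes D d)))) (mk⇔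
            (λ { (inj₁ s) → ℕ.≤-trans (ℕ.≤-reflexive (start⇒0 s)) z≤n
               ; (inj₂ (inj₁ (_ , 0<m , _ , t))) → ℕ.≤-trans (ℕ.≤-reflexive (sym (ℕ.suc-pred m {{>-nonZero 0<m}}))) (s≤s (to (drop-one x<) t))
               ; (inj₂ (inj₂ (_ , t))) → ℕ.m≤n⇒m≤1+n (to (keep x<) t) })
            (λ m≤ → back (0 <? m) m≤))
          where
          back : Dec (0 < m) → m ≤ suc (count (suc x)) → ⟦ cntF ⟧ env τ
          back (no m≯0)  _  = inj₁ (subst (T ∘ isStart ∘ word) (sym (ℕ.n≤0⇒n≡0 (ℕ.≮⇒≥ m≯0))) tt)
          back (yes 0<m) m≤ = inj₂ (inj₁ (from counted⇔ (mk , d) , 0<m , x< , from (drop-one x<) (ℕ.pred-mono-≤ m≤)))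

  sound-cnt : Sound cntᴿ
  sound-cnt τ (x ∷ m ∷ c) bv@(x≤ ∷ m≤ ∷ bc) below lower =
    subst₂ (λ x m → ⟦ cntF ⟧ env τ ⇔ m ≤ length (lastOpen c (pallets (suff x)))) env-X env-M (cnt⇔ IH)
    where
    env₀ = upd (upd zeroEnv X x) M m
    env  = assign env₀ cs c
    env-X : env X ≡ x
    env-X = assign-low env₀ c λ _ ()
    env-M : env M ≡ m
    env-M = assign-low env₀ c λ _ ()
    open Counting τ env c (bounded-assign (X ∷ M ∷ cs) (λ _ → z≤n) bv) bc (assign-cs env₀ c) below using (cnt⇔)
    IH : ∀ m → m ≤ last → env X < last → T (τ cntᴿ (index (suc (env X) ∷ m ∷ c))) ⇔ m ≤ length (lastOpen c (pallets (suff (suc (env X)))))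
    IH m m≤ x< = lower (suc (env X) ∷ m ∷ c) (x< ∷ m≤ ∷ bc) (subst (λ i → last ∸ suc (env X) < last ∸ i) env-X (closer x<))

  length-lastOpen : ∀ c ts → length (lastOpen c ts) ≤ length ts
  length-lastOpen c [] = z≤n
  length-lastOpen c (t ∷ ts) with does (open? c t ×-dec ¬? (t ∈? ts))
  ... | true  = s≤s (length-lastOpen c ts)
  ... | false = ℕ.m≤n⇒m≤1+n (length-lastOpen c ts)

  length-pallets : ∀ v → length (pallets v) ≤ length v
  length-pallets [] = z≤n
  length-pallets (blank ∷ v)                = ℕ.m≤n⇒m≤1+n (length-pallets v)
  length-pallets (start ∷ v)                = ℕ.m≤n⇒m≤1+n (length-pallets v)
  length-pallets (mark ∷ v)                 = ℕ.m≤n⇒m≤1+n (length-pallets v)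
  length-pallets (letter (bit _) ∷ v)       = ℕ.m≤n⇒m≤1+n (length-pallets v)
  length-pallets (letter endSequence ∷ v)   = ℕ.m≤n⇒m≤1+n (length-pallets v)
  length-pallets (letter endNumber ∷ v) with odd v
  ... | true  = s≤s (length-pallets v)
  ... | false = ℕ.m≤n⇒m≤1+n (length-pallets v)

  sound-good : Sound goodᴿ
  sound-good τ c bc below lower = mk⇔
      (λ { (f , inj₁ p) → finished (to fits⇔ f) (λ i → subst (T ∘ isDollar ∘ word) (env-C i) (to (andAll⇔ k (λ i → is (C i) isDollar) env τ) p i))
         ; (f , inj₂ p) → let i , nd , c< , t = to (orAll⇔ k advanceF env τ) p in
             advanced (to fits⇔ f) i (nd ∘ subst (T ∘ isDollar ∘ word) (sym (env-C i))) (subst (_< last) (env-C i) c<)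
               (to (IH i (subst (_< last) (env-C i) c<)) (subst (λ v → T (τ goodᴿ (index v))) (moved i) t)) })
      (λ { (finished f p)        → from fits⇔ f , inj₁ (from (andAll⇔ k (λ i → is (C i) isDollar) env τ) λ i → subst (T ∘ isDollar ∘ word) (sym (env-C i)) (p i))
         ; (advanced f i nd c< g) → from fits⇔ f , inj₂ (from (orAll⇔ k advanceF env τ) (i , nd ∘ subst (T ∘ isDollar ∘ word) (env-C i) ,
             subst (_< last) (sym (env-C i)) c< , subst (λ v → T (τ goodᴿ (index v))) (sym (moved i)) (from (IH i c<) g))) })
    where
    env = assign zeroEnv cs c

    env-C : ∀ i → env (C i) ≡ lookup c i
    env-C = assign-cs zeroEnv c

    env-X : env X ≡ 0
    env-X = assign-low zeroEnv c λ _ ()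

    n = length (lastOpen c (pallets text))
    p = fromDigits (digits (suff 1))

    -- The text yields at most one pallet per symbol, so the count is itself a position and can
    -- serve as a value of `M`.
    n≤last : n ≤ last
    n≤last = ℕ.≤-trans (length-lastOpen c (pallets text)) (ℕ.≤-trans (length-pallets text) (s≤s (ℕ.≤-reflexive (List.length-map letter w))))

    cnt : ∀ {m} → m ≤ last → T (τ cntᴿ (index (env X ∷ m ∷ Vec.map (upd env M m) cs))) ⇔ m ≤ n
    cnt {m} m≤ = subst₂ (λ x v → T (τ cntᴿ (index (x ∷ m ∷ v))) ⇔ m ≤ n) (sym env-X) (sym (map-cs (upd env M m) c env-C))
      (below cntᴿ ℕ.≤-refl (0 ∷ m ∷ c) (z≤n ∷ m≤ ∷ bc))

    val : ∀ {m} → m ≤ last → T (τ valᴿ (index (m ∷ suc (env X) ∷ []))) ⇔ m ≤ p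
    val {m} m≤ = subst (λ x → T (τ valᴿ (index (m ∷ suc x ∷ []))) ⇔ m ≤ p) (sym env-X)
      (below valᴿ (ℕ.n≤1+n _) (m ∷ 1 ∷ []) (m≤ ∷ s≤s z≤n ∷ []))

    X<last : env X < last
    X<last = subst (_< last) (sym env-X) (s≤s z≤n)

    fits⇔ : ⟦ ~ᶠ ex M (call cntᴿ (X ∷ M ∷ cs) ∧ᶠ (~ᶠ next X (call valᴿ (M ∷ X ∷ [])))) ⟧ env τ ⇔ n ≤ p
    fits⇔ = mk⇔
      (λ none → case n ≤? p of λ where
        (yes n≤p) → n≤p
        -- The count itself is the position that lies below the count but not below p.
        (no n≰p)  → contradiction (n , n≤last , from (cnt n≤last) ℕ.≤-refl , λ { (_ , t) → n≰p (to (val n≤last) t) }) none)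
      (λ { n≤p (m , m≤ , t , ¬t) → ¬t (X<last , from (val m≤) (ℕ.≤-trans (to (cnt m≤) t) n≤p)) })

    moved : ∀ i → Vec.map (upd env (C i) (suc (env (C i)))) cs ≡ c [ i ]≔ suc (lookup c i)
    moved i = map-cs (upd env (C i) (suc (env (C i)))) (c [ i ]≔ suc (lookup c i)) λ j → case i Fin.≟ j of λ where
      (yes refl) → trans (upd-same env (C i)) (trans (cong suc (env-C i)) (sym (Vec.lookup∘update i c (suc (lookup c i)))))
      (no i≢j)   → trans (if-no (i Fin.≟ j) i≢j) (trans (env-C j) (sym (Vec.lookup∘update′ (i≢j ∘ sym) c (suc (lookup c i)))))

    IH : ∀ i → lookup c i < last → T (τ goodᴿ (index (c [ i ]≔ suc (lookup c i)))) ⇔ Good (c [ i ]≔ suc (lookup c i))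
    IH i c< = lower _ (bounded-update c i c< bc) (remaining-update c i c<)

  sound : ∀ r → Sound r
  sound leᴿ   = sound-le
  sound oddᴿ  = sound-odd
  sound sameᴿ = sound-same
  sound segᴿ  = sound-seg
  sound dblᴿ  = sound-dbl
  sound valᴿ  = sound-val
  sound cntᴿ  = sound-cnt
  sound goodᴿ = sound-good

-- Locating the sequences, and the decision by the program

module Deciding (k : ℕ) (w : List InputSymbol) where

  open StackUpFormulas k
  open Meaning w
  open Stages k w

  Chain : ∀ {n} → ℕ → Vec ℕ n → Set
  Chain a []      = ⊤
  Chain a (b ∷ c) = 0 < b × Seg a (pred b) × T (isDollar (word (pred b))) × Chain b c

  Starts : ∀ {n} → Vec ℕ n → Set
  Starts []      = ⊤
  Starts (a ∷ c) = a ≡ 0 × Chain a c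

  chain⇔ : ∀ {n τ} → Correct segᴿ τ → ∀ v (us : Vec Var n) φ env → Bounded env → Unique (v ∷ us) →
           ⟦ chainF v us φ ⟧ env τ ⇔ (∃[ c ] BoundedVec c × Chain (env v) c × ⟦ φ ⟧ (assign env us c) τ)
  chain⇔ seg v [] φ env bd _ = mk⇔ (λ p → [] , [] , tt , p) (λ { ([] , _ , _ , p) → p })
  chain⇔ {suc n} {τ} seg v (u ∷ us) φ env bd ((v≢u ∷ v≢us) ∷ uniq) = mk⇔
      (λ { (b , b≤ , (0<b , t , d) , rest) →
        let c , bc , ch , p = to (IH b b≤) rest
            s = to (seg⇔ b≤) (subst (λ e → T (τ segᴿ (index e))) (values b) t)
        in b ∷ c , b≤ ∷ bc ,
           (subst (0 <_) (b≡ b) 0<b , s , subst (T ∘ isDollar ∘ word) (at-u b) d , subst (λ a → Chain a c) (b≡ b) ch) , p })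
      (λ { (b ∷ c , b≤ ∷ bc , (0<b , s , d , ch) , p) →
        b , b≤ , (subst (0 <_) (sym (b≡ b)) 0<b ,
          subst (λ e → T (τ segᴿ (index e))) (sym (values b)) (from (seg⇔ b≤) s) , subst (T ∘ isDollar ∘ word) (sym (at-u b)) d) ,
        from (IH b b≤) (c , bc , subst (λ a → Chain a c) (sym (b≡ b)) ch , p) })
    where
    env′ : ℕ → Env
    env′ b = upd (upd env u b) u (pred (upd env u b u))
    b≡ : ∀ b → upd env u b u ≡ b
    b≡ b = upd-same env u
    at-u : ∀ b → env′ b u ≡ pred b
    at-u b = trans (upd-same (upd env u b) u) (cong pred (b≡ b))
    at-v : ∀ b → env′ b v ≡ env v
    at-v b = trans (if-no (u Fin.≟ v) (v≢u ∘ sym)) (if-no (u Fin.≟ v) (v≢u ∘ sym))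
    values : ∀ b → Vec.map (env′ b) (v ∷ u ∷ []) ≡ env v ∷ pred b ∷ []
    values b = cong₂ (λ x y → x ∷ y ∷ []) (at-v b) (at-u b)
    seg⇔ : ∀ {b} → b ≤ last → T (τ segᴿ (index (env v ∷ pred b ∷ []))) ⇔ Seg (env v) (pred b)
    seg⇔ b≤ = seg _ (bd v ∷ ℕ.≤-trans ℕ.pred[n]≤n b≤ ∷ [])
    IH : ∀ b → b ≤ last → _
    IH b b≤ = chain⇔ seg u us φ (upd env u b) (bounded-upd {x = u} bd b≤) uniq

  startEnv : ∀ {n} → Vec Var n → Vec ℕ n → Env
  startEnv []       []      = zeroEnv
  startEnv (v ∷ vs) (a ∷ c) = assign zeroEnv vs c

  map-startEnv : ∀ {n} (vs : Vec Var n) c → Unique vs → Starts c → Vec.map (startEnv vs c) vs ≡ c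
  map-startEnv []       []      _          _          = refl
  map-startEnv (v ∷ vs) (a ∷ c) (n ∷ u) (refl , _) =
    cong₂ _∷_ (assign-other vs c (All.map (λ v≢u u≡v → v≢u (sym u≡v)) n)) (map-assign vs c u)

  start⇔ : ∀ {n τ} → Correct segᴿ τ → ∀ (vs : Vec Var n) φ → Unique vs →
           ⟦ startF vs φ ⟧ zeroEnv τ ⇔ (∃[ c ] BoundedVec c × Starts c × ⟦ φ ⟧ (startEnv vs c) τ)
  start⇔ seg [] φ _ = mk⇔ (λ p → [] , [] , tt , p) (λ { ([] , _ , _ , p) → p })
  start⇔ seg (v ∷ vs) φ u = mk⇔
    (λ p → let c , bc , ch , q = to (chain⇔ seg v vs φ zeroEnv (λ _ → z≤n) u) p in 0 ∷ c , z≤n ∷ bc , (refl , ch) , q)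
    (λ { (a ∷ c , _ ∷ bc , (refl , ch) , q) → from (chain⇔ seg v vs φ zeroEnv (λ _ → z≤n) u) (c , bc , ch , q) })

  decision⇔ : ∀ τ → (∀ r → Correct r τ) → ⟦ startF cs (call goodᴿ cs) ⟧ zeroEnv τ ⇔ (∃[ c ] BoundedVec c × Starts c × Good c)
  decision⇔ τ ok = mk⇔
    (λ p → let c , bc , st , t = to (start⇔ (ok segᴿ) cs (call goodᴿ cs) unique-cs) p in
       c , bc , st , to (ok goodᴿ c bc) (subst (λ v → T (τ goodᴿ (index v))) (map-startEnv cs c unique-cs st) t))
    (λ { (c , bc , st , g) → from (start⇔ (ok segᴿ) cs (call goodᴿ cs) unique-cs)
       (c , bc , st , subst (λ v → T (τ goodᴿ (index v))) (sym (map-startEnv cs c unique-cs st)) (from (ok goodᴿ c bc) g)) })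

  clean-orAll : ∀ n (φ : Fin n → Form) env → (∀ i → Clean (φ i) env) → Clean (orAll n φ) env
  clean-orAll zero    φ env cl = tt
  clean-orAll (suc n) φ env cl = cl zero , clean-orAll n (φ ∘ suc) env (cl ∘ suc)

  clean-andAll : ∀ n (φ : Fin n → Form) env → (∀ i → Clean (φ i) env) → Clean (andAll n φ) env
  clean-andAll zero    φ env cl = tt
  clean-andAll (suc n) φ env cl = cl zero , clean-andAll n (φ ∘ suc) env (cl ∘ suc)

  clean-counted : ∀ env → env Y ≡ 0 → Clean countedF env
  clean-counted env y≡0 = (tt , tt) , (y≡0 , λ _ → tt , (tt , tt) , tt) ,
    clean-orAll k hereF env (λ i → y≡0 , λ _ → tt , (tt , tt) , tt) ,
    clean-orAll k beforeF env (λ i → y≡0 , λ _ → ((tt , tt) , tt) , tt)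

  -- The starting positions are held by distinct variables, so each is still at 0 when its
  -- quantifier is reached.
  clean-chain : ∀ {n} v (us : Vec Var n) φ env → All (λ u → env u ≡ 0) us → Unique us → (∀ env → Clean φ env) → Clean (chainF v us φ) env
  clean-chain v []       φ env zs        u        cl = cl env
  clean-chain v (u ∷ us) φ env (z ∷ zs) (n ∷ ns) cl = z , λ i → (tt , tt) , clean-chain u us φ (upd env u i) (still i us n zs) ns cl
    where
    still : ∀ i {n} (us : Vec Var n) → All (u ≢_) us → All (λ u → env u ≡ 0) us → All (λ x → upd env u i x ≡ 0) us
    still i []       []        []        = []
    still i (x ∷ us) (u≢x ∷ n) (z ∷ zs) = trans (if-no (u Fin.≟ x) u≢x) z ∷ still i us n zs

  clean-start : ∀ {n} (vs : Vec Var n) φ → Unique vs → (∀ env → Clean φ env) → Clean (startF vs φ) zeroEnv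
  clean-start []       φ u       cl = cl zeroEnv
  clean-start (v ∷ vs) φ (_ ∷ u) cl = clean-chain v vs φ zeroEnv (zeros vs) u cl
    where
    zeros : ∀ {n} (vs : Vec Var n) → All (λ u → zeroEnv u ≡ 0) vs
    zeros []       = []
    zeros (v ∷ vs) = refl ∷ zeros vs

  unique-params : ∀ r → Unique (params r)
  unique-params leᴿ   = ((λ ()) ∷ []) ∷ [] ∷ []
  unique-params oddᴿ  = [] ∷ []
  unique-params sameᴿ = ((λ ()) ∷ []) ∷ [] ∷ []
  unique-params segᴿ  = ((λ ()) ∷ []) ∷ [] ∷ []
  unique-params dblᴿ  = ((λ ()) ∷ []) ∷ [] ∷ []
  unique-params valᴿ  = ((λ ()) ∷ []) ∷ [] ∷ []
  unique-params cntᴿ  = ((λ ()) ∷ All.tabulate⁺ {P = X ≢_} λ _ ()) ∷ All.tabulate⁺ {P = M ≢_} (λ _ ()) ∷ unique-cs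
  unique-params goodᴿ = unique-cs

  clean-formula : ∀ r v → Clean (formula r) (assign zeroEnv (params r) v)
  clean-formula leᴿ   v = tt , tt
  clean-formula oddᴿ  v = (tt , tt) , tt , tt , tt
  clean-formula sameᴿ v = (tt , tt) , ((tt , tt) , tt , tt) , tt
  clean-formula segᴿ  v = (tt , tt) , tt , tt
  clean-formula dblᴿ  v = tt , tt , tt
  clean-formula valᴿ  (m ∷ x ∷ []) = tt , (tt , refl , λ _ → tt , tt) , tt , refl , λ _ → tt , tt
  clean-formula cntᴿ  (x ∷ m ∷ c) = tt , (clean-counted (assign zeroEnv (params cntᴿ) (x ∷ m ∷ c)) (assign-low (upd (upd zeroEnv X x) M m) c λ _ ()) , tt) , tt
  clean-formula goodᴿ c = (assign-low zeroEnv c (λ _ ()) , λ _ → tt , tt) ,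
    clean-andAll k (λ i → is (C i) isDollar) (assign zeroEnv cs c) (λ _ → tt) , clean-orAll k advanceF (assign zeroEnv cs c) (λ _ → tt , tt)

  decides : ∃[ b ] ∃[ s ] Spec (decide (family params formula) (startF cs (call goodᴿ cs))) empty
                            (⟦ decideCost (family params formula) (startF cs (call goodᴿ cs)) ⟧ₚ B) b s ×
                          (T b ⇔ (∃[ c ] BoundedVec c × Starts c × Good c))
  decides = conclude (family-decides sound unique-params (λ r v _ → clean-formula r v) φ (clean-start cs (call goodᴿ cs) unique-cs (λ _ → tt)))
    where
    φ = startF cs (call goodᴿ cs)
    conclude : (∃[ τ ] (∀ r → Correct r τ) × ∃[ s ] Spec (decide (family params formula) φ) empty
                 (⟦ decideCost (family params formula) φ ⟧ₚ B) (does (dec φ zeroEnv τ)) s) → _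
    conclude (τ , ok , s , spec) = does (dec φ zeroEnv τ) , s , spec , mk⇔
      (λ t → to (decision⇔ τ ok) (does-true (dec φ zeroEnv τ) (to T-≡ t)))
      (λ p → from T-≡ (dec-true (dec φ zeroEnv τ) (from (decision⇔ τ ok) p)))

-- The lists of pallets read off an encoding

bits : ℕ → List Bit
bits n = proj₁ (toDigits 2 n)

-- `fromDigits` inverts `toDigits`; this is what permits identifying a pallet symbol with its string
-- of digits.
bits-injective : ∀ {m n} → bits m ≡ bits n → m ≡ n
bits-injective {m} {n} eq = trans (sym (proj₂ (toDigits 2 m))) (trans (cong fromDigits eq) (proj₂ (toDigits 2 n)))

pallet : Bin → List Bit
pallet b = bits (plt b)

module _ (v : List InputSymbol) where

  odd-number : ∀ n → odd (map letter (encodeNumber n ++ v)) ≡ not (odd (map letter v))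
  odd-number n = go (bits n)
    where
    go : ∀ ds → odd (map letter ((map bit ds ++ [ endNumber ]) ++ v)) ≡ not (odd (map letter v))
    go []       = refl
    go (_ ∷ ds) = go ds

  digits-number : ∀ n → digits (map letter (encodeNumber n ++ v)) ≡ bits n
  digits-number n = go (bits n)
    where
    go : ∀ ds → digits (map letter ((map bit ds ++ [ endNumber ]) ++ v)) ≡ ds
    go []       = refl
    go (d ∷ ds) = cong (d ∷_) (go ds)

  pallets-number : ∀ n → pallets (map letter (encodeNumber n ++ v)) ≡
                   (if odd (map letter v) then digits (map letter v) ∷ pallets (map letter v) else pallets (map letter v))
  pallets-number n = go (bits n)
    where
    go : ∀ ds → pallets (map letter ((map bit ds ++ [ endNumber ]) ++ v)) ≡ _
    go []       = refl
    go (_ ∷ ds) = go ds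

  palletsHere-number : ∀ n → palletsHere (map letter (encodeNumber n ++ v)) ≡
                       (if odd (map letter v) then digits (map letter v) ∷ palletsHere (map letter v) else palletsHere (map letter v))
  palletsHere-number n = go (bits n)
    where
    go : ∀ ds → palletsHere (map letter ((map bit ds ++ [ endNumber ]) ++ v)) ≡ _
    go []       = refl
    go (_ ∷ ds) = go ds

encodeSequence-∷ : ∀ b q v → encodeSequence (b ∷ q) ++ v ≡ encodeNumber (name b) ++ (encodeNumber (plt b) ++ (encodeSequence q ++ v))
encodeSequence-∷ b q v = trans
  (cong (_++ v) (trans (List.++-assoc (encodeBin b) (concatMap encodeBin q) [ endSequence ])
                       (List.++-assoc (encodeNumber (name b)) (encodeNumber (plt b)) (encodeSequence q))))
  (trans (List.++-assoc (encodeNumber (name b)) (encodeNumber (plt b) ++ encodeSequence q) v)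
    (cong (encodeNumber (name b) ++_) (List.++-assoc (encodeNumber (plt b)) (encodeSequence q) v)))

-- Each bin contributes two ends of numbers, so the parity is even at every boundary between bins
-- and odd only between a name and its pallet symbol.
odd-sequence : ∀ q v → odd (map letter (encodeSequence q ++ v)) ≡ false
odd-sequence []      v = refl
odd-sequence (b ∷ q) v rewrite encodeSequence-∷ b q v
  | odd-number (encodeNumber (plt b) ++ (encodeSequence q ++ v)) (name b)
  | odd-number (encodeSequence q ++ v) (plt b) | odd-sequence q v = refl

palletsHere-sequence : ∀ q v → palletsHere (map letter (encodeSequence q ++ v)) ≡ map pallet q
palletsHere-sequence []      v = refl
palletsHere-sequence (b ∷ q) v rewrite encodeSequence-∷ b q v
  | palletsHere-number (encodeNumber (plt b) ++ (encodeSequence q ++ v)) (name b)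
  | odd-number (encodeSequence q ++ v) (plt b) | odd-sequence q v
  | digits-number (encodeSequence q ++ v) (plt b)
  | palletsHere-number (encodeSequence q ++ v) (plt b) | odd-sequence q v = cong (pallet b ∷_) (palletsHere-sequence q v)

pallets-sequence : ∀ q v → pallets (map letter (encodeSequence q ++ v)) ≡ map pallet q ++ pallets (map letter v)
pallets-sequence []      v = refl
pallets-sequence (b ∷ q) v rewrite encodeSequence-∷ b q v
  | pallets-number (encodeNumber (plt b) ++ (encodeSequence q ++ v)) (name b)
  | odd-number (encodeSequence q ++ v) (plt b) | odd-sequence q v
  | digits-number (encodeSequence q ++ v) (plt b)
  | pallets-number (encodeSequence q ++ v) (plt b) | odd-sequence q v = cong (pallet b ∷_) (pallets-sequence q v)

odd-sequences : ∀ qs → odd (map letter (concatMap encodeSequence qs)) ≡ false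
odd-sequences []       = refl
odd-sequences (q ∷ qs) = odd-sequence q (concatMap encodeSequence qs)

pallets-sequences : ∀ qs → pallets (map letter (concatMap encodeSequence qs)) ≡ map pallet (concat qs)
pallets-sequences []       = refl
pallets-sequences (q ∷ qs) = trans (pallets-sequence q (concatMap encodeSequence qs))
  (trans (cong (map pallet q ++_) (pallets-sequences qs)) (sym (List.map-++ pallet q (concat qs))))

Plain : InputSymbol → Set
Plain a = ¬ T (isDollar (letter a))

plain-number : ∀ n → ListAll.All Plain (encodeNumber n)
plain-number n = ListAll.++⁺ (ListAll.map⁺ (ListAll.universal (λ _ ()) (bits n))) ((λ ()) ListAll.∷ ListAll.[])

plain-bins : ∀ q → ListAll.All Plain (concatMap encodeBin q)
plain-bins []      = ListAll.[]
plain-bins (b ∷ q) = ListAll.++⁺ (ListAll.++⁺ (plain-number (name b)) (plain-number (plt b))) (plain-bins q)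

unique-length : ∀ {A : Set} {xs ys : List A} → ListUnique.Unique xs → (∀ {x} → x ∈ xs → x ∈ ys) → length xs ≤ length ys
unique-length {xs = []}     _              sub = z≤n
unique-length {xs = x ∷ xs} {ys} (x∉xs ListAllPairs.∷ u) sub with ∈-∃++ (sub (here refl))
... | as , bs , refl = ℕ.≤-trans (s≤s (unique-length u others))
    (ℕ.≤-reflexive (sym (trans (List.length-++ as) (trans (ℕ.+-suc (length as) (length bs)) (cong suc (sym (List.length-++ as)))))))
  where
  others : ∀ {y} → y ∈ xs → y ∈ as ++ bs
  others y∈ with ∈-++⁻ as (sub (there y∈))
  ... | inj₁ y∈as         = ∈-++⁺ˡ y∈as
  ... | inj₂ (here refl)  = contradiction refl (ListAll.lookup x∉xs y∈)
  ... | inj₂ (there y∈bs) = ∈-++⁺ʳ as y∈bs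

∖-++ : ∀ {s q} → Suffix _≡_ s q → q ≡ (q ∖ s) ++ s
∖-++ {s} {q} suf with Suffix.toView suf
... | pre Suffix.++ pw with Pointwise.Pointwise-≡⇒≡ pw
...   | refl = cong (_++ s) (sym (trans (cong (λ n → take n (pre ++ s))
                 (trans (cong (_∸ length s) (List.length-++ pre)) (ℕ.m+n∸n≡m (length pre) (length s)))) (take-length pre)))
  where
  take-length : ∀ pre → take (length pre) (pre ++ s) ≡ pre
  take-length []        = refl
  take-length (x ∷ pre) = cong (x ∷_) (take-length pre)

-- Pointer positions that represent a configuration

module Bridge (k : ℕ) (I : StackUpInstance k) (w : List InputSymbol) (w≡ : w ≡ encodeInstance I) where

  open StackUpInstance I

  Q : Sequences k
  Q = sequences

  open StackUpFormulas k
  open Meaning w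
  open Stages k w
  open Deciding k w using (Chain; Starts)
  open Configuration renaming (remaining to rest)

  -- Keeps a pointer inside the text: a symbol that is not the end of the sequence can always be
  -- passed.
  Ahead : ℕ → Set
  Ahead a = ∃[ y ] Seg a y × T (isDollar (word y))

  ahead⇒< : ∀ {a} → Ahead a → a < last
  ahead⇒< (y , s , d) = ℕ.≤-<-trans (Seg⇒≤ s) (symbol⇒< isDollar refl d)

  -- Compares the remaining and the removed bins through their pallets only, which is all that
  -- openness depends on.
  Stands : ℕ → List Bin → List Bin → Set
  Stands a q r = palletsHere (suff a) ≡ map pallet q × palletsBefore a ≡ map pallet r × Ahead a

  -- Holds at the first symbol of a sequence. It also records which text follows its end, so that
  -- the start of the next sequence can be identified.
  AtSequence : ℕ → List Bin → List InputSymbol → Set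
  AtSequence a q v = palletsHere (suff a) ≡ map pallet q × palletsBefore a ≡ [] ×
                     (∃[ y ] Seg a y × T (isDollar (word y)) × suff (suc y) ≡ map letter v)

  uncons : ∀ {a x r} → suff a ≡ x ∷ r → a < last × word a ≡ x × suff (suc a) ≡ r
  uncons {a} eq with a <? last
  ... | no a≮  = case trans (sym eq) (suff-end a (ℕ.≮⇒≥ a≮)) of λ ()
  ... | yes a< = let x≡ , r≡ = List.∷-injective (trans (sym (suff-∷ a a<)) eq) in a< , x≡ , r≡

  find-end : ∀ us {a v} → ListAll.All Plain us → suff a ≡ map letter (us ++ endSequence ∷ v) →
             ∃[ y ] Seg a y × T (isDollar (word y)) × suff (suc y) ≡ map letter v
  find-end []       {a} _ eq = let _ , d , r = uncons {a} eq in a , here , subst (T ∘ isDollar) (sym d) tt , r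
  find-end (u ∷ us) {a} (p ListAll.∷ ps) eq =
    let _ , d , r = uncons {a} eq
        y , s , rest = find-end us {suc a} ps r
    in y , there (p ∘ subst (T ∘ isDollar) d) s , rest

  at-sequence : ∀ {a} q v → suff a ≡ map letter (encodeSequence q ++ v) → palletsBefore a ≡ [] → AtSequence a q v
  at-sequence {a} q v eq before = trans (cong palletsHere eq) (palletsHere-sequence q v) , before ,
    find-end (concatMap encodeBin q) {a} (plain-bins q) (trans eq (cong (map letter) (List.++-assoc (concatMap encodeBin q) [ endSequence ] v)))

  at-start : ∀ q v → w ≡ encodeNumber places ++ (encodeSequence q ++ v) → AtSequence 0 q v
  at-start q v eq = here-pallets , refl , after-start (find-end (encodeNumber places ++ concatMap encodeBin q) {1}
      (ListAll.++⁺ (plain-number places) (plain-bins q))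
      (cong (map letter) (trans eq (trans (cong (encodeNumber places ++_) (List.++-assoc (concatMap encodeBin q) [ endSequence ] v))
        (sym (List.++-assoc (encodeNumber places) (concatMap encodeBin q) (endSequence ∷ v)))))))
    where
    here-pallets : palletsHere text ≡ map pallet q
    here-pallets = trans (cong (palletsHere ∘ map letter) eq) (trans (palletsHere-number (encodeSequence q ++ v) places)
      (trans (cong (if_then digits (map letter (encodeSequence q ++ v)) ∷ palletsHere (map letter (encodeSequence q ++ v))
                     else palletsHere (map letter (encodeSequence q ++ v))) (odd-sequence q v))
        (palletsHere-sequence q v)))

    after-start : (∃[ y ] Seg 1 y × T (isDollar (word y)) × suff (suc y) ≡ map letter v) → ∃[ y ] Seg 0 y × T (isDollar (word y)) × suff (suc y) ≡ map letter v
    after-start (y , s , rest) = y , there (λ ()) s , rest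

  stands : ∀ {a q v} → AtSequence a q v → Stands a q []
  stands (h , b , y , s , d , _) = h , b , y , s , d

  end-unique : ∀ {a y y′} → Seg a y → T (isDollar (word y)) → Seg a y′ → T (isDollar (word y′)) → y ≡ y′
  end-unique here        d here         d′ = refl
  end-unique here        d (there nd _) d′ = contradiction d nd
  end-unique (there nd _) d here        d′ = contradiction d′ nd
  end-unique (there _ s) d (there _ s′) d′ = end-unique s d s′ d′

  before-end : ∀ y → T (isDollar (word y)) → palletsBefore (suc y) ≡ []
  before-end y d with view y
  ... | end last≤y _         = contradiction (symbol⇒< isDollar refl d) (ℕ.≤⇒≯ last≤y)
  ... | marker _ _ nd _ _ _  = contradiction d nd
  ... | other _ _ nd _ _ _   = contradiction d nd
  ... | dollar _ _ _ _ _ p   = p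

  next-sequence : ∀ {a q n} {q′} {qs : Vec (List Bin) n} → AtSequence a q (concatMap encodeSequence (toList (q′ ∷ qs))) →
                  ∀ {b} → 0 < b → Seg a (pred b) → T (isDollar (word (pred b))) → AtSequence b q′ (concatMap encodeSequence (toList qs))
  next-sequence {q′ = q′} {qs} (_ , _ , y , s , d , r) {suc b} _ s′ d′ with end-unique s d s′ d′
  ... | refl = at-sequence {suc y} q′ (concatMap encodeSequence (toList qs)) r (before-end y d)

  chain-stands : ∀ {n a q} {qs : Vec (List Bin) n} {c} → AtSequence a q (concatMap encodeSequence (toList qs)) → Chain a c →
                 ∀ i → Stands (lookup (a ∷ c) i) (lookup (q ∷ qs) i) []
  chain-stands {q = q} {qs} at ch zero = stands {q = q} {concatMap encodeSequence (toList qs)} at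
  chain-stands {q = q} {q′ ∷ qs} {b ∷ c} at (0<b , s , d , ch) (suc i) =
    chain-stands {q = q′} {qs} (next-sequence {q = q} {q′ = q′} {qs = qs} at 0<b s d) ch i

  chain-exists : ∀ {n a q} (qs : Vec (List Bin) n) → AtSequence a q (concatMap encodeSequence (toList qs)) →
                 ∃[ c ] BoundedVec {n} c × Chain a c
  chain-exists []        at = [] , [] , tt
  chain-exists {q = q} (q′ ∷ qs) at@(_ , _ , y , s , d , _) =
    let c , bc , ch = chain-exists {q = q′} qs (next-sequence {q = q} {q′ = q′} {qs = qs} at {suc y} (s≤s z≤n) s d)
    in suc y ∷ c , symbol⇒< isDollar refl d ∷ bc , (s≤s z≤n , s , d , ch)

  starts-stand : ∀ {n} (qs : Vec (List Bin) n) {c} → w ≡ encodeNumber places ++ concatMap encodeSequence (toList qs) → Starts c →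
                 ∀ i → Stands (lookup c i) (lookup qs i) []
  starts-stand (q ∷ qs) {a ∷ c} eq (refl , ch) i = chain-stands {q = q} {qs} (at-start q (concatMap encodeSequence (toList qs)) eq) ch i

  starts-exist : ∀ {n} (qs : Vec (List Bin) n) → w ≡ encodeNumber places ++ concatMap encodeSequence (toList qs) →
                 ∃[ c ] BoundedVec {n} c × Starts c
  starts-exist []       eq = [] , [] , tt
  starts-exist (q ∷ qs) eq =
    let c , bc , ch = chain-exists {q = q} qs (at-start q (concatMap encodeSequence (toList qs)) eq)
    in 0 ∷ c , z≤n ∷ bc , (refl , ch)

  Represents : Configuration Q → Vec ℕ k → Set
  Represents D c = ∀ i → Stands (lookup c i) (lookup (rest D) i) (removed D i)

  represents-initial : ∀ {c} → Starts c → Represents (initial Q) c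
  represents-initial {c} st i =
    let h , b , a = starts-stand Q w≡ st i
    in h , trans b (sym (cong (map pallet) (trans (cong (λ n → take n (lookup Q i)) (ℕ.n∸n≡0 (length (lookup Q i)))) refl))) , a

  text-pallets : pallets text ≡ map bits (map plt (bins Q))
  text-pallets = trans (cong (pallets ∘ map letter) w≡) (trans (pallets-number (concatMap encodeSequence (toList Q)) places)
    (trans (cong (if_then digits (map letter (concatMap encodeSequence (toList Q))) ∷ pallets (map letter (concatMap encodeSequence (toList Q)))
                   else pallets (map letter (concatMap encodeSequence (toList Q)))) (odd-sequences (toList Q)))
      (trans (pallets-sequences (toList Q)) (List.map-∘ (bins Q)))))

  lastOpen-yes : ∀ {c s ts} → Open c s × s ∉ ts → lastOpen c (s ∷ ts) ≡ s ∷ lastOpen c ts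
  lastOpen-yes {c} {s} {ts} = if-yes (open? c s ×-dec ¬? (s ∈? ts))

  lastOpen-no : ∀ {c s ts} → ¬ (Open c s × s ∉ ts) → lastOpen c (s ∷ ts) ≡ lastOpen c ts
  lastOpen-no {c} {s} {ts} = if-no (open? c s ×-dec ¬? (s ∈? ts))

  ∈-lastOpen : ∀ c ts {t} → t ∈ lastOpen c ts ⇔ (t ∈ ts × Open c t)
  ∈-lastOpen c [] = mk⇔ (λ ()) (λ ())
  ∈-lastOpen c (s ∷ ts) {t} = by (open? c s ×-dec ¬? (s ∈? ts))
    where
    by : Dec (Open c s × s ∉ ts) → t ∈ lastOpen c (s ∷ ts) ⇔ (t ∈ s ∷ ts × Open c t)
    by (yes p) = subst (λ l → t ∈ l ⇔ (t ∈ s ∷ ts × Open c t)) (sym (lastOpen-yes p)) (mk⇔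
      (λ { (here refl) → here refl , proj₁ p ; (there t∈) → let t∈ts , o = to (∈-lastOpen c ts) t∈ in there t∈ts , o })
      (λ { (here refl , o) → here refl ; (there t∈ , o) → there (from (∈-lastOpen c ts) (t∈ , o)) }))
    by (no ¬p) = subst (λ l → t ∈ l ⇔ (t ∈ s ∷ ts × Open c t)) (sym (lastOpen-no ¬p)) (mk⇔
      (λ t∈ → let t∈ts , o = to (∈-lastOpen c ts) t∈ in there t∈ts , o)
      -- An open pallet is skipped only if it recurs, so it is found further on.
      (λ { (here refl , o) → from (∈-lastOpen c ts) (repeated o (s ∈? ts) , o) ; (there t∈ , o) → from (∈-lastOpen c ts) (t∈ , o) }))
      where
      repeated : Open c s → Dec (s ∈ ts) → s ∈ ts
      repeated o (yes s∈) = s∈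
      repeated o (no s∉)  = contradiction (o , s∉) ¬p

  unique-lastOpen : ∀ c ts → ListUnique.Unique (lastOpen c ts)
  unique-lastOpen c [] = ListAllPairs.[]
  unique-lastOpen c (s ∷ ts) = by (open? c s ×-dec ¬? (s ∈? ts))
    where
    by : Dec (Open c s × s ∉ ts) → ListUnique.Unique (lastOpen c (s ∷ ts))
    by (yes p) = subst ListUnique.Unique (sym (lastOpen-yes p)) (ListAll.tabulate fresh ListAllPairs.∷ unique-lastOpen c ts)
      where
      fresh : ∀ {t} → t ∈ lastOpen c ts → s ≢ t
      fresh t∈ refl = proj₂ p (proj₁ (to (∈-lastOpen c ts) t∈))
    by (no ¬p) = subst ListUnique.Unique (sym (lastOpen-no ¬p)) (unique-lastOpen c ts)

-- Processings correspond to walks of the pointers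

module Processings (k : ℕ) (I : StackUpInstance k) (w : List InputSymbol) (w≡ : w ≡ encodeInstance I) where

  open StackUpInstance I
  open StackUpFormulas k
  open Meaning w
  open Stages k w
  open Deciding k w using (Chain; Starts)
  open Configuration renaming (remaining to rest)
  open Bridge k I w w≡

  any⇔ : ∀ {n} q → Any (λ b → plt b ≡ n) q ⇔ bits n ∈ map pallet q
  any⇔ {n} q = mk⇔
    (λ p → let b , b∈ , eq = find p in subst (_∈ map pallet q) (cong bits eq) (∈-map⁺ pallet b∈))
    (λ n∈ → let b , b∈ , eq = ∈-map⁻ pallet n∈ in lose b∈ (bits-injective (sym eq)))

  open⇔ : ∀ {D c n} → Represents D c → IsOpen Q D n ⇔ Open c (bits n)
  open⇔ {D} {c} {n} rep = mk⇔
    (λ { ((i , p) , (j , q)) → (i , subst (bits n ∈_) (sym (proj₁ (rep i))) (to (any⇔ (lookup (rest D) i)) p)) ,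
                               (j , subst (bits n ∈_) (sym (proj₁ (proj₂ (rep j)))) (to (any⇔ (removed D j)) q)) })
    (λ { ((i , p) , (j , q)) → (i , from (any⇔ (lookup (rest D) i)) (subst (bits n ∈_) (proj₁ (rep i)) p)) ,
                               (j , from (any⇔ (removed D j)) (subst (bits n ∈_) (proj₁ (proj₂ (rep j))) q)) })

  -- Both lists are free of duplicates and `bits` is injective and carries the members of one to
  -- those of the other, so neither is longer.
  open-count : ∀ {D c} → Represents D c → length (openPallets Q D) ≡ length (lastOpen c (pallets text))
  open-count {D} {c} rep = ℕ.≤-antisym
      (subst (_≤ length L) (List.length-map bits O) (unique-length (ListUnique.map⁺ bits-injective unique-O) O⊆L))
      (subst (length L ≤_) (List.length-map bits O) (unique-length (unique-lastOpen c (pallets text)) L⊆O))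
    where
    O = openPallets Q D
    L = lastOpen c (pallets text)

    unique-O : ListUnique.Unique O
    unique-O = ListUnique.filter⁺ (isOpen? Q D) (deduplicate-! _≟_ (map plt (bins Q)))

    O⊆L : ∀ {t} → t ∈ map bits O → t ∈ L
    O⊆L t∈ = case ∈-map⁻ bits t∈ of λ { (n , n∈ , refl) →
      let n∈ps , o = ∈-filter⁻ (isOpen? Q D) {xs = palletSymbols Q} n∈ in
      from (∈-lastOpen c (pallets text))
        (subst (bits n ∈_) (sym text-pallets) (∈-map⁺ bits (∈-deduplicate⁻ _≟_ (map plt (bins Q)) n∈ps)) , to (open⇔ {D} {c} rep) o) }

    L⊆O : ∀ {t} → t ∈ L → t ∈ map bits O
    L⊆O {t} t∈ = let t∈text , o = to (∈-lastOpen c (pallets text)) t∈ in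
      case ∈-map⁻ bits (subst (t ∈_) text-pallets t∈text) of λ { (n , n∈ , eq) →
        subst (_∈ map bits O) (sym eq)
          (∈-map⁺ bits (∈-filter⁺ (isOpen? Q D) (∈-deduplicate⁺ _≟_ n∈) (from (open⇔ {D} {c} rep) (subst (Open c) eq o)))) }

  fits⇔ : ∀ {D c} → Represents D c → Fits c ⇔ length (openPallets Q D) ≤ places
  fits⇔ {D} {c} rep = mk⇔ (subst₂ _≤_ (sym (open-count {D} rep)) value) (subst₂ _≤_ (open-count {D} rep) (sym value))
    where
    value : fromDigits (digits (suff 1)) ≡ places
    value = trans (cong (fromDigits ∘ digits ∘ map letter) w≡)
      (trans (cong fromDigits (digits-number (concatMap encodeSequence (toList Q)) places)) (proj₂ (toDigits 2 places)))

  removed-++ : ∀ (D : Configuration Q) i → lookup Q i ≡ removed D i ++ lookup (rest D) i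
  removed-++ D i = ∖-++ (suffix D i)

  ahead-suc : ∀ {a} → ¬ T (isDollar (word a)) → Ahead a → Ahead (suc a)
  ahead-suc nd (_ , here , d)      = contradiction d nd
  ahead-suc nd (_ , there _ s , d) = _ , s , d

  -- Passing the end of a name is the removal of that bin. `E` is arbitrary because a transformation
  -- step prescribes only the remaining sequences of its target.
  take-one : ∀ {D c} i → Represents D c → ∀ {b bs} → lookup (rest D) i ≡ b ∷ bs → ∀ {E} → rest E ≡ rest D [ i ]≔ bs →
             Marker (lookup c i) → Represents E (c [ i ]≔ suc (lookup c i))
  take-one {D} {c} i rep {b} {bs} eq {E} eqE m j with i Fin.≟ j
  ... | no i≢j rewrite eqE | Vec.lookup∘update′ (i≢j ∘ sym) (rest D) bs | Vec.lookup∘update′ (i≢j ∘ sym) c (suc (lookup c i)) = rep j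
  ... | yes refl with view (lookup c i) | rep i
  ...   | end last≤ _         | _ = contradiction (marker⇒< m) (ℕ.≤⇒≯ last≤)
  ...   | dollar _ ¬m _ _ _ _ | _ = contradiction m ¬m
  ...   | other _ ¬m _ _ _ _  | _ = contradiction m ¬m
  ...   | marker _ _ nd _ ph pb | h , bf , a
    rewrite Vec.lookup∘update i c (suc (lookup c i)) =
      trans (proj₂ split) (cong (map pallet) (sym rest≡)) ,
      trans pb (trans (cong₂ (λ l t → l ++ [ t ]) bf (proj₁ split)) (trans (sym (List.map-++ pallet (removed D i) [ b ])) (cong (map pallet) (sym removed≡)))) ,
      ahead-suc nd a
    where
    rest≡ : lookup (rest E) i ≡ bs
    rest≡ = trans (cong (λ r → lookup r i) eqE) (Vec.lookup∘update i (rest D) bs)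

    removed≡ : removed E i ≡ removed D i ++ [ b ]
    -- Removed and remaining bins make up the same sequence in `D` and in `E`; cancelling the common
    -- suffix `bs` leaves the removed part.
    removed≡ = List.++-cancelʳ bs (removed E i) (removed D i ++ [ b ])
      (trans (cong (removed E i ++_) (sym rest≡)) (trans (sym (removed-++ E i)) (trans (removed-++ D i)
        (trans (cong (removed D i ++_) eq) (sym (List.++-assoc (removed D i) [ b ] bs))))))

    split = List.∷-injective (trans (sym ph) (trans h (cong (map pallet) eq)))

  pass-by : ∀ {D c} i → Represents D c → ¬ T (isDollar (word (lookup c i))) → ¬ Marker (lookup c i) →
            Represents D (c [ i ]≔ suc (lookup c i))
  pass-by {D} {c} i rep nd ¬m j with i Fin.≟ j
  ... | no i≢j rewrite Vec.lookup∘update′ (i≢j ∘ sym) c (suc (lookup c i)) = rep j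
  ... | yes refl with view (lookup c i) | rep i
  ...   | end last≤ _        | _ , _ , a = contradiction (ahead⇒< a) (ℕ.≤⇒≯ last≤)
  ...   | marker _ m _ _ _ _ | _ = contradiction m ¬m
  ...   | dollar _ _ d _ _ _ | _ = contradiction d nd
  ...   | other _ _ _ _ ph pb | h , bf , a
    rewrite Vec.lookup∘update i c (suc (lookup c i)) = trans (sym ph) h , trans pb bf , ahead-suc nd a

  at-end : ∀ {a q r} → Stands a q r → T (isDollar (word a)) → q ≡ []
  at-end {a} {q} (h , _ , _) d with view a
  ... | end last≤ _         = contradiction (symbol⇒< isDollar refl d) (ℕ.≤⇒≯ last≤)
  ... | marker _ _ nd _ _ _ = contradiction d nd
  ... | other _ _ nd _ _ _  = contradiction d nd
  ... | dollar _ _ _ _ p _  = map-[] (trans (sym h) p)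
    where
    map-[] : ∀ {q} → map pallet q ≡ [] → q ≡ []
    map-[] {[]} _ = refl

  at-marker : ∀ {a q r} → Stands a q r → Marker a → ∃[ b ] ∃[ bs ] q ≡ b ∷ bs
  at-marker {a} {q} (h , _ , _) m with view a
  ... | end last≤ _         = contradiction (marker⇒< m) (ℕ.≤⇒≯ last≤)
  ... | dollar _ ¬m _ _ _ _ = contradiction m ¬m
  ... | other _ ¬m _ _ _ _  = contradiction m ¬m
  ... | marker _ _ _ _ p _  = map-∷ (trans (sym h) p)
    where
    map-∷ : ∀ {q t ts} → map pallet q ≡ t ∷ ts → ∃[ b ] ∃[ bs ] q ≡ b ∷ bs
    map-∷ {b ∷ bs} _ = b , bs , refl

  marker? : ∀ a → Dec (Marker a)
  marker? a = T? (isHash (word a)) ×-dec T? (odd (suff (suc a)))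

  take-bin : ∀ (D : Configuration Q) i {b bs} → lookup (rest D) i ≡ b ∷ bs → Configuration Q
  take-bin D i {b} {bs} eq = record { remaining = rest D [ i ]≔ bs ; suffix = still }
    where
    still : ∀ j → Suffix _≡_ (lookup (rest D [ i ]≔ bs) j) (lookup Q j)
    still j with i Fin.≟ j
    ... | yes refl = subst (λ r → Suffix _≡_ r (lookup Q i)) (sym (Vec.lookup∘update i (rest D) bs))
                       (Suffix.tail (subst (λ r → Suffix _≡_ r (lookup Q i)) eq (suffix D i)))
    ... | no i≢j   = subst (λ r → Suffix _≡_ r (lookup Q j)) (sym (Vec.lookup∘update′ (i≢j ∘ sym) (rest D) bs)) (suffix D j)

  Completes : Configuration Q → Set
  Completes D = ∃[ E ] ∃[ ss ] IsFinal Q E × ListAll.All (λ D → length (openPallets Q D) ≤ places) (along Q {D} {E} ss)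

  -- Only a move past the end of a name becomes a transformation step; every other move still
  -- represents the same configuration.
  good⇒completes : ∀ {c D} → Good c → Represents D c → Completes D
  good⇒completes {c} {D} (finished f d) rep = D , ε , (λ i → at-end {lookup c i} {lookup (rest D) i} {removed D i} (rep i) (d i)) , to (fits⇔ {D} {c} rep) f ListAll.∷ ListAll.[]
  good⇒completes {c} {D} (advanced f i nd c< g) rep with marker? (lookup c i)
  ... | no ¬m = good⇒completes {c [ i ]≔ suc (lookup c i)} {D} g (pass-by {D} {c} i rep nd ¬m)
  ... | yes m with at-marker {lookup c i} {lookup (rest D) i} {removed D i} (rep i) m
  ...   | b , bs , eq =
      let E = take-bin D i eq
          F , ss , final , oks = good⇒completes {c [ i ]≔ suc (lookup c i)} {E} g (take-one {D} {c} i rep eq {E} refl m)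
      in F , (i , b , bs , eq , refl) ◅ ss , final , to (fits⇔ {D} {c} rep) f ListAll.∷ oks

  -- Before a bin is taken, the pointer of its sequence is driven on to the end of the name; after
  -- the last bin, all pointers are driven to the ends of their sequences. Such moves do not shorten
  -- `ss`, so the induction is on a bound `n` for the total distance left.
  completes⇒good : ∀ n {c D E} → remaining c < n → (ss : Star (_⟶_ Q) D E) → IsFinal Q E →
                   ListAll.All (λ D → length (openPallets Q D) ≤ places) (along Q ss) → Represents D c → Good c
  completes⇒good (suc n) {c} {D} (s≤s c≤n) ε final oks@(ok ListAll.∷ _) rep with Fin.all? {P = λ i → T (isDollar (word (lookup c i)))} (λ i → T? (isDollar (word (lookup c i))))
  ... | yes d = finished (from (fits⇔ {D} {c} rep) ok) d
  -- No bins are left, so a pointer not yet at the end of its sequence cannot be at the end of a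
  -- name, and moving it keeps the configuration.
  ... | no ¬d with Fin.¬∀⟶∃¬ k (λ i → T (isDollar (word (lookup c i)))) (λ i → T? (isDollar (word (lookup c i)))) ¬d
  ...   | i , nd = advanced (from (fits⇔ {D} {c} rep) ok) i nd c<
      (completes⇒good n {c [ i ]≔ suc (lookup c i)} (ℕ.<-≤-trans (remaining-update c i c<) c≤n) ε final oks (pass-by {D} {c} i rep nd ¬m))
    where
    c< = ahead⇒< (proj₂ (proj₂ (rep i)))
    ¬m : ¬ Marker (lookup c i)
    ¬m m with at-marker {lookup c i} {lookup (rest D) i} {removed D i} (rep i) m
    ... | b , bs , eq = case trans (sym (final i)) eq of λ ()
  completes⇒good (suc n) {c} {D} (s≤s c≤n) ss@(_◅_ {j = D′} (i , b , bs , eq , eqE) ss′) final oks@(ok ListAll.∷ oks′) rep with marker? (lookup c i)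
  ... | yes m = advanced (from (fits⇔ {D} {c} rep) ok) i nd c<
      (completes⇒good n {c [ i ]≔ suc (lookup c i)} (ℕ.<-≤-trans (remaining-update c i c<) c≤n) ss′ final oks′ (take-one {D} {c} i rep eq {D′} eqE m))
    where
    c< = ahead⇒< (proj₂ (proj₂ (rep i)))
    nd : ¬ T (isDollar (word (lookup c i)))
    nd d = case trans (sym eq) (at-end {lookup c i} {lookup (rest D) i} {removed D i} (rep i) d) of λ ()
  ... | no ¬m = advanced (from (fits⇔ {D} {c} rep) ok) i nd c<
      (completes⇒good n {c [ i ]≔ suc (lookup c i)} (ℕ.<-≤-trans (remaining-update c i c<) c≤n) ss final oks (pass-by {D} {c} i rep nd ¬m))
    where
    c< = ahead⇒< (proj₂ (proj₂ (rep i)))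
    nd : ¬ T (isDollar (word (lookup c i)))
    nd d = case trans (sym eq) (at-end {lookup c i} {lookup (rest D) i} {removed D i} (rep i) d) of λ ()

  yes⇔ : (∃[ c ] BoundedVec c × Starts c × Good c) ⇔ (∃[ π ] UsesAtMost Q places π)
  yes⇔ = mk⇔
    (λ { (c , _ , st , g) → let E , ss , final , oks = good⇒completes {c} {initial Q} g (represents-initial {c} st) in (E , ss , final) , oks })
    (λ { ((E , ss , final) , oks) → let c , bc , st = starts-exist Q w≡ in
       c , bc , st , completes⇒good (suc (remaining c)) {c} ℕ.≤-refl ss final oks (represents-initial {c} st) })

-- The Turing machine for the stack-up problem

module Machine (k : ℕ) where

  open StackUpFormulas k

  -- Opaque because conversion checking would otherwise unfold the whole program and its cost.
  opaque
    program : Prog Bool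
    program = decide (family params formula) (startF cs (call goodᴿ cs))

    time : Poly
    time = decideCost (family params formula) (startF cs (call goodᴿ cs))

    program-decides : ∀ w → ∃[ b ] ∃[ s ] Spec program (Meaning.empty w) (⟦ time ⟧ₚ (Meaning.B w)) b s ×
      (T b ⇔ (∃[ c ] Meaning.BoundedVec w c × Deciding.Starts k w c × Meaning.Good w c))
    program-decides w = Deciding.decides k w

  open TuringMachine (machine program) using (initialConfiguration; _⇓[_]_; accepting)

  a d : ℕ
  a = proj₁ (poly-time time)
  d = proj₁ (proj₂ (poly-time time))

  time≤ : ∀ n → ⟦ time ⟧ₚ (2 + n) ≤ a * n ^ d + a
  time≤ = proj₂ (proj₂ (poly-time time))

  run : ∀ (I : StackUpInstance k) w → w ≡ encodeInstance I → ∃[ n ] ∃[ c ]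
        initialConfiguration w ⇓[ n ] c × n ≤ a * length w ^ d + a ×
        (accepting (proj₁ c) ≡ true ⇔ DecisionProblem.Yes (StackUp k) I)
  run I w w≡ =
    let b , s , spec , correct = program-decides w
        n , ts , n≤ , reaches , _ = spec _ (Meaning.input-tapes w)
    in n , (inj₂ b , ts) , machine-runs program reaches , ℕ.≤-trans n≤ (time≤ (length w)) ,
       mk⇔ (λ e → to (Processings.yes⇔ k I w w≡) (to correct (from T-≡ e)))
           (λ y → to T-≡ (from correct (from (Processings.yes⇔ k I w w≡) y)))

theorem7 : ∀ (k : ℕ) .{{_ : NonZero k}} → SolvableInPolynomialTime (StackUp k)
theorem7 k = machine program , a , d , λ I → run I (encodeInstance I) refl
  where
  open StackUpFormulas k
  open Machine k
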